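{- Let $n\ge1$. The map $\mathrm{ruffle}:\mathrm{Ruffle}_n\to S_n$ does the right thing with respect to $\mathrm{hand}$ on $\mathrm{Ruffle}_n$ and the turning number on $S_n$; moreover the projection $\pi:\bar S_n\to S_n$ that forgets orientations does the right thing with respect to the oriented rising number on $\bar S_n$ and the turning number on $S_n$. Consequently the turning number is a lumping of $S_n$: the sums $\sum_\sigma\sigma$ over all $\sigma\in S_n$ with a given number of turning points form a basis of a subalgebra of the group algebra $\mathbf{Q}[S_n]$ (the turning algebra), and this subalgebra is commutative.
   Context: Permutations are composed left to right: $(\sigma\tau)(i)=\tau(\sigma(i))$. $S_n$ is the symmetric group on $\{1,\dots,n\}$; $\sigma(i)$ is the position to which the card originally in position $i$ is moved. $\bar S_n$ is the group of oriented (signed) permutations: bijections $w$ of $\{\pm1,\dots,\pm n\}$ with $w(-i)=-w(i)$, also composed left to right; the card in position $i$ is moved to position $|w(i)|$ and is turned over iff $w(i)<0$. The projection is $\pi(w)(i)=|w(i)|$. A permutation $\sigma\in S_n$ has a turning point at $i$, $1\le i<n$, if, setting $\sigma(0)=0$ and interpolating linearly to a piecewise linear map on $[0,n]$, the graph has a local maximum or minimum at $i$; i.e. $\sigma(i)-\sigma(i-1)$ and $\sigma(i+1)-\sigma(i)$ have opposite signs. (So $1$ is a turning point iff $\sigma(2)<\sigma(1)$, and $n$ is never one.) The turning number of $\sigma$ is its number of turning points. The ruffle monoid $\mathrm{Ruffle}_n$ has as elements the pairs $(a,x)$, with $a\ge1$ an integer and $x=(x_1,\dots,x_n)$ integers,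 $0\le x_i<a$. Each $(a,x)$ describes an $a$-handed ruffle: let $c_j=\#\{i:x_i=j\}$; hand $j$ ($0\le j<a$) receives the cards $c_0+\dots+c_{j-1}+1,\dots,c_0+\dots+c_j$; the odd-numbered hands are turned over as a bunch (order reversed, each card's orientation flipped); then the hands are interleaved so that the card in final position $i$ comes from hand $x_i$. Thus, in the positions $i$ with $x_i=j$, read in increasing order, the cards of hand $j$ appear in increasing order and unflipped if $j$ is even, and in decreasing order and flipped if $j$ is odd. The resulting oriented permutation is $\mathrm{orientedruffle}(a,x)\in\bar S_n$, and $\mathrm{ruffle}(a,x)=\pi(\mathrm{orientedruffle}(a,x))\in S_n$. $S_n$ acts on lists by $(x^\sigma)_{\sigma(i)}=x_i$. The product in $\mathrm{Ruffle}_n$ is $(a,x)*(b,y)=(ab,z)$, where, with $x'=x^{\mathrm{ruffle}(b,y)}$, $z_i=bx'_i+y_i$ if $x'_i$ is even and $z_i=bx'_i+b-1-y_i$ if $x'_i$ is odd. The function $\mathrm{hand}$ on $\mathrm{Ruffle}_n$ is $\mathrm{hand}(a,x)=a$. The oriented rising number of $w\in\bar S_n$ is the minimum $a$ such that $w=\mathrm{orientedruffle}(a,x)$ for some $x$. A function $\mu$ on a monoid $M$ is a lumping if its equivalence classes (level sets) are finite and the class sums form a basis of a subalgebra of $\mathbf{Q}[M]$ (a linear subspace closed under multiplication). Given a lumping $\mu$ of $M$ and a function $\nu$ with finite level sets on a monoid $N$, a monoid homomorphism $f:M\to N$ does the right thing with respect to $\mu$ and $\nu$ if the elements $\sum_{x\in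 C}f(x)$, $C$ ranging over the $\mu$-classes, belong to and span the subspace of $\mathbf{Q}[N]$ spanned by the class sums of $\nu$. The function $\mathrm{hand}$ is a lumping of $\mathrm{Ruffle}_n$, and the oriented rising number is a lumping of $\bar S_n$. -}

module Defs where

open import Algebra.Bundles using (Monoid)
open import Algebra.Morphism.Structures using (module MonoidMorphisms)
open import Algebra.Properties.CommutativeSemigroup using (interchange)
open import Data.Fin.Base as Fin using (Fin; zero; suc; toℕ; fromℕ; fromℕ<; inject₁; punchOut; finToFun; funToFin)
open import Data.Fin.Induction using (<-weakInduction; >-weakInduction)
open import Data.Fin.Permutation as Perm using (Permutation′; permutation; _⟨$⟩ʳ_; _⟨$⟩ˡ_; _∘ₚ_)
import Data.Fin.Properties as Fin
open import Data.List.Base using (List; []; _∷_; _++_; map; concatMap; cartesianProductWith; filter; length; tabulate; allFin)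
open import Data.List.Membership.Propositional.Properties using (∈-allFin)
import Data.List.Membership.Setoid as Membership
open import Data.List.Properties using (filter-notAll; filter-≐; filter-none; length-tabulate)
open import Data.List.Relation.Unary.All using (All)
import Data.List.Relation.Unary.All.Properties as All
open import Data.List.Relation.Unary.AllPairs using (AllPairs)
open import Data.List.Relation.Unary.Any using (Any; here; there)
import Data.List.Relation.Unary.Any as Any
import Data.List.Relation.Unary.Unique.Setoid as Uniqueness
open import Data.Nat.Base using (ℕ; zero; suc; _+_; _*_; _∸_; _^_; _≤_; _<_; z≤n; s≤s; parity)
open import Data.Nat.Properties
open import Data.Parity.Base as ℙ using (Parity; 0ℙ; 1ℙ; toSign)
import Data.Parity.Properties as ℙ
open import Data.Product.Base using (Σ; ∃; _×_; _,_; proj₁; proj₂)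
open import Data.Product.Properties using (≡-dec)
open import Data.Rational.Base as ℚ using (ℚ; 0ℚ; 1ℚ)
open import Data.Sign.Base as Sign using (Sign)
import Data.Sign.Properties as Sign
open import Data.Sum.Base using (_⊎_; inj₁; inj₂)
open import Function.Base using (_∘_)
open import Function.Bundles using (Inverse; _↔_; _⇔_; mk↔ₛ′)
open import Function.Construct.Composition using (_↔-∘_)
open import Function.Construct.Identity using (↔-id)
open import Function.Definitions using (Injective)
open import Level using (0ℓ)
open import Relation.Binary.Bundles using (Setoid)
import Relation.Binary.Construct.On as On
open import Relation.Binary.Core using (Rel)
open import Relation.Binary.Definitions using (tri<; tri≈; tri>)
import Relation.Binary.Definitions as Binary
open import Relation.Binary.PropositionalEquality as ≡ hiding (setoid)
open import Relation.Nullary.Decidable using (Dec; yes; no; does; _×-dec_; _⊎-dec_; map′)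
open import Relation.Nullary.Negation using (¬_; contradiction)
open import Relation.Unary using (Pred; Decidable)
open import Data.Bool.Base using (if_then_else_)

-- Interleaved with the definitions are the lemmas showing that they make
-- sense: a ruffle is a bijection, ruffles form a monoid (because
-- orientedRuffle is multiplicative), and the oriented rising number exists.

#_ : ∀ {n} {P : Pred (Fin n) 0ℓ} → Decidable P → ℕ
#_ {n} P? = length (filter P? (allFin n))

module _ {A : Set} {P Q : Pred A 0ℓ} (P? : Decidable P) (Q? : Decidable Q) where

  length-filter-mono : (∀ x → P x → Q x) → ∀ xs → length (filter P? xs) ≤ length (filter Q? xs)
  length-filter-mono P⊆Q [] = z≤n
  length-filter-mono P⊆Q (x ∷ xs) with P? x | Q? x
  ... | yes p | yes q = s≤s (length-filter-mono P⊆Q xs)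
  ... | yes p | no ¬q = contradiction (P⊆Q x p) ¬q
  ... | no ¬p | yes q = m≤n⇒m≤1+n (length-filter-mono P⊆Q xs)
  ... | no ¬p | no ¬q = length-filter-mono P⊆Q xs

  length-filter-strict : (∀ x → P x → Q x) → ∀ {xs} → Any (λ x → Q x × ¬ P x) xs →
                         length (filter P? xs) < length (filter Q? xs)
  length-filter-strict P⊆Q {x ∷ xs} (here (q , ¬p)) with P? x | Q? x
  ... | yes p | _     = contradiction p ¬p
  ... | no _  | yes _ = s≤s (length-filter-mono P⊆Q xs)
  ... | no _  | no ¬q = contradiction q ¬q
  length-filter-strict P⊆Q {x ∷ xs} (there any) with P? x | Q? x
  ... | yes p | yes q = s≤s (length-filter-strict P⊆Q any)
  ... | yes p | no ¬q = contradiction (P⊆Q x p) ¬q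
  ... | no ¬p | yes q = m≤n⇒m≤1+n (length-filter-strict P⊆Q any)
  ... | no ¬p | no ¬q = length-filter-strict P⊆Q any

length-filter-⊎ : {A : Set} {P Q R : Pred A 0ℓ}
  (P? : Decidable P) (Q? : Decidable Q) (R? : Decidable R) →
  (∀ x → R x → P x ⊎ Q x) → (∀ x → P x → R x) → (∀ x → Q x → R x) → (∀ x → P x → ¬ Q x) →
  ∀ xs → length (filter R? xs) ≡ length (filter P? xs) + length (filter Q? xs)
length-filter-⊎ P? Q? R? r p q d [] = refl
length-filter-⊎ P? Q? R? r p q d (x ∷ xs)
  with ih ← length-filter-⊎ P? Q? R? r p q d xs | P? x | Q? x | R? x
... | yes px | yes qx | _      = contradiction qx (d x px)
... | yes px | no ¬qx | yes rx = cong suc ih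
... | no ¬px | yes qx | yes rx = trans (cong suc ih) (sym (+-suc _ _))
... | no ¬px | no ¬qx | no ¬rx = ih
... | yes px | no ¬qx | no ¬rx = contradiction (p x px) ¬rx
... | no ¬px | yes qx | no ¬rx = contradiction (q x qx) ¬rx
... | no ¬px | no ¬qx | yes rx with r x rx
...   | inj₁ px = contradiction px ¬px
...   | inj₂ qx = contradiction qx ¬qx

length-filter-≟ : ∀ {A : Set} {n} (_≟A_ : Binary.Decidable {A = A} _≡_) (f : Fin n → A) →
  Injective _≡_ _≡_ f → ∀ i → length (filter (_≟A f i) (tabulate f)) ≡ 1
length-filter-≟ _≟A_ f inj zero with f zero ≟A f zero
... | yes _  = cong suc (cong length (filter-none (_≟A f zero)
                 (All.tabulate⁺ {f = f ∘ suc} (λ j eq → Fin.0≢1+n (inj {zero} {suc j} (sym eq))))))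
... | no f0≢ = contradiction refl f0≢
length-filter-≟ _≟A_ f inj (suc i) with f zero ≟A f (suc i)
... | yes f0≡ = contradiction (inj f0≡) Fin.0≢1+n
... | no _    = length-filter-≟ _≟A_ (f ∘ suc) (Fin.suc-injective ∘ inj) i

#-≟ : ∀ {n} (i : Fin n) → # (Fin._≟ i) ≡ 1
#-≟ = length-filter-≟ Fin._≟_ (λ i → i) (λ eq → eq)

any-∈ : ∀ {n} {P : Pred (Fin n) 0ℓ} i → P i → Any P (allFin n)
any-∈ i p = Any.map (λ { refl → p }) (∈-allFin i)

injective⇒hits : ∀ {n} (f : Fin n → Fin n) → Injective _≡_ _≡_ f → ∀ j → ∃ λ i → f i ≡ j
injective⇒hits {suc n} f inj j with Fin.any? (λ i → f i Fin.≟ j)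
... | yes hit = hit
... | no miss = contradiction
        (Fin.injective⇒≤ {f = λ i → punchOut {i = j} {j = f i} (λ eq → miss (i , sym eq))}
           (λ eq → inj (Fin.punchOut-injective (λ e → miss (_ , sym e)) (λ e → miss (_ , sym e)) eq)))
        1+n≰n

strictlyMonotone⇒id : ∀ {n} (h : Fin n → Fin n) → (∀ {i j} → i Fin.< j → h i Fin.< h j) → ∀ i → h i ≡ i
strictlyMonotone⇒id {suc n} h mono i = Fin.toℕ-injective (≤-antisym (upper i) (lower i))
  where
  step : ∀ i → inject₁ i Fin.< suc i
  step i = ≤-reflexive (cong suc (Fin.toℕ-inject₁ i))
  lower : ∀ i → toℕ i ≤ toℕ (h i)
  lower = <-weakInduction (λ i → toℕ i ≤ toℕ (h i)) z≤n
    (λ i ih → ≤-trans (s≤s (subst (_≤ toℕ (h (inject₁ i))) (Fin.toℕ-inject₁ i) ih)) (mono (step i)))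
  upper : ∀ i → toℕ (h i) ≤ toℕ i
  upper = >-weakInduction (λ i → toℕ (h i) ≤ toℕ i)
    (subst (toℕ (h (fromℕ n)) ≤_) (sym (Fin.toℕ-fromℕ n)) (Fin.toℕ≤pred[n] (h (fromℕ n))))
    (λ i ih → subst (toℕ (h (inject₁ i)) ≤_) (sym (Fin.toℕ-inject₁ i))
      (≤-pred (≤-trans (mono (step i)) ih)))

record DecMonoid : Set₁ where
  field
    monoid : Monoid 0ℓ 0ℓ
    _≈?_   : Binary.Decidable (Monoid._≈_ monoid)
  open Monoid monoid public

-- The symmetric group, composed left to right: (σ ∘ₚ τ) i = τ (σ i).
-- Positions and cards 1,…,n are represented by Fin n, so position i of
-- the mathematics is the element of Fin n with toℕ equal to i - 1.

𝕊 : ℕ → DecMonoid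
𝕊 n = record
  { monoid = record
    { Carrier  = Permutation′ n
    ; _≈_      = Perm._≈_
    ; _∙_      = _∘ₚ_
    ; ε        = Perm.id
    ; isMonoid = record
      { isSemigroup = record
        { isMagma = record
          { isEquivalence = record
            { refl  = λ _ → refl
            ; sym   = λ eq i → sym (eq i)
            ; trans = λ eq eq′ i → trans (eq i) (eq′ i)
            }
          ; ∙-cong = λ {_} {σ′} {τ} eq eq′ i → trans (cong (τ ⟨$⟩ʳ_) (eq i)) (eq′ (σ′ ⟨$⟩ʳ i))
          }
        ; assoc = λ _ _ _ _ → refl
        }
      ; identity = (λ _ _ → refl) , (λ _ _ → refl)
      }
    }
  ; _≈?_ = λ σ τ → Fin.all? (λ i → (σ ⟨$⟩ʳ i) Fin.≟ (τ ⟨$⟩ʳ i))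
  }

-- The set {±1,…,±n}.
± : ℕ → Set
± n = Sign × Fin n

neg : ∀ {n} → ± n → ± n
neg (s , i) = (Sign.opposite s , i)

record OrientedPerm (n : ℕ) : Set where
  field
    bijection : ± n ↔ ± n
  open Inverse bijection public using (to; from; strictlyInverseˡ; strictlyInverseʳ)
  field
    odd : ∀ x → to (neg x) ≡ neg (to x)

open OrientedPerm public using (odd)

infix 6 _≈±_

_≈±_ : ∀ {n} → Rel (OrientedPerm n) 0ℓ
w ≈± v = ∀ x → OrientedPerm.to w x ≡ OrientedPerm.to v x

odd-from : ∀ {n} (w : OrientedPerm n) x → OrientedPerm.from w (neg x) ≡ neg (OrientedPerm.from w x)
odd-from w x = begin
  from (neg x)               ≡⟨ cong (from ∘ neg) (strictlyInverseˡ x) ⟨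
  from (neg (to (from x)))   ≡⟨ cong from (odd w (from x)) ⟨
  from (to (neg (from x)))   ≡⟨ strictlyInverseʳ _ ⟩
  neg (from x)               ∎
  where
  open ≡-Reasoning
  open OrientedPerm w using (to; from; strictlyInverseˡ; strictlyInverseʳ)

odd-* : ∀ {n} (f : ± n → ± n) → (∀ x → f (neg x) ≡ neg (f x)) →
        ∀ s i → f (s , i) ≡ (s Sign.* proj₁ (f (Sign.+ , i)) , proj₂ (f (Sign.+ , i)))
odd-* f f-odd Sign.+ i = refl
odd-* f f-odd Sign.- i = f-odd (Sign.+ , i)

≈±-from : ∀ {n} (w v : OrientedPerm n) → (∀ x → OrientedPerm.from w x ≡ OrientedPerm.from v x) → w ≈± v
≈±-from w v eq x = begin
  W.to x                     ≡⟨ cong W.to (V.strictlyInverseʳ x) ⟨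
  W.to (V.from (V.to x))     ≡⟨ cong W.to (eq (V.to x)) ⟨
  W.to (W.from (V.to x))     ≡⟨ W.strictlyInverseˡ _ ⟩
  V.to x                     ∎
  where
  open ≡-Reasoning
  module W = OrientedPerm w
  module V = OrientedPerm v

𝕊± : ℕ → DecMonoid
𝕊± n = record
  { monoid = record
    { Carrier  = OrientedPerm n
    ; _≈_      = _≈±_
    ; _∙_      = λ w v → record
      { bijection = OrientedPerm.bijection v ↔-∘ OrientedPerm.bijection w
      ; odd       = λ x → trans (cong (OrientedPerm.to v) (odd w x)) (odd v (OrientedPerm.to w x))
      }
    ; ε        = record { bijection = ↔-id _ ; odd = λ _ → refl }
    ; isMonoid = record
      { isSemigroup = record
        { isMagma = record
          { isEquivalence = record
            { refl  = λ _ → refl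
            ; sym   = λ eq x → sym (eq x)
            ; trans = λ eq eq′ x → trans (eq x) (eq′ x)
            }
          ; ∙-cong = λ {_} {w′} {v} eq eq′ x →
              trans (cong (OrientedPerm.to v) (eq x)) (eq′ (OrientedPerm.to w′ x))
          }
        ; assoc = λ _ _ _ _ → refl
        }
      ; identity = (λ _ _ → refl) , (λ _ _ → refl)
      }
    }
  ; _≈?_ = λ w v →
      map′ (λ { (p , m) (Sign.+ , i) → p i ; (p , m) (Sign.- , i) → m i })
           (λ eq → (λ i → eq (Sign.+ , i)) , (λ i → eq (Sign.- , i)))
           (agree? w v Sign.+ ×-dec agree? w v Sign.-)
  }
  where
  agree? : (w v : OrientedPerm n) (s : Sign) →
           Dec (∀ i → OrientedPerm.to w (s , i) ≡ OrientedPerm.to v (s , i))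
  agree? w v s = Fin.all? (λ i → ≡-dec Sign._≟_ Fin._≟_ (OrientedPerm.to w (s , i)) (OrientedPerm.to v (s , i)))

π : ∀ {n} → OrientedPerm n → Permutation′ n
π {n} w = permutation
  (λ i → proj₂ (to (Sign.+ , i)))
  (λ i → proj₂ (from (Sign.+ , i)))
  (λ i → trans (sign-irrelevant to (odd w) (from (Sign.+ , i))) (cong proj₂ (strictlyInverseˡ (Sign.+ , i))))
  (λ i → trans (sign-irrelevant from (odd-from w) (to (Sign.+ , i))) (cong proj₂ (strictlyInverseʳ (Sign.+ , i))))
  where
  open OrientedPerm w using (to; from; strictlyInverseˡ; strictlyInverseʳ)
  sign-irrelevant : (f : ± n → ± n) → (∀ x → f (neg x) ≡ neg (f x)) →
                    ∀ x → proj₂ (f (Sign.+ , proj₂ x)) ≡ proj₂ (f x)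
  sign-irrelevant f f-odd (s , i) = sym (cong proj₂ (odd-* f f-odd s i))

-- `source i` is the hand from which the card in final position i comes.
record Ruffle (n : ℕ) : Set where
  field
    hand        : ℕ
    hand≥1      : 1 ≤ hand
    source      : Fin n → ℕ
    source<hand : ∀ i → source i < hand

open Ruffle public

_≈ᴿ_ : ∀ {n} → Rel (Ruffle n) 0ℓ
r ≈ᴿ s = hand r ≡ hand s × (∀ i → source r i ≡ source s i)

module _ {n : ℕ} (x : Fin n → ℕ) where

  handSize : ℕ → ℕ
  handSize j = # (λ i → x i ≟ j)

  -- c₀ + … + c_{j-1}
  offset : ℕ → ℕ
  offset zero    = 0
  offset (suc j) = offset j + handSize j

  -- The number of earlier positions filled from the same hand.
  rank : Fin n → ℕ
  rank i = # (λ k → (k Fin.<? i) ×-dec (x k ≟ x i))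

  -- A hand's cards are taken in increasing order if it is even and in
  -- decreasing order if it is odd.  No truncation: rank i < handSize (x i).
  withinHand : Parity → Fin n → ℕ
  withinHand 0ℙ i = rank i
  withinHand 1ℙ i = handSize (x i) ∸ suc (rank i)

  -- The card (counted from 0) that ends up in position i.
  cardNumber : Fin n → ℕ
  cardNumber i = offset (x i) + withinHand (parity (x i)) i

-- The order of the positions by the card they receive; cardNumber is the rank
-- function of this total order on positions.
Towards : ∀ {n} → Parity → Rel (Fin n) 0ℓ
Towards 0ℙ i k = i Fin.< k
Towards 1ℙ i k = k Fin.< i

Precedes : ∀ {n} → (Fin n → ℕ) → Rel (Fin n) 0ℓ
Precedes x i k = x i < x k ⊎ (x i ≡ x k × Towards (parity (x k)) i k)

towards? : ∀ {n} p (i k : Fin n) → Dec (Towards p i k)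
towards? 0ℙ i k = i Fin.<? k
towards? 1ℙ i k = k Fin.<? i

precedes? : ∀ {n} (x : Fin n → ℕ) i k → Dec (Precedes x i k)
precedes? x i k = (x i <? x k) ⊎-dec ((x i ≟ x k) ×-dec towards? (parity (x k)) i k)

towards-trans : ∀ {n} p {i j k : Fin n} → Towards p i j → Towards p j k → Towards p i k
towards-trans 0ℙ i<j j<k = <-trans i<j j<k
towards-trans 1ℙ j<i k<j = <-trans k<j j<i

precedes-trans : ∀ {n} (x : Fin n → ℕ) {i j k} → Precedes x i j → Precedes x j k → Precedes x i k
precedes-trans x {i} {j} {k} (inj₁ a) (inj₁ b) = inj₁ (<-trans a b)
precedes-trans x {i} {j} {k} (inj₁ a) (inj₂ (b , _)) = inj₁ (subst (x i <_) b a)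
precedes-trans x {i} {j} {k} (inj₂ (a , _)) (inj₁ b) = inj₁ (subst (_< x k) (sym a) b)
precedes-trans x {i} {j} {k} (inj₂ (a , s)) (inj₂ (b , t)) =
  inj₂ (trans a b , towards-trans (parity (x k)) (subst (λ m → Towards (parity m) i j) b s) t)

precedes-irrefl : ∀ {n} (x : Fin n → ℕ) {i} → ¬ Precedes x i i
precedes-irrefl x (inj₁ a) = <-irrefl refl a
precedes-irrefl x {i} (inj₂ (_ , t)) with parity (x i)
... | 0ℙ = <-irrefl refl t
... | 1ℙ = <-irrefl refl t

towards-total : ∀ {n} p (i k : Fin n) → Towards p i k ⊎ i ≡ k ⊎ Towards p k i
towards-total p i k with p | Fin.<-cmp i k
... | 0ℙ | tri< a _ _ = inj₁ a
... | 1ℙ | tri< a _ _ = inj₂ (inj₂ a)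
... | _  | tri≈ _ a _ = inj₂ (inj₁ a)
... | 0ℙ | tri> _ _ a = inj₂ (inj₂ a)
... | 1ℙ | tri> _ _ a = inj₁ a

precedes-total : ∀ {n} (x : Fin n → ℕ) i k → Precedes x i k ⊎ i ≡ k ⊎ Precedes x k i
precedes-total x i k with <-cmp (x i) (x k)
... | tri< a _ _ = inj₁ (inj₁ a)
... | tri> _ _ a = inj₂ (inj₂ (inj₁ a))
... | tri≈ _ a _ with towards-total (parity (x k)) i k
...   | inj₁ t = inj₁ (inj₂ (a , t))
...   | inj₂ (inj₁ t) = inj₂ (inj₁ t)
...   | inj₂ (inj₂ t) = inj₂ (inj₂ (inj₂ (sym a , subst (λ m → Towards (parity m) k i) (sym a) t)))

offset-count : ∀ {n} (x : Fin n → ℕ) j → offset x j ≡ # (λ k → x k <? j)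
offset-count {n} x zero = sym (cong length (filter-none (λ k → x k <? 0) (All.tabulate⁺ {n = n} (λ _ ()))))
offset-count {n} x (suc j) = trans (cong (_+ handSize x j) (offset-count x j)) (sym
  (length-filter-⊎ (λ k → x k <? j) (λ k → x k ≟ j) (λ k → x k <? suc j)
    (λ k lt → m≤n⇒m<n∨m≡n (≤-pred lt)) (λ k lt → m≤n⇒m≤1+n lt) (λ k eq → s≤s (≤-reflexive eq))
    (λ k → <⇒≢) (allFin n)))

later-count : ∀ {n} (x : Fin n → ℕ) i →
  handSize x (x i) ≡ suc (rank x i) + # (λ k → (i Fin.<? k) ×-dec (x k ≟ x i))
later-count {n} x i = begin
  handSize x (x i)
    ≡⟨ length-filter-⊎ earlier? atLeast? (λ k → x k ≟ x i)
         (λ k eq → split k eq) (λ k → proj₂) (λ k → proj₂)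
         (λ k p q → <⇒≱ (proj₁ p) (proj₁ q)) (allFin n) ⟩
  rank x i + # atLeast?
    ≡⟨ cong (rank x i +_) (length-filter-⊎ (Fin._≟ i) later? atLeast?
         (λ k p → split′ k p) (λ { k refl → ≤-refl , refl }) (λ k p → <⇒≤ (proj₁ p) , proj₂ p)
         (λ { k refl p → <-irrefl refl (proj₁ p) }) (allFin n)) ⟩
  rank x i + (# (Fin._≟ i) + # later?)
    ≡⟨ cong (λ m → rank x i + (m + # later?)) (#-≟ i) ⟩
  rank x i + suc (# later?)
    ≡⟨ +-suc _ _ ⟩
  suc (rank x i + # later?) ∎
  where
  open ≡-Reasoning
  earlier? : Decidable (λ k → k Fin.< i × x k ≡ x i)
  earlier? k = (k Fin.<? i) ×-dec (x k ≟ x i)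
  atLeast? : Decidable (λ k → i Fin.≤ k × x k ≡ x i)
  atLeast? k = (i Fin.≤? k) ×-dec (x k ≟ x i)
  later? : Decidable (λ k → i Fin.< k × x k ≡ x i)
  later? k = (i Fin.<? k) ×-dec (x k ≟ x i)
  split : ∀ k → x k ≡ x i → (k Fin.< i × x k ≡ x i) ⊎ (i Fin.≤ k × x k ≡ x i)
  split k eq with k Fin.<? i
  ... | yes lt = inj₁ (lt , eq)
  ... | no ≮ = inj₂ (≮⇒≥ ≮ , eq)
  split′ : ∀ k → i Fin.≤ k × x k ≡ x i → k ≡ i ⊎ (i Fin.< k × x k ≡ x i)
  split′ k (le , eq) with m≤n⇒m<n∨m≡n le
  ... | inj₁ lt = inj₂ (lt , eq)
  ... | inj₂ e  = inj₁ (Fin.toℕ-injective (sym e))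

withinHand-count : ∀ {n} (x : Fin n → ℕ) p i →
  withinHand x p i ≡ # (λ k → (x k ≟ x i) ×-dec towards? p k i)
withinHand-count {n} x 0ℙ i = cong length (filter-≐ _ _ ((λ (a , b) → b , a) , (λ (a , b) → b , a)) (allFin n))
withinHand-count {n} x 1ℙ i = begin
  handSize x (x i) ∸ suc (rank x i)
    ≡⟨ cong (_∸ suc (rank x i)) (later-count x i) ⟩
  suc (rank x i) + # (λ k → (i Fin.<? k) ×-dec (x k ≟ x i)) ∸ suc (rank x i)
    ≡⟨ m+n∸m≡n (suc (rank x i)) _ ⟩
  # (λ k → (i Fin.<? k) ×-dec (x k ≟ x i))
    ≡⟨ cong length (filter-≐ _ _ ((λ (a , b) → b , a) , (λ (a , b) → b , a)) (allFin n)) ⟩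
  # (λ k → (x k ≟ x i) ×-dec (i Fin.<? k)) ∎
  where open ≡-Reasoning

cardNumber-count : ∀ {n} (x : Fin n → ℕ) i → cardNumber x i ≡ # (λ k → precedes? x k i)
cardNumber-count {n} x i = trans
  (cong₂ _+_ (offset-count x (x i)) (withinHand-count x (parity (x i)) i))
  (sym (length-filter-⊎ (λ k → x k <? x i) (λ k → (x k ≟ x i) ×-dec towards? (parity (x i)) k i)
    (λ k → precedes? x k i) (λ k p → p) (λ k → inj₁) (λ k → inj₂)
    (λ k lt (eq , _) → <⇒≢ lt eq) (allFin n)))

cardNumber< : ∀ {n} (x : Fin n → ℕ) i → cardNumber x i < n
cardNumber< {n} x i = subst₂ _<_ (sym (cardNumber-count x i)) (length-tabulate (λ (k : Fin n) → k))
  (filter-notAll (λ k → precedes? x k i) (allFin n) (any-∈ i (precedes-irrefl x)))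

-- From positions to cards, hence the inverse of the ruffle as a permutation.
cardAt : ∀ {n} → (Fin n → ℕ) → Fin n → Fin n
cardAt x i = fromℕ< (cardNumber< x i)

cardAt-mono : ∀ {n} (x : Fin n → ℕ) {i k} → Precedes x i k → cardAt x i Fin.< cardAt x k
cardAt-mono {n} x {i} {k} i≺k =
  subst₂ _<_ (sym (trans (Fin.toℕ-fromℕ< (cardNumber< x i)) (cardNumber-count x i)))
             (sym (trans (Fin.toℕ-fromℕ< (cardNumber< x k)) (cardNumber-count x k)))
    (length-filter-strict (λ j → precedes? x j i) (λ j → precedes? x j k)
      (λ j j≺i → precedes-trans x j≺i i≺k) (any-∈ i (i≺k , precedes-irrefl x)))

cardAt-injective : ∀ {n} (x : Fin n → ℕ) → Injective _≡_ _≡_ (cardAt x)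
cardAt-injective x {i} {k} eq with precedes-total x i k
... | inj₁ i≺k        = contradiction (cong toℕ eq) (<⇒≢ (cardAt-mono x i≺k))
... | inj₂ (inj₁ i≡k) = i≡k
... | inj₂ (inj₂ k≺i) = contradiction (cong toℕ (sym eq)) (<⇒≢ (cardAt-mono x k≺i))

positionOf : ∀ {n} → (Fin n → ℕ) → Fin n → Fin n
positionOf x c = proj₁ (injective⇒hits (cardAt x) (cardAt-injective x) c)

cardAt-positionOf : ∀ {n} (x : Fin n → ℕ) c → cardAt x (positionOf x c) ≡ c
cardAt-positionOf x c = proj₂ (injective⇒hits (cardAt x) (cardAt-injective x) c)

positionOf-cardAt : ∀ {n} (x : Fin n → ℕ) i → positionOf x (cardAt x i) ≡ i
positionOf-cardAt x i = cardAt-injective x (cardAt-positionOf x (cardAt x i))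

cardAt-unique : ∀ {n} (x : Fin n → ℕ) (τ : Fin n → Fin n) →
                (∀ {i k} → Precedes x i k → τ i Fin.< τ k) → ∀ i → cardAt x i ≡ τ i
cardAt-unique x τ τ-mono i =
  trans (sym (strictlyMonotone⇒id (τ ∘ positionOf x) mono (cardAt x i))) (cong τ (positionOf-cardAt x i))
  where
  mono : ∀ {c d} → c Fin.< d → τ (positionOf x c) Fin.< τ (positionOf x d)
  mono {c} {d} c<d with precedes-total x (positionOf x c) (positionOf x d)
  ... | inj₁ p        = τ-mono p
  ... | inj₂ (inj₁ e) = contradiction
          (trans (sym (cardAt-positionOf x c)) (trans (cong (cardAt x) e) (cardAt-positionOf x d)))
          (λ c≡d → <⇒≢ c<d (cong toℕ c≡d))
  ... | inj₂ (inj₂ p) = contradiction c<d (<⇒≯ (subst₂ Fin._<_ (cardAt-positionOf x d) (cardAt-positionOf x c) (cardAt-mono x p)))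

cardAt-cong : ∀ {n} {x y : Fin n → ℕ} → (∀ i → x i ≡ y i) → ∀ i → cardAt x i ≡ cardAt y i
cardAt-cong {x = x} {y} eq = cardAt-unique x (cardAt y)
  (λ {i} {k} → λ { (inj₁ lt) → cardAt-mono y (inj₁ (subst₂ _<_ (eq i) (eq k) lt))
                 ; (inj₂ (e , t)) → cardAt-mono y (inj₂ (trans (sym (eq i)) (trans e (eq k)) ,
                                      subst (λ m → Towards (parity m) i k) (eq k) t)) })

-- Cards coming from odd-numbered hands are flipped.
flipSign : ℕ → Sign
flipSign j = toSign (parity j)

orientedRuffle : ∀ {n} → Ruffle n → OrientedPerm n
orientedRuffle {n} r = record
  { bijection = mk↔ₛ′ to from to-from from-to
  ; odd       = λ (s , c) → cong (_, positionOf x c) (opposite-* s (flipSign (x (positionOf x c))))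
  }
  where
  x = source r
  to from : ± n → ± n
  to   (s , c) = (s Sign.* flipSign (x (positionOf x c)) , positionOf x c)
  from (s , i) = (s Sign.* flipSign (x i) , cardAt x i)

  cancel : ∀ s t → s Sign.* t Sign.* t ≡ s
  cancel s t = trans (Sign.*-assoc s t t) (trans (cong (s Sign.*_) (Sign.s*s≡+ t)) (Sign.*-identityʳ s))

  to-from : ∀ y → to (from y) ≡ y
  to-from (s , i) rewrite positionOf-cardAt x i = cong (_, i) (cancel s (flipSign (x i)))

  from-to : ∀ y → from (to y) ≡ y
  from-to (s , c) = cong₂ _,_ (cancel s _) (cardAt-positionOf x c)

  opposite-* : ∀ s t → Sign.opposite s Sign.* t ≡ Sign.opposite (s Sign.* t)
  opposite-* Sign.- t = sym (Sign.opposite-involutive t)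
  opposite-* Sign.+ t = refl

ruffle : ∀ {n} → Ruffle n → Permutation′ n
ruffle r = π (orientedRuffle r)

-- (x ^ σ) satisfies (x ^ σ) (σ i) = x i.
_^ₚ_ : ∀ {n} → (Fin n → ℕ) → Permutation′ n → (Fin n → ℕ)
(x ^ₚ σ) i = x (σ ⟨$⟩ˡ i)

-- Only used for y < b, so the subtraction is never truncated.
reflectIfOdd : Parity → ℕ → ℕ → ℕ
reflectIfOdd 0ℙ b y = y
reflectIfOdd 1ℙ b y = b ∸ 1 ∸ y

reflect< : ∀ p {b y} → y < b → reflectIfOdd p b y < b
reflect< 0ℙ {b} {y} y<b = y<b
reflect< 1ℙ {suc b} {y} y<b = s≤s (m∸n≤m b y)

digit< : ∀ {a b x u} → x < a → u < b → b * x + u < a * b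
digit< {a} {b} {x} {u} x<a u<b = begin-strict
  b * x + u  <⟨ +-monoʳ-< (b * x) u<b ⟩
  b * x + b  ≡⟨ +-comm (b * x) b ⟩
  b + b * x  ≡⟨ *-suc b x ⟨
  b * suc x  ≤⟨ *-monoʳ-≤ b x<a ⟩
  b * a      ≡⟨ *-comm b a ⟩
  a * b      ∎
  where open ≤-Reasoning

_*ᴿ_ : ∀ {n} → Ruffle n → Ruffle n → Ruffle n
r *ᴿ s = record
  { hand        = hand r * hand s
  ; hand≥1      = *-mono-≤ (hand≥1 r) (hand≥1 s)
  ; source      = λ i → b * x′ i + reflectIfOdd (parity (x′ i)) b (source s i)
  ; source<hand = λ i → digit< (source<hand r _) (reflect< (parity (x′ i)) (source<hand s i))
  }
  where
  b  = hand s
  x′ = source r ^ₚ ruffle s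

1ᴿ : ∀ {n} → Ruffle n
1ᴿ = record { hand = 1 ; hand≥1 = ≤-refl ; source = λ _ → 0 ; source<hand = λ _ → s≤s z≤n }

reflect-⁻¹ : ∀ p {c t} → t < c → reflectIfOdd (p ℙ.⁻¹) c t ≡ c ∸ 1 ∸ reflectIfOdd p c t
reflect-⁻¹ 0ℙ t<c = refl
reflect-⁻¹ 1ℙ {suc c} {t} t<c = sym (m∸[m∸n]≡n (≤-pred t<c))

reflect-+ : ∀ {b y} → y < b → (b ∸ 1 ∸ y) + suc y ≡ b
reflect-+ {suc b} {y} y<b = trans (+-suc (b ∸ y) y) (cong suc (m∸n+n≡m (≤-pred y<b)))

digit-mono : ∀ b {x x′ u u′} → u < b → x < x′ → b * x + u < b * x′ + u′
digit-mono b {x} {x′} {u} {u′} u<b x<x′ = begin-strict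
  b * x + u    <⟨ +-monoʳ-< (b * x) u<b ⟩
  b * x + b    ≡⟨ +-comm (b * x) b ⟩
  b + b * x    ≡⟨ *-suc b x ⟨
  b * suc x    ≤⟨ *-monoʳ-≤ b x<x′ ⟩
  b * x′       ≤⟨ m≤m+n (b * x′) u′ ⟩
  b * x′ + u′  ∎
  where open ≤-Reasoning

digit-<⁻¹ : ∀ b {x x′ u u′} → u′ < b → b * x + u < b * x′ + u′ → x < x′ ⊎ (x ≡ x′ × u < u′)
digit-<⁻¹ b {x} {x′} {u} {u′} u′<b lt with <-cmp x x′
... | tri< x<x′ _ _ = inj₁ x<x′
... | tri≈ _ refl _ = inj₂ (refl , +-cancelˡ-< (b * x) u u′ lt)
... | tri> _ _ x′<x = contradiction lt (<⇒≯ (digit-mono b u′<b x′<x))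

digit-≡⁻¹ : ∀ b {x x′ u u′} → u < b → u′ < b → b * x + u ≡ b * x′ + u′ → x ≡ x′ × u ≡ u′
digit-≡⁻¹ b {x} {x′} {u} {u′} u<b u′<b eq with <-cmp x x′
... | tri< x<x′ _ _ = contradiction eq (<⇒≢ (digit-mono b u<b x<x′))
... | tri≈ _ refl _ = refl , +-cancelˡ-≡ (b * x) u u′ eq
... | tri> _ _ x′<x = contradiction (sym eq) (<⇒≢ (digit-mono b u′<b x′<x))

reflect-injective : ∀ p {b y y′} → y < b → y′ < b → reflectIfOdd p b y ≡ reflectIfOdd p b y′ → y ≡ y′
reflect-injective 0ℙ _ _ eq = eq
reflect-injective 1ℙ {suc b} y<b y′<b eq = ∸-cancelˡ-≡ (≤-pred y<b) (≤-pred y′<b) eq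

parity-suc : ∀ m → parity (suc m) ≡ parity m ℙ.⁻¹
parity-suc m = trans (sym (ℙ.⁻¹-involutive (parity (suc m)))) (cong ℙ._⁻¹ (ℙ.suc-homo-⁻¹ m))

parity-digit : ∀ b x {y} → y < b → parity (b * x + reflectIfOdd (parity x) b y) ≡ parity x ℙ.+ parity y
parity-digit b x {y} y<b with parity x in eq
... | 0ℙ = begin
    parity (b * x + y)                   ≡⟨ ℙ.+-homo-+ (b * x) y ⟩
    parity (b * x) ℙ.+ parity y          ≡⟨ cong (ℙ._+ parity y) (ℙ.*-homo-* b x) ⟩
    parity b ℙ.* parity x ℙ.+ parity y   ≡⟨ cong (λ p → parity b ℙ.* p ℙ.+ parity y) eq ⟩
    parity b ℙ.* 0ℙ ℙ.+ parity y         ≡⟨ cong (ℙ._+ parity y) (ℙ.*-zeroʳ (parity b)) ⟩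
    parity y                             ∎
  where open ≡-Reasoning
... | 1ℙ = begin
    parity (b * x + v)                   ≡⟨ ℙ.+-homo-+ (b * x) v ⟩
    parity (b * x) ℙ.+ parity v          ≡⟨ cong (ℙ._+ parity v) (ℙ.*-homo-* b x) ⟩
    parity b ℙ.* parity x ℙ.+ parity v   ≡⟨ cong (λ p → parity b ℙ.* p ℙ.+ parity v) eq ⟩
    parity b ℙ.* 1ℙ ℙ.+ parity v         ≡⟨ cong (ℙ._+ parity v) (ℙ.*-identityʳ (parity b)) ⟩
    parity b ℙ.+ parity v                ≡⟨ cong (λ m → parity m ℙ.+ parity v) (reflect-+ y<b) ⟨
    parity (v + suc y) ℙ.+ parity v      ≡⟨ cong (ℙ._+ parity v) (ℙ.+-homo-+ v (suc y)) ⟩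
    parity v ℙ.+ parity (suc y) ℙ.+ parity v
      ≡⟨ cong (λ p → parity v ℙ.+ p ℙ.+ parity v) (parity-suc y) ⟩
    parity v ℙ.+ parity y ℙ.⁻¹ ℙ.+ parity v
      ≡⟨ cancel (parity v) (parity y) ⟩
    parity y ℙ.⁻¹                        ∎
  where
  open ≡-Reasoning
  v = b ∸ 1 ∸ y
  cancel : ∀ p q → p ℙ.+ q ℙ.⁻¹ ℙ.+ p ≡ q ℙ.⁻¹
  cancel 0ℙ 0ℙ = refl
  cancel 0ℙ 1ℙ = refl
  cancel 1ℙ 0ℙ = refl
  cancel 1ℙ 1ℙ = refl

cardAt-*ᴿ : ∀ {n} (r s : Ruffle n) i →
            cardAt (source (r *ᴿ s)) i ≡ cardAt (source r) (cardAt (source s) i)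
cardAt-*ᴿ r s = cardAt-unique (source (r *ᴿ s)) (cardAt x ∘ cardAt y) (cardAt-mono x ∘ compare)
  where
  x = source r
  y = source s
  b = hand s
  x′ = x ∘ cardAt y
  digit : ∀ i → reflectIfOdd (parity (x′ i)) b (y i) < b
  digit i = reflect< (parity (x′ i)) (source<hand s i)

  within : ∀ {i k} → x′ i ≡ x′ k →
           reflectIfOdd (parity (x′ k)) b (y i) < reflectIfOdd (parity (x′ k)) b (y k) →
           Precedes x (cardAt y i) (cardAt y k)
  within {i} {k} e lt with parity (x′ k)
  ... | 0ℙ = inj₂ (e , cardAt-mono y (inj₁ lt))
  ... | 1ℙ = inj₂ (e , cardAt-mono y (inj₁ (≰⇒> (λ le → <⇒≱ lt (∸-monoʳ-≤ (b ∸ 1) le)))))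

  tie : ∀ {i k} → x′ i ≡ x′ k → y i ≡ y k → Towards (parity (x′ k) ℙ.+ parity (y k)) i k →
        Precedes x (cardAt y i) (cardAt y k)
  tie {i} {k} e e′ t = inj₂ (e , direction (parity (x′ k)) t)
    where
    direction : ∀ p → Towards (p ℙ.+ parity (y k)) i k → Towards p (cardAt y i) (cardAt y k)
    direction 0ℙ t = cardAt-mono y (inj₂ (e′ , t))
    direction 1ℙ t = cardAt-mono y (inj₂ (sym e′ , subst (λ m → Towards (parity m) k i) (sym e′) (flip (parity (y k)) t)))
      where
      flip : ∀ p → Towards (p ℙ.⁻¹) i k → Towards p k i
      flip 0ℙ t = t
      flip 1ℙ t = t

  compare : ∀ {i k} → Precedes (source (r *ᴿ s)) i k → Precedes x (cardAt y i) (cardAt y k)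
  compare {i} {k} (inj₁ lt) with digit-<⁻¹ b (digit k) lt
  ... | inj₁ x<x = inj₁ x<x
  ... | inj₂ (e , u<u) = within e (subst (λ m → reflectIfOdd (parity m) b (y i) < reflectIfOdd (parity (x′ k)) b (y k)) e u<u)
  compare {i} {k} (inj₂ (eq , t)) with digit-≡⁻¹ b (digit i) (digit k) eq
  ... | (e , e′) = tie e
    (reflect-injective (parity (x′ k)) (source<hand s i) (source<hand s k)
      (subst (λ m → reflectIfOdd (parity m) b (y i) ≡ reflectIfOdd (parity (x′ k)) b (y k)) e e′))
    (subst (λ p → Towards p i k) (parity-digit b (x′ k) (source<hand s k)) t)

flipSign-*ᴿ : ∀ {n} (r s : Ruffle n) i →
              flipSign (source (r *ᴿ s) i) ≡ flipSign (source r (cardAt (source s) i)) Sign.* flipSign (source s i)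
flipSign-*ᴿ r s i = trans
  (cong toSign (parity-digit (hand s) (source r (cardAt (source s) i)) (source<hand s i)))
  (ℙ.+-homo-* (parity (source r (cardAt (source s) i))) (parity (source s i)))

orientedRuffle-*ᴿ : ∀ {n} (r s : Ruffle n) →
  orientedRuffle (r *ᴿ s) ≈± DecMonoid._∙_ (𝕊± n) (orientedRuffle r) (orientedRuffle s)
orientedRuffle-*ᴿ {n} r s =
  ≈±-from (orientedRuffle (r *ᴿ s)) (DecMonoid._∙_ (𝕊± n) (orientedRuffle r) (orientedRuffle s)) λ (t , i) →
  cong₂ _,_
    (trans (cong (t Sign.*_) (trans (flipSign-*ᴿ r s i) (Sign.*-comm (flipSign (source r (cardAt (source s) i))) _)))
           (sym (Sign.*-assoc t _ _)))
    (cardAt-*ᴿ r s i)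

orientedRuffle-cong : ∀ {n} (r s : Ruffle n) → (∀ i → source r i ≡ source s i) → orientedRuffle r ≈± orientedRuffle s
orientedRuffle-cong r s eq = ≈±-from (orientedRuffle r) (orientedRuffle s) λ (t , i) →
  cong₂ _,_ (cong (λ m → t Sign.* flipSign m) (eq i)) (cardAt-cong eq i)

*ᴿ-cong : ∀ {n} {r r′ s s′ : Ruffle n} → r ≈ᴿ r′ → s ≈ᴿ s′ → (r *ᴿ s) ≈ᴿ (r′ *ᴿ s′)
*ᴿ-cong {r = r} {r′} {s} {s′} (a , x) (b , y) = cong₂ _*_ a b , λ i → cong₃ (x′ i) b (y i)
  where
  x′ : ∀ i → source r (cardAt (source s) i) ≡ source r′ (cardAt (source s′) i)
  x′ i = trans (x _) (cong (source r′) (cardAt-cong y i))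
  cong₃ : ∀ {m m′ b b′ u u′} → m ≡ m′ → b ≡ b′ → u ≡ u′ →
          b * m + reflectIfOdd (parity m) b u ≡ b′ * m′ + reflectIfOdd (parity m′) b′ u′
  cong₃ refl refl refl = refl

*ᴿ-assoc : ∀ {n} (r s t : Ruffle n) → ((r *ᴿ s) *ᴿ t) ≈ᴿ (r *ᴿ (s *ᴿ t))
*ᴿ-assoc r s t = *-assoc (hand r) (hand s) (hand t) , λ i →
  trans (arithmetic (source r (cardAt (source s) (cardAt (source t) i)))
                    (source<hand s (cardAt (source t) i)) (source<hand t i))
        (cong (λ m → b * c * m + reflectIfOdd (parity m) (b * c) (source (s *ᴿ t) i))
              (cong (source r) (sym (cardAt-*ᴿ s t i))))
  where
  b = hand s
  c = hand t

  odd-digit : ∀ {y v} → y < b → v < c → c * (b ∸ 1 ∸ y) + (c ∸ 1 ∸ v) ≡ b * c ∸ 1 ∸ (c * y + v)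
  odd-digit {y} {v} y<b v<c = begin
    c * (b ∸ 1 ∸ y) + (c ∸ 1 ∸ v)
      ≡⟨ m+n∸n≡m (c * (b ∸ 1 ∸ y) + (c ∸ 1 ∸ v)) (suc (c * y + v)) ⟨
    c * (b ∸ 1 ∸ y) + (c ∸ 1 ∸ v) + suc (c * y + v) ∸ suc (c * y + v)
      ≡⟨ cong (_∸ suc (c * y + v)) total ⟩
    b * c ∸ suc (c * y + v)
      ≡⟨ ∸-+-assoc (b * c) 1 (c * y + v) ⟨
    b * c ∸ 1 ∸ (c * y + v) ∎
    where
    open ≡-Reasoning
    total : c * (b ∸ 1 ∸ y) + (c ∸ 1 ∸ v) + suc (c * y + v) ≡ b * c
    total = begin
      c * (b ∸ 1 ∸ y) + (c ∸ 1 ∸ v) + suc (c * y + v)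
        ≡⟨ cong (c * (b ∸ 1 ∸ y) + (c ∸ 1 ∸ v) +_) (+-suc (c * y) v) ⟨
      c * (b ∸ 1 ∸ y) + (c ∸ 1 ∸ v) + (c * y + suc v)
        ≡⟨ interchange +-commutativeSemigroup (c * (b ∸ 1 ∸ y)) (c ∸ 1 ∸ v) (c * y) (suc v) ⟩
      c * (b ∸ 1 ∸ y) + c * y + ((c ∸ 1 ∸ v) + suc v)
        ≡⟨ cong₂ _+_ (sym (*-distribˡ-+ c (b ∸ 1 ∸ y) y)) (reflect-+ v<c) ⟩
      c * (b ∸ 1 ∸ y + y) + c
        ≡⟨ +-comm _ c ⟩
      c + c * (b ∸ 1 ∸ y + y)
        ≡⟨ *-suc c _ ⟨
      c * suc (b ∸ 1 ∸ y + y)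
        ≡⟨ cong (c *_) (trans (sym (+-suc (b ∸ 1 ∸ y) y)) (reflect-+ y<b)) ⟩
      c * b
        ≡⟨ *-comm c b ⟩
      b * c ∎

  arithmetic : ∀ x {y z} → y < b → z < c →
    c * (b * x + reflectIfOdd (parity x) b y) + reflectIfOdd (parity (b * x + reflectIfOdd (parity x) b y)) c z
    ≡ b * c * x + reflectIfOdd (parity x) (b * c) (c * y + reflectIfOdd (parity y) c z)
  arithmetic x {y} {z} y<b z<c = begin
    c * (b * x + Y) + reflectIfOdd (parity (b * x + Y)) c z
      ≡⟨ cong₂ _+_ (*-distribˡ-+ c (b * x) Y) (cong (λ p → reflectIfOdd p c z) (parity-digit b x y<b)) ⟩
    c * (b * x) + c * Y + Z (parity x)
      ≡⟨ +-assoc (c * (b * x)) (c * Y) (Z (parity x)) ⟩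
    c * (b * x) + (c * Y + Z (parity x))
      ≡⟨ cong₂ _+_ (trans (sym (*-assoc c b x)) (cong (_* x) (*-comm c b))) (lower (parity x)) ⟩
    b * c * x + reflectIfOdd (parity x) (b * c) (c * y + reflectIfOdd (parity y) c z) ∎
    where
    open ≡-Reasoning
    Y = reflectIfOdd (parity x) b y
    Z : Parity → ℕ
    Z p = reflectIfOdd (p ℙ.+ parity y) c z
    lower : ∀ p → c * reflectIfOdd p b y + Z p ≡ reflectIfOdd p (b * c) (c * y + reflectIfOdd (parity y) c z)
    lower 0ℙ = refl
    lower 1ℙ = trans (cong (c * (b ∸ 1 ∸ y) +_) (reflect-⁻¹ (parity y) z<c))
                     (odd-digit y<b (reflect< (parity y) z<c))

*ᴿ-identityˡ : ∀ {n} (r : Ruffle n) → (1ᴿ *ᴿ r) ≈ᴿ r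
*ᴿ-identityˡ r = *-identityˡ (hand r) , λ i → cong (_+ source r i) (*-zeroʳ (hand r))

cardAt-1ᴿ : ∀ {n} (i : Fin n) → cardAt (source 1ᴿ) i ≡ i
cardAt-1ᴿ = cardAt-unique (source 1ᴿ) (λ i → i) λ { (inj₁ ()) ; (inj₂ (_ , i<k)) → i<k }

*ᴿ-identityʳ : ∀ {n} (r : Ruffle n) → (r *ᴿ 1ᴿ) ≈ᴿ r
*ᴿ-identityʳ r = *-identityʳ (hand r) , λ i → trans (unit (source r (cardAt (source 1ᴿ) i))) (cong (source r) (cardAt-1ᴿ i))
  where
  unit : ∀ x → 1 * x + reflectIfOdd (parity x) 1 0 ≡ x
  unit x with parity x
  ... | 0ℙ = trans (+-identityʳ (1 * x)) (*-identityˡ x)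
  ... | 1ℙ = trans (+-identityʳ (1 * x)) (*-identityˡ x)

RuffleMonoid : ℕ → DecMonoid
RuffleMonoid n = record
  { monoid = record
    { Carrier  = Ruffle n
    ; _≈_      = _≈ᴿ_
    ; _∙_      = _*ᴿ_
    ; ε        = 1ᴿ
    ; isMonoid = record
      { isSemigroup = record
        { isMagma = record
          { isEquivalence = record
            { refl  = refl , λ _ → refl
            ; sym   = λ (a , x) → sym a , λ i → sym (x i)
            ; trans = λ (a , x) (b , y) → trans a b , λ i → trans (x i) (y i)
            }
          ; ∙-cong = λ {r} {r′} {s} {s′} → *ᴿ-cong {n} {r} {r′} {s} {s′}
          }
        ; assoc = *ᴿ-assoc
        }
      ; identity = *ᴿ-identityˡ , *ᴿ-identityʳ
      }
    }
  ; _≈?_ = λ r s → (hand r ≟ hand s) ×-dec Fin.all? (λ i → source r i ≟ source s i)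
  }

IsRuffle : ∀ {n} → OrientedPerm n → ℕ → Set
IsRuffle {n} w a = ∃ λ (r : Ruffle n) → hand r ≡ a × orientedRuffle r ≈± w

isRuffle? : ∀ {n} (w : OrientedPerm n) a → Dec (IsRuffle w a)
isRuffle? w zero = no λ { (r , refl , _) → contradiction (hand≥1 r) (λ ()) }
isRuffle? {n} w (suc a) =
  map′ (λ (k , eq) → candidate k , refl , eq) encode
       (Fin.any? (λ k → DecMonoid._≈?_ (𝕊± n) (orientedRuffle (candidate k)) w))
  where
  candidate : Fin (suc a ^ n) → Ruffle n
  candidate k = record
    { hand        = suc a
    ; hand≥1      = s≤s z≤n
    ; source      = λ i → toℕ (finToFun {suc a} {n} k i)
    ; source<hand = λ i → Fin.toℕ<n (finToFun {suc a} {n} k i)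
    }
  encode : IsRuffle w (suc a) → ∃ λ k → orientedRuffle (candidate k) ≈± w
  encode (r , refl , eq) = k , λ x → trans (orientedRuffle-cong (candidate k) r source≡ x) (eq x)
    where
    f : Fin n → Fin (suc a)
    f i = fromℕ< (source<hand r i)
    k = funToFin f
    source≡ : ∀ i → toℕ (finToFun k i) ≡ source r i
    source≡ i = trans (cong toℕ (Fin.finToFun-funToFin f i)) (Fin.toℕ-fromℕ< (source<hand r i))

-- Give every card a hand of its own, of the right parity.
isRuffle-large : ∀ {n} (w : OrientedPerm n) → IsRuffle w (suc (n * 2))
isRuffle-large {n} w = r , refl , ≈±-from (orientedRuffle r) w λ (s , i) →
  trans (cong₂ _,_ (cong (s Sign.*_) (sign (card i) (ε i))) (cards i)) (sym (odd-* W.from (odd-from w) s i))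
  where
  module W = OrientedPerm w
  card : Fin n → Fin n
  card i = proj₂ (W.from (Sign.+ , i))
  ε : Fin n → Sign
  ε i = proj₁ (W.from (Sign.+ , i))
  bit : Sign → ℕ
  bit Sign.+ = 0
  bit Sign.- = 1
  bit< : ∀ s → bit s < 2
  bit< Sign.+ = s≤s z≤n
  bit< Sign.- = s≤s (s≤s z≤n)

  r : Ruffle n
  r = record
    { hand        = suc (n * 2)
    ; hand≥1      = s≤s z≤n
    ; source      = λ i → 2 * toℕ (card i) + bit (ε i)
    ; source<hand = λ i → m≤n⇒m≤1+n (digit< (Fin.toℕ<n (card i)) (bit< (ε i)))
    }

  sign : ∀ {n} (c : Fin n) s → flipSign (2 * toℕ c + bit s) ≡ s
  sign c s = trans (cong toSign (trans (ℙ.+-homo-+ (2 * toℕ c) (bit s)) (cong (ℙ._+ parity (bit s)) (ℙ.*-homo-* 2 (toℕ c))))) (bit-sign s)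
    where
    bit-sign : ∀ s → toSign (parity (bit s)) ≡ s
    bit-sign Sign.+ = refl
    bit-sign Sign.- = refl

  card-injective : ∀ {i k} → card i ≡ card k → i ≡ k
  card-injective {i} {k} eq = trans (sym (Perm.inverseʳ (π w))) (trans (cong (π w ⟨$⟩ʳ_) eq) (Perm.inverseʳ (π w)))

  cards : ∀ i → cardAt (source r) i ≡ card i
  cards = cardAt-unique (source r) card compare
    where
    compare : ∀ {i k} → Precedes (source r) i k → card i Fin.< card k
    compare {i} {k} (inj₁ lt) with digit-<⁻¹ 2 (bit< (ε k)) lt
    ... | inj₁ c<c = c<c
    ... | inj₂ (eq , lt′) with refl ← card-injective (Fin.toℕ-injective eq) = contradiction lt′ (<-irrefl refl)
    compare {i} {k} p@(inj₂ (eq , _))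
      with refl ← card-injective (Fin.toℕ-injective (proj₁ (digit-≡⁻¹ 2 (bit< (ε i)) (bit< (ε k)) eq))) =
      contradiction p (precedes-irrefl (source r))

IsLeast : Pred ℕ 0ℓ → Pred ℕ 0ℓ
IsLeast P a = P a × (∀ b → P b → a ≤ b)

least : {P : Pred ℕ 0ℓ} → Decidable P → ∀ m → P m → ∃ (IsLeast P)
least P? m p with P? 0
least P? m       p | yes p₀ = 0 , p₀ , λ _ _ → z≤n
least P? zero    p | no ¬p₀ = contradiction p ¬p₀
least P? (suc m) p | no ¬p₀ with least (P? ∘ suc) m p
... | a , pa , min = suc a , pa , λ { zero p₀ → contradiction p₀ ¬p₀ ; (suc b) pb → s≤s (min b pb) }

orientedRisingNumber-exists : ∀ {n} (w : OrientedPerm n) → ∃ (IsLeast (IsRuffle w))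
orientedRisingNumber-exists w = least (isRuffle? w) _ (isRuffle-large w)

orientedRisingNumber : ∀ {n} → OrientedPerm n → ℕ
orientedRisingNumber w = proj₁ (orientedRisingNumber-exists w)

-- The graph of σ on {0,1,…,n}, with σ(0) = 0.
height : ∀ {n} → Permutation′ n → Fin (suc n) → ℕ
height σ zero    = 0
height σ (suc i) = suc (toℕ (σ ⟨$⟩ʳ i))

-- A turning point at i, 1 ≤ i < n, is indexed by i - 1 : Fin (n - 1).
module _ {m : ℕ} (σ : Permutation′ (suc m)) where

  previous current next : Fin m → ℕ
  previous k = height σ (inject₁ (inject₁ k))
  current  k = height σ (suc (inject₁ k))
  next     k = height σ (suc (suc k))

  IsTurningPoint : Pred (Fin m) 0ℓ
  IsTurningPoint k = (previous k < current k × next k < current k)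
                   ⊎ (current k < previous k × current k < next k)

  isTurningPoint? : Decidable IsTurningPoint
  isTurningPoint? k = ((previous k <? current k) ×-dec (next k <? current k))
               ⊎-dec ((current k <? previous k) ×-dec (current k <? next k))

turningNumber : ∀ {n} → Permutation′ n → ℕ
turningNumber {zero}  σ = 0
turningNumber {suc m} σ = # (isTurningPoint? σ)

module MonoidAlgebra (M : DecMonoid) where
  open DecMonoid M using (Carrier; _≈?_; _∙_; setoid)

  -- Formal sums of terms q·m; a list may repeat a monoid element, and two
  -- lists denote the same element when all their coefficients agree.
  ℚ[M] : Set
  ℚ[M] = List (ℚ × Carrier)

  coefficient : ℚ[M] → Carrier → ℚ
  coefficient []            m = 0ℚ
  coefficient ((q , x) ∷ u) m = (if does (x ≈? m) then q else 0ℚ) ℚ.+ coefficient u m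

  infix 4 _≋_
  infixl 6 _⊕_
  infixl 7 _⊛_ _·_

  _≋_ : Rel ℚ[M] 0ℓ
  u ≋ v = ∀ m → coefficient u m ≡ coefficient v m

  𝟘 : ℚ[M]
  𝟘 = []

  _⊕_ _⊛_ : ℚ[M] → ℚ[M] → ℚ[M]
  u ⊕ v = u ++ v
  u ⊛ v = cartesianProductWith (λ (q , x) (r , y) → (q ℚ.* r , x ∙ y)) u v

  _·_ : ℚ → ℚ[M] → ℚ[M]
  q · u = map (λ (r , x) → (q ℚ.* r , x)) u

  sumOf : List Carrier → ℚ[M]
  sumOf = map (1ℚ ,_)

  linearCombination : {I : Set} → (I → ℚ[M]) → List (ℚ × I) → ℚ[M]
  linearCombination v = concatMap (λ (q , i) → q · v i)

  Span : {I : Set} → (I → ℚ[M]) → Pred ℚ[M] 0ℓ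
  Span v u = ∃ λ ts → u ≋ linearCombination v ts

  -- The family v is indexed by the elements of I up to the equality of I.
  LinearlyIndependent : (I : Setoid 0ℓ 0ℓ) → (Setoid.Carrier I → ℚ[M]) → Set
  LinearlyIndependent I v =
    ∀ ts → AllPairs (λ s t → ¬ (Setoid._≈_ I (proj₂ s) (proj₂ t))) ts →
    linearCombination v ts ≋ 𝟘 → All (λ t → proj₁ t ≡ 0ℚ) ts

  record IsSubalgebra (A : Pred ℚ[M] 0ℓ) : Set where
    field
      ≋-closed : ∀ {u v} → u ≋ v → A u → A v
      𝟘-closed : A 𝟘
      ⊕-closed : ∀ {u v} → A u → A v → A (u ⊕ v)
      ·-closed : ∀ q {u} → A u → A (q · u)
      ⊛-closed : ∀ {u v} → A u → A v → A (u ⊛ v)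

  IsCommutative : Pred ℚ[M] 0ℓ → Set
  IsCommutative A = ∀ {u v} → A u → A v → u ⊛ v ≋ v ⊛ u

  -- An equivalence class of μ is represented by any of its elements.
  classes : {V : Set} → (Carrier → V) → Setoid 0ℓ 0ℓ
  classes {V} μ = On.setoid (≡.setoid V) μ

  -- `complete` makes μ invariant under the equality of M, since list
  -- membership is.
  record FiniteLevelSets {V : Set} (μ : Carrier → V) : Set where
    open Membership setoid using (_∈_)
    open Uniqueness setoid using (Unique)
    field
      levelSet : Carrier → List Carrier
      unique   : ∀ x → Unique (levelSet x)
      complete : ∀ x y → y ∈ levelSet x ⇔ μ y ≡ μ x

    classSum : Carrier → ℚ[M]
    classSum x = sumOf (levelSet x)

  record IsLumping {V : Set} (μ : Carrier → V) : Set where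
    field
      finiteLevelSets : FiniteLevelSets μ
    open FiniteLevelSets finiteLevelSets public

    -- The subspace spanned by the class sums.
    algebra : Pred ℚ[M] 0ℓ
    algebra = Span classSum

    field
      independent  : LinearlyIndependent (classes μ) classSum
      isSubalgebra : IsSubalgebra algebra

record DoesTheRightThing (M N : DecMonoid) {V W : Set}
         (μ : DecMonoid.Carrier M → V) (ν : DecMonoid.Carrier N → W)
         (f : DecMonoid.Carrier M → DecMonoid.Carrier N) : Set where
  open MonoidMorphisms (DecMonoid.rawMonoid M) (DecMonoid.rawMonoid N)
  open MonoidAlgebra N
  field
    isMonoidHomomorphism : IsMonoidHomomorphism f
    isLumping            : MonoidAlgebra.IsLumping M μ
    finiteLevelSets      : FiniteLevelSets ν

  open MonoidAlgebra.IsLumping isLumping using (levelSet)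
  open FiniteLevelSets finiteLevelSets using (classSum)

  imageSum : DecMonoid.Carrier M → ℚ[M]
  imageSum x = sumOf (map f (levelSet x))

  field
    belong : ∀ x → Span classSum (imageSum x)
    span   : ∀ {u} → Span classSum u → Span imageSum u

{-# OPTIONS --safe #-}
module Submission where

-- Write s(c) for the direction (up or down) of the graph of σ from c - 1 to c
-- and o(c) for the orientation of card c, with o(0) = +.  When an oriented
-- permutation (σ , o) is dealt from hands, the number of the hand increases
-- from card c - 1 to card c by an amount of the form
-- [o(c-1) ≠ s(c)] + [o(c) ≠ s(c)] + 2e(c), and the e(c) ≥ 0 are arbitrary.
-- So the number of a-handed ruffles giving (σ , o) depends only on a and on the
-- oriented rising number, which is one more than the sum of the forced
-- increments.  Regrouping that sum by cards, card c < n contributes 1 to it at a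
-- turning point and 0 or 2, according to o(c), elsewhere, and card n contributes
-- 0 or 1.  So for σ with t turning points the orientations are distributed over
-- the oriented rising numbers with generating function
-- z (1 + z) (2z)ᵗ (1 + z²)ⁿ⁻¹⁻ᵗ, which depends only on t.
--
-- Hence the images of the class sums are class functions, and they are
-- triangular with nonzero diagonal, so they span all class functions.  The sum
-- of the a-handed ruffles times that of the b-handed ones is that of the
-- ab-handed ones, so their images span commutative subalgebras.

open import Defs
open import Algebra.Morphism.Structures using (module MonoidMorphisms)
open import Data.Bool.Base using (true; false; if_then_else_)
open import Data.Fin.Base as Fin using (Fin; zero; suc; toℕ; fromℕ; fromℕ<; inject₁; punchIn)
open import Data.Fin.Induction using (<-weakInduction)
open import Data.Fin.Permutation as Perm using (Permutation′; _⟨$⟩ʳ_; _⟨$⟩ˡ_)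
import Data.Fin.Properties as Fin
open import Data.List.Base using (List; []; _∷_; _++_; map; cartesianProductWith; filter; length; tabulate; allFin)
open import Data.List.Membership.Propositional.Properties using (∈-allFin)
import Data.List.Membership.Setoid as Membership
import Data.List.Membership.Setoid.Properties as ∈
open import Data.List.Properties using (filter-≐; filter-some; map-∘)
open import Data.List.Relation.Unary.All as All using (All; []; _∷_)
import Data.List.Relation.Unary.All.Properties as All
open import Data.List.Relation.Unary.AllPairs using ([]; _∷_)
open import Data.List.Relation.Unary.Any as Any using (Any; here; there)
import Data.List.Relation.Unary.Any.Properties as Any
open import Data.List.Relation.Unary.Unique.Propositional.Properties using (allFin⁺)
import Data.List.Relation.Unary.Unique.Setoid as Uniqueness
import Data.List.Relation.Unary.Unique.Setoid.Properties as Unique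
open import Data.Nat.Base using (ℕ; zero; suc; _+_; _*_; _≤_; _<_; z≤n; s≤s; parity)
open import Data.Nat.DivMod using (_/_; _%_; m≡m%n+[m/n]*n; m%n<n; m<n*o⇒m/o<n)
open import Data.Nat.Properties
open import Algebra.Properties.CommutativeMonoid.Sum +-0-commutativeMonoid using (sum; sum-cong-≗; ∑-distrib-+)
open import Data.Parity.Base as ℙ using (0ℙ; 1ℙ; toSign)
import Data.Parity.Properties as ℙ
open import Data.Product.Base using (∃; _×_; _,_; proj₁; proj₂; Σ-syntax)
open import Data.Rational.Base as ℚ using (ℚ; 0ℚ; 1ℚ)
import Data.Rational.Properties as ℚ
open import Data.Sign.Base as Sign using (Sign)
import Data.Sign.Properties as Sign
open import Data.Sum.Base as Sum using (_⊎_; inj₁; inj₂)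
import Data.Vec.Functional as Vector
open import Function.Base using (_∘_)
open import Function.Bundles using (mk⇔; mk↔ₛ′; module Equivalence)
open import Level using (0ℓ)
open import Relation.Binary.Bundles using (Setoid)
open import Relation.Binary.Definitions using (tri<; tri≈; tri>)
open import Relation.Binary.PropositionalEquality as ≡ hiding (setoid)
open import Relation.Nullary.Decidable using (Dec; yes; no; does; map′)
open import Relation.Nullary.Negation using (¬_; contradiction)
open import Relation.Unary using (Pred; Decidable)

-- Equality in the algebra is agreement of coefficients of lists, so compatibility of products and
-- pushforwards with it must be proved. Each formal sum is therefore also read as a linear
-- functional on functions that respect equality in the monoid, and a linear map is known by its
-- transpose on such functions.
--
-- The product rule for hand classes is unique factorisation: dividing hand numbers by `b` with
-- remainder, and reflecting the remainder when the quotient is odd, writes each `ab`-handed ruffle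
-- in exactly one way as an `a`-handed one times a `b`-handed one.
--
-- Triangularity comes from a minimal choice. Over an oriented permutation it is a ruffle with the
-- fewest hands. Over σ it is the orientation `o = s`: at a turn every orientation disagrees with a
-- neighbouring step, and `o = s` disagrees nowhere else, so the least oriented rising number over σ
-- is its turning number plus one.
--
-- Ruffles over a fixed σ are never counted directly. Their class sums are first expressed through
-- those of the oriented rising number, and π takes each of these to a class function.

module Rational where
  open import Data.Rational.Solver
  open +-*-Solver

  distrib-shuffle : ∀ a b c d → (a ℚ.* b) ℚ.* c ℚ.+ a ℚ.* d ≡ a ℚ.* (b ℚ.* c ℚ.+ d)
  distrib-shuffle = solve 4 (λ a b c d → (a :* b) :* c :+ a :* d := a :* (b :* c :+ d)) refl

  pull-out : ∀ a b c d → a ℚ.* b ℚ.+ (c ℚ.* b ℚ.+ d) ≡ (a ℚ.* 1ℚ ℚ.+ c) ℚ.* b ℚ.+ d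
  pull-out = solve 4 (λ a b c d → a :* b :+ (c :* b :+ d) := (a :* con 1ℚ :+ c) :* b :+ d) refl

  push-in : ∀ a b c d → a ℚ.* b ℚ.+ (c ℚ.+ d) ≡ c ℚ.+ (a ℚ.* b ℚ.+ d)
  push-in = solve 4 (λ a b c d → a :* b :+ (c :+ d) := c :+ (a :* b :+ d)) refl

  cancel : ∀ a b → a ℚ.+ ℚ.- 1ℚ ℚ.* b ≡ 0ℚ → a ≡ b
  cancel a b eq = begin
    a                          ≡⟨ solve 2 (λ a b → a := (a :+ con (ℚ.- 1ℚ) :* b) :+ b) refl a b ⟩
    (a ℚ.+ ℚ.- 1ℚ ℚ.* b) ℚ.+ b ≡⟨ cong (ℚ._+ b) eq ⟩
    0ℚ ℚ.+ b                   ≡⟨ ℚ.+-identityˡ b ⟩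
    b                          ∎
    where open ≡-Reasoning

  cancel⁻¹ : ∀ {a b} → a ≡ b → a ℚ.+ ℚ.- 1ℚ ℚ.* b ≡ 0ℚ
  cancel⁻¹ {a} refl = solve 1 (λ a → a :+ con (ℚ.- 1ℚ) :* a := con 0ℚ) refl a

  restore : ∀ c a b → a ≡ (a ℚ.+ ℚ.- c ℚ.* b) ℚ.+ c ℚ.* b
  restore = solve 3 (λ c a b → a := (a :+ (:- c) :* b) :+ c :* b) refl

  neg-* : ∀ a b → ℚ.- a ℚ.* b ≡ ℚ.- (a ℚ.* b)
  neg-* = solve 2 (λ a b → (:- a) :* b := :- (a :* b)) refl

  quotient : ∀ a b .{{_ : ℚ.NonZero b}} → (a ℚ.÷ b) ℚ.* b ≡ a
  quotient a b = trans (ℚ.*-assoc a (ℚ.1/ b) b) (trans (cong (a ℚ.*_) (ℚ.*-inverseˡ b)) (ℚ.*-identityʳ a))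

-- Defined by repeated addition of `1ℚ`, as the coefficient of a sum of monoid elements is
-- accumulated term by term.
fromℕℚ : ℕ → ℚ
fromℕℚ zero    = 0ℚ
fromℕℚ (suc k) = 1ℚ ℚ.+ fromℕℚ k

fromℕℚ-nonNegative : ∀ k → 0ℚ ℚ.≤ fromℕℚ k
fromℕℚ-nonNegative zero    = ℚ.≤-refl
fromℕℚ-nonNegative (suc k) = ℚ.+-mono-≤ (ℚ.nonNegative⁻¹ 1ℚ) (fromℕℚ-nonNegative k)

fromℕℚ-nonZero : ∀ k → fromℕℚ (suc k) ≢ 0ℚ
fromℕℚ-nonZero k = ℚ.<⇒≢ (ℚ.+-mono-<-≤ (ℚ.positive⁻¹ 1ℚ) (fromℕℚ-nonNegative k)) ∘ sym

-- Formal sums as linear functionals, and subspaces of the algebra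

module Pairing (M : DecMonoid) where
  open DecMonoid M using (Carrier; _≈?_; _≈_; _∙_; setoid; ∙-cong) renaming (refl to ≈-refl; sym to ≈-sym; trans to ≈-trans)
  open MonoidAlgebra M

  Invariant : Pred (Carrier → ℚ) 0ℓ
  Invariant φ = ∀ {x y} → x ≈ y → φ x ≡ φ y

  -- The functional given by a formal sum. It involves no test of equality, so sums, multiples and
  -- products of lists become operations on the test function; coefficients are recovered as its
  -- values on the indicators `δ`.
  ∫ : ℚ[M] → (Carrier → ℚ) → ℚ
  ∫ []            φ = 0ℚ
  ∫ ((q , x) ∷ u) φ = q ℚ.* φ x ℚ.+ ∫ u φ

  δ : Carrier → Carrier → ℚ
  δ m x = if does (x ≈? m) then 1ℚ else 0ℚ

  δ-invariant : ∀ m → Invariant (δ m)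
  δ-invariant m {x} {y} x≈y with x ≈? m | y ≈? m
  ... | yes _   | yes _   = refl
  ... | no _    | no _    = refl
  ... | yes x≈m | no y≉m  = contradiction (≈-trans (≈-sym x≈y) x≈m) y≉m
  ... | no x≉m  | yes y≈m = contradiction (≈-trans x≈y y≈m) x≉m

  coefficient-∫ : ∀ u m → coefficient u m ≡ ∫ u (δ m)
  coefficient-∫ []            m = refl
  coefficient-∫ ((q , x) ∷ u) m with does (x ≈? m)
  ... | true  = cong₂ ℚ._+_ (sym (ℚ.*-identityʳ q)) (coefficient-∫ u m)
  ... | false = cong₂ ℚ._+_ (sym (ℚ.*-zeroʳ q)) (coefficient-∫ u m)

  coefficient-invariant : ∀ u → Invariant (coefficient u)
  coefficient-invariant []            eq = refl
  coefficient-invariant ((q , z) ∷ u) {x} {y} x≈y = cong₂ ℚ._+_ head (coefficient-invariant u x≈y)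
    where
    head : (if does (z ≈? x) then q else 0ℚ) ≡ (if does (z ≈? y) then q else 0ℚ)
    head with z ≈? x | z ≈? y
    ... | yes _   | yes _   = refl
    ... | no _    | no _    = refl
    ... | yes z≈x | no z≉y  = contradiction (≈-trans z≈x x≈y) z≉y
    ... | no z≉x  | yes z≈y = contradiction (≈-trans z≈y (≈-sym x≈y)) z≉x

  ∫-cong : ∀ u {φ ψ} → (∀ x → φ x ≡ ψ x) → ∫ u φ ≡ ∫ u ψ
  ∫-cong []            eq = refl
  ∫-cong ((q , x) ∷ u) eq = cong₂ ℚ._+_ (cong (q ℚ.*_) (eq x)) (∫-cong u eq)

  ∫-⊕ : ∀ u v φ → ∫ (u ⊕ v) φ ≡ ∫ u φ ℚ.+ ∫ v φ
  ∫-⊕ []            v φ = sym (ℚ.+-identityˡ _)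
  ∫-⊕ ((q , x) ∷ u) v φ = trans (cong (q ℚ.* φ x ℚ.+_) (∫-⊕ u v φ)) (sym (ℚ.+-assoc (q ℚ.* φ x) _ _))

  ∫-· : ∀ q u φ → ∫ (q · u) φ ≡ q ℚ.* ∫ u φ
  ∫-· q []            φ = sym (ℚ.*-zeroʳ q)
  ∫-· q ((r , x) ∷ u) φ = trans (cong ((q ℚ.* r) ℚ.* φ x ℚ.+_) (∫-· q u φ)) (Rational.distrib-shuffle q r (φ x) _)

  ∫-⊛ : ∀ u v φ → ∫ (u ⊛ v) φ ≡ ∫ u (λ x → ∫ v (λ y → φ (x ∙ y)))
  ∫-⊛ []            v φ = refl
  ∫-⊛ ((q , x) ∷ u) v φ = trans (∫-⊕ (map (λ (r , y) → (q ℚ.* r , x ∙ y)) v) (u ⊛ v) φ)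
                                (cong₂ ℚ._+_ (row v) (∫-⊛ u v φ))
    where
    row : ∀ v → ∫ (map (λ (r , y) → (q ℚ.* r , x ∙ y)) v) φ ≡ q ℚ.* ∫ v (λ y → φ (x ∙ y))
    row []            = sym (ℚ.*-zeroʳ q)
    row ((r , y) ∷ v) = trans (cong ((q ℚ.* r) ℚ.* φ (x ∙ y) ℚ.+_) (row v)) (Rational.distrib-shuffle q r (φ (x ∙ y)) _)

  ∫-0 : ∀ u → ∫ u (λ _ → 0ℚ) ≡ 0ℚ
  ∫-0 []            = refl
  ∫-0 ((q , x) ∷ u) = trans (cong₂ ℚ._+_ (ℚ.*-zeroʳ q) (∫-0 u)) (ℚ.+-identityʳ 0ℚ)

  ∫-linear : ∀ u q φ ψ → ∫ u (λ x → q ℚ.* φ x ℚ.+ ψ x) ≡ q ℚ.* ∫ u φ ℚ.+ ∫ u ψ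
  ∫-linear []            q φ ψ = sym (trans (ℚ.+-identityʳ _) (ℚ.*-zeroʳ q))
  ∫-linear ((r , x) ∷ u) q φ ψ = trans (cong (r ℚ.* (q ℚ.* φ x ℚ.+ ψ x) ℚ.+_) (∫-linear u q φ ψ))
                                        (shuffle r q (φ x) (ψ x) (∫ u φ) (∫ u ψ))
    where
    open import Data.Rational.Solver
    open +-*-Solver
    shuffle : ∀ r q a b c d → r ℚ.* (q ℚ.* a ℚ.+ b) ℚ.+ (q ℚ.* c ℚ.+ d) ≡ q ℚ.* (r ℚ.* a ℚ.+ c) ℚ.+ (r ℚ.* b ℚ.+ d)
    shuffle = solve 6 (λ r q a b c d → r :* (q :* a :+ b) :+ (q :* c :+ d) := q :* (r :* a :+ c) :+ (r :* b :+ d)) refl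

  module _ (x : Carrier) where

    without : ℚ[M] → ℚ[M]
    without []            = []
    without ((q , y) ∷ u) = if does (y ≈? x) then without u else (q , y) ∷ without u

    length-without : ∀ u → length (without u) ≤ length u
    length-without []            = z≤n
    length-without ((q , y) ∷ u) with does (y ≈? x)
    ... | true  = m≤n⇒m≤1+n (length-without u)
    ... | false = s≤s (length-without u)

    -- All terms at elements equal to `x` meet the same value `φ x`, so together they contribute
    -- their total coefficient times that value.
    ∫-without : ∀ {φ} → Invariant φ → ∀ u → ∫ u φ ≡ ∫ u (δ x) ℚ.* φ x ℚ.+ ∫ (without u) φ
    ∫-without {φ} inv []            = sym (trans (ℚ.+-identityʳ _) (ℚ.*-zeroˡ (φ x)))
    ∫-without {φ} inv ((q , y) ∷ u) with y ≈? x
    ... | yes y≈x = begin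
      q ℚ.* φ y ℚ.+ ∫ u φ
        ≡⟨ cong₂ (λ a b → q ℚ.* a ℚ.+ b) (inv y≈x) (∫-without inv u) ⟩
      q ℚ.* φ x ℚ.+ (∫ u (δ x) ℚ.* φ x ℚ.+ ∫ (without u) φ)
        ≡⟨ Rational.pull-out q (φ x) (∫ u (δ x)) (∫ (without u) φ) ⟩
      (q ℚ.* 1ℚ ℚ.+ ∫ u (δ x)) ℚ.* φ x ℚ.+ ∫ (without u) φ ∎
      where open ≡-Reasoning
    ... | no y≉x = begin
      q ℚ.* φ y ℚ.+ ∫ u φ
        ≡⟨ cong (q ℚ.* φ y ℚ.+_) (∫-without inv u) ⟩
      q ℚ.* φ y ℚ.+ (∫ u (δ x) ℚ.* φ x ℚ.+ ∫ (without u) φ)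
        ≡⟨ Rational.push-in q (φ y) (∫ u (δ x) ℚ.* φ x) (∫ (without u) φ) ⟩
      ∫ u (δ x) ℚ.* φ x ℚ.+ (q ℚ.* φ y ℚ.+ ∫ (without u) φ)
        ≡⟨ cong (λ a → a ℚ.* φ x ℚ.+ (q ℚ.* φ y ℚ.+ ∫ (without u) φ))
             (trans (cong (ℚ._+ ∫ u (δ x)) (ℚ.*-zeroʳ q)) (ℚ.+-identityˡ (∫ u (δ x)))) ⟨
      (q ℚ.* 0ℚ ℚ.+ ∫ u (δ x)) ℚ.* φ x ℚ.+ (q ℚ.* φ y ℚ.+ ∫ (without u) φ) ∎
      where open ≡-Reasoning

  -- Grouping the terms equal to the head contributes zero, and the remaining list again has
  -- vanishing coefficients. The bound `k` carries the recursion because `without x u` is not a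
  -- sublist given by pattern matching.
  ∫-null : ∀ {φ} → Invariant φ → ∀ k u → length u ≤ k → (∀ m → ∫ u (δ m) ≡ 0ℚ) → ∫ u φ ≡ 0ℚ
  ∫-null inv k       []              le null = refl
  ∫-null {φ} inv (suc k) u@((q , x) ∷ t) (s≤s le) null = begin
    ∫ u φ                                          ≡⟨ reduce inv ⟩
    ∫ (without x u) φ                              ≡⟨ ∫-null inv k (without x u) shorter
                                                        (λ m → trans (sym (reduce (δ-invariant m))) (null m)) ⟩
    0ℚ                                             ∎
    where
    open ≡-Reasoning
    reduce : ∀ {ψ} → Invariant ψ → ∫ u ψ ≡ ∫ (without x u) ψ
    reduce {ψ} inv′ = trans (∫-without x inv′ u) (trans (cong (λ a → a ℚ.* ψ x ℚ.+ ∫ (without x u) ψ) (null x))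
      (trans (cong (ℚ._+ ∫ (without x u) ψ) (ℚ.*-zeroˡ (ψ x))) (ℚ.+-identityˡ _)))
    shorter : length (without x u) ≤ k
    shorter with x ≈? x
    ... | yes _  = ≤-trans (length-without x t) le
    ... | no x≉x = contradiction ≈-refl x≉x

  -- Apply `∫-null` to the difference of the two sums. This is what makes every map with a transpose
  -- well defined up to `≋`.
  ∫-ext : ∀ {u v} → u ≋ v → ∀ {φ} → Invariant φ → ∫ u φ ≡ ∫ v φ
  ∫-ext {u} {v} u≋v {φ} inv = Rational.cancel _ _ (trans (sym (difference φ))
    (∫-null inv _ (u ⊕ ℚ.- 1ℚ · v) ≤-refl λ m → trans (difference (δ m))
      (Rational.cancel⁻¹ (trans (sym (coefficient-∫ u m)) (trans (u≋v m) (coefficient-∫ v m))))))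
    where
    difference : ∀ φ → ∫ (u ⊕ ℚ.- 1ℚ · v) φ ≡ ∫ u φ ℚ.+ ℚ.- 1ℚ ℚ.* ∫ v φ
    difference φ = trans (∫-⊕ u (ℚ.- 1ℚ · v) φ) (cong (∫ u φ ℚ.+_) (∫-· (ℚ.- 1ℚ) v φ))

  from-∫ : ∀ {u v} → (∀ m → ∫ u (δ m) ≡ ∫ v (δ m)) → u ≋ v
  from-∫ {u} {v} eq m = trans (coefficient-∫ u m) (trans (eq m) (sym (coefficient-∫ v m)))

  coefficient-⊕ : ∀ u v m → coefficient (u ⊕ v) m ≡ coefficient u m ℚ.+ coefficient v m
  coefficient-⊕ u v m = trans (coefficient-∫ (u ⊕ v) m) (trans (∫-⊕ u v (δ m))
    (sym (cong₂ ℚ._+_ (coefficient-∫ u m) (coefficient-∫ v m))))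

  coefficient-· : ∀ q u m → coefficient (q · u) m ≡ q ℚ.* coefficient u m
  coefficient-· q u m = trans (coefficient-∫ (q · u) m) (trans (∫-· q u (δ m)) (sym (cong (q ℚ.*_) (coefficient-∫ u m))))

  -- A closure property of predicates, so that class functions, preimages and equalisers of linear
  -- maps all qualify and `span-least` reduces a claim about a span to its generators.
  record IsSubspace (P : Pred ℚ[M] 0ℓ) : Set where
    field
      ≋-closed : ∀ {u v} → u ≋ v → P u → P v
      𝟘-closed : P 𝟘
      ⊕-closed : ∀ {u v} → P u → P v → P (u ⊕ v)
      ·-closed : ∀ q {u} → P u → P (q · u)

  module _ {I : Set} (v : I → ℚ[M]) where

    lc-⊕ : ∀ ss ts m → coefficient (linearCombination v (ss ++ ts)) m ≡
           coefficient (linearCombination v ss ⊕ linearCombination v ts) m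
    lc-⊕ []             ts m = refl
    lc-⊕ ((q , i) ∷ ss) ts m = trans (coefficient-⊕ (q · v i) (linearCombination v (ss ++ ts)) m)
      (trans (cong (coefficient (q · v i) m ℚ.+_) (trans (lc-⊕ ss ts m) (coefficient-⊕ (linearCombination v ss) _ m)))
      (trans (sym (ℚ.+-assoc (coefficient (q · v i) m) _ _))
      (trans (cong (ℚ._+ _) (sym (coefficient-⊕ (q · v i) (linearCombination v ss) m)))
             (sym (coefficient-⊕ (linearCombination v ((q , i) ∷ ss)) (linearCombination v ts) m)))))

    lc-· : ∀ q ts m → coefficient (linearCombination v (map (λ (r , i) → (q ℚ.* r , i)) ts)) m ≡
           q ℚ.* coefficient (linearCombination v ts) m
    lc-· q []             m = sym (ℚ.*-zeroʳ q)
    lc-· q ((r , i) ∷ ts) m = trans (coefficient-⊕ ((q ℚ.* r) · v i) (linearCombination v (map _ ts)) m)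
      (trans (cong₂ ℚ._+_ (trans (coefficient-· (q ℚ.* r) (v i) m) (ℚ.*-assoc q r _)) (lc-· q ts m))
      (trans (sym (ℚ.*-distribˡ-+ q _ _))
             (cong (q ℚ.*_) (sym (trans (coefficient-⊕ (r · v i) (linearCombination v ts) m)
                                        (cong (ℚ._+ _) (coefficient-· r (v i) m)))))))

    span-isSubspace : IsSubspace (Span v)
    span-isSubspace = record
      { ≋-closed = λ u≋w (ts , eq) → ts , λ m → trans (sym (u≋w m)) (eq m)
      ; 𝟘-closed = [] , λ _ → refl
      ; ⊕-closed = λ {u} {w} (ss , eq) (ts , eq′) → ss ++ ts , λ m →
          trans (coefficient-⊕ u w m) (trans (cong₂ ℚ._+_ (eq m) (eq′ m))
          (trans (sym (coefficient-⊕ (linearCombination v ss) (linearCombination v ts) m)) (sym (lc-⊕ ss ts m))))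
      ; ·-closed = λ q {u} (ts , eq) → map _ ts , λ m →
          trans (coefficient-· q u m) (trans (cong (q ℚ.*_) (eq m)) (sym (lc-· q ts m)))
      }

    span-generator : ∀ i → Span v (v i)
    span-generator i = (1ℚ , i) ∷ [] , λ m → sym (trans (coefficient-⊕ (1ℚ · v i) [] m)
      (trans (ℚ.+-identityʳ _) (trans (coefficient-· 1ℚ (v i) m) (ℚ.*-identityˡ _))))

    span-least : ∀ {P} → IsSubspace P → (∀ i → P (v i)) → ∀ {u} → Span v u → P u
    span-least {P} sub gen (ts , eq) = ≋-closed (λ m → sym (eq m)) (combination ts)
      where
      open IsSubspace sub
      combination : ∀ ts → P (linearCombination v ts)
      combination []             = 𝟘-closed
      combination ((q , i) ∷ ts) = ⊕-closed (·-closed q (gen i)) (combination ts)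

-- Linear maps, bilinearity of the product, pushforward along a homomorphism

module _ (M N : DecMonoid) where
  private
    module M = Pairing M
    module N = Pairing N
  open MonoidAlgebra M using () renaming (ℚ[M] to ℚ[M]; _≋_ to _≋ᴹ_)
  open MonoidAlgebra N using (_≋_) renaming (ℚ[M] to ℚ[N])

  -- Linear maps are presented by their transpose on invariant functions.
  record IsLinear (L : ℚ[M] → ℚ[N]) : Set where
    field
      transpose           : (DecMonoid.Carrier N → ℚ) → (DecMonoid.Carrier M → ℚ)
      transpose-invariant : ∀ {φ} → N.Invariant φ → M.Invariant (transpose φ)
      adjoint             : ∀ u φ → N.∫ (L u) φ ≡ M.∫ u (transpose φ)

    linear-cong : ∀ {u v} → u ≋ᴹ v → L u ≋ L v
    linear-cong {u} {v} u≋v = N.from-∫ {L u} {L v} λ m → trans (adjoint u _)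
      (trans (M.∫-ext {u} {v} u≋v (transpose-invariant (N.δ-invariant m))) (sym (adjoint v _)))

    linear-𝟘 : MonoidAlgebra.𝟘 N ≋ L []
    linear-𝟘 = N.from-∫ {[]} {L []} λ m → sym (adjoint [] _)

    linear-⊕ : ∀ u v → MonoidAlgebra._⊕_ N (L u) (L v) ≋ L (u ++ v)
    linear-⊕ u v = N.from-∫ {L u ++ L v} {L (u ++ v)} λ m → trans (N.∫-⊕ (L u) (L v) _)
      (trans (cong₂ ℚ._+_ (adjoint u _) (adjoint v _)) (sym (trans (adjoint (u ++ v) _) (M.∫-⊕ u v _))))

    linear-· : ∀ q u → MonoidAlgebra._·_ N q (L u) ≋ L (MonoidAlgebra._·_ M q u)
    linear-· q u = N.from-∫ {MonoidAlgebra._·_ N q (L u)} {L (MonoidAlgebra._·_ M q u)} λ m → trans (N.∫-· q (L u) _)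
      (trans (cong (q ℚ.*_) (adjoint u _)) (sym (trans (adjoint (MonoidAlgebra._·_ M q u) _) (M.∫-· q u _))))

module _ {M N : DecMonoid} {L : MonoidAlgebra.ℚ[M] M → MonoidAlgebra.ℚ[M] N} (lin : IsLinear M N L) where
  open IsLinear lin
  private
    module M = Pairing M
    module N = Pairing N

  preimage-isSubspace : ∀ {P} → N.IsSubspace P → M.IsSubspace (P ∘ L)
  preimage-isSubspace sub = record
    { ≋-closed = λ {u} {v} eq → ≋-closed (linear-cong {u} {v} eq)
    ; 𝟘-closed = ≋-closed linear-𝟘 𝟘-closed
    ; ⊕-closed = λ {u} {v} p q → ≋-closed (linear-⊕ u v) (⊕-closed p q)
    ; ·-closed = λ q {u} p → ≋-closed (linear-· q u) (·-closed q p)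
    }
    where open N.IsSubspace sub

  equaliser-isSubspace : ∀ {K} → IsLinear M N K → M.IsSubspace (λ u → MonoidAlgebra._≋_ N (L u) (K u))
  equaliser-isSubspace {K} lin′ = record
    { ≋-closed = λ {u} {v} eq p m → trans (sym (linear-cong {u} {v} eq m)) (trans (p m) (K.linear-cong {u} {v} eq m))
    ; 𝟘-closed = λ m → trans (sym (linear-𝟘 m)) (K.linear-𝟘 m)
    ; ⊕-closed = λ {u} {v} p q m → trans (sym (linear-⊕ u v m))
        (trans (trans (N.coefficient-⊕ (L u) (L v) m) (trans (cong₂ ℚ._+_ (p m) (q m)) (sym (N.coefficient-⊕ (K u) (K v) m))))
               (K.linear-⊕ u v m))
    ; ·-closed = λ q {u} p m → trans (sym (linear-· q u m))
        (trans (trans (N.coefficient-· q (L u) m) (trans (cong (q ℚ.*_) (p m)) (sym (N.coefficient-· q (K u) m))))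
               (K.linear-· q u m))
    }
    where module K = IsLinear lin′

module Multiplication (M : DecMonoid) where
  open DecMonoid M using (Carrier; _∙_; ∙-cong) renaming (refl to ≈-refl)
  open MonoidAlgebra M
  open Pairing M

  -- Fubini for finite sums; it supplies the transpose of multiplication in the right-hand factor.
  ∫-swap : ∀ u v (φ : Carrier → Carrier → ℚ) → ∫ u (λ x → ∫ v (φ x)) ≡ ∫ v (λ y → ∫ u (λ x → φ x y))
  ∫-swap []            v φ = sym (∫-0 v)
  ∫-swap ((q , x) ∷ u) v φ = trans (cong (q ℚ.* ∫ v (φ x) ℚ.+_) (∫-swap u v φ)) (sym (∫-linear v q (φ x) _))

  ⊛-linearˡ : ∀ v → IsLinear M M (_⊛ v)
  ⊛-linearˡ v = record
    { transpose           = λ φ x → ∫ v (λ y → φ (x ∙ y))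
    ; transpose-invariant = λ inv x≈x′ → ∫-cong v (λ y → inv (∙-cong x≈x′ ≈-refl))
    ; adjoint             = λ u φ → ∫-⊛ u v φ
    }

  ⊛-linearʳ : ∀ u → IsLinear M M (u ⊛_)
  ⊛-linearʳ u = record
    { transpose           = λ φ y → ∫ u (λ x → φ (x ∙ y))
    ; transpose-invariant = λ inv y≈y′ → ∫-cong u (λ x → inv (∙-cong ≈-refl y≈y′))
    ; adjoint             = λ v φ → trans (∫-⊛ u v φ) (∫-swap u v (λ x y → φ (x ∙ y)))
    }

  module _ {I : Set} (v : I → ℚ[M]) where

    -- With one factor fixed, the other factors whose product lies in the span form a subspace.
    -- Using this once for each side reduces closure to products of generators.
    span-isSubalgebra : (∀ i j → Span v (v i ⊛ v j)) → IsSubalgebra (Span v)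
    span-isSubalgebra closed = record
      { ≋-closed = λ {u} {w} → ≋-closed {u} {w}
      ; 𝟘-closed = 𝟘-closed
      ; ⊕-closed = λ {u} {w} → ⊕-closed {u} {w}
      ; ·-closed = λ q {u} → ·-closed q {u}
      ; ⊛-closed = λ {u} {w} su sw →
          span-least v (preimage-isSubspace (⊛-linearˡ w) (span-isSubspace v))
            (λ i → span-least v (preimage-isSubspace (⊛-linearʳ (v i)) (span-isSubspace v)) (closed i) {w} sw) {u} su
      }
      where open IsSubspace (span-isSubspace v)

    -- The elements commuting with a fixed one are the equaliser of left and right multiplication by
    -- it, hence a subspace.
    span-isCommutative : (∀ i j → v i ⊛ v j ≋ v j ⊛ v i) → IsCommutative (Span v)
    span-isCommutative comm {u} {w} su sw =
      span-least v (equaliser-isSubspace (⊛-linearˡ w) (⊛-linearʳ w))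
        (λ i → span-least v (equaliser-isSubspace (⊛-linearʳ (v i)) (⊛-linearˡ (v i))) (comm i) {w} sw) {u} su

module _ (M N : DecMonoid) (f : DecMonoid.Carrier M → DecMonoid.Carrier N)
         (f-cong : ∀ {x y} → DecMonoid._≈_ M x y → DecMonoid._≈_ N (f x) (f y)) where
  private
    module M = MonoidAlgebra M
    module N = MonoidAlgebra N
    module ∫M = Pairing M
    module ∫N = Pairing N
  open DecMonoid M using () renaming (_∙_ to _∙ᴹ_)
  open DecMonoid N using () renaming (_∙_ to _∙ᴺ_)

  pushforward : M.ℚ[M] → N.ℚ[M]
  pushforward = map (λ (q , x) → (q , f x))

  ∫-pushforward : ∀ u φ → ∫N.∫ (pushforward u) φ ≡ ∫M.∫ u (φ ∘ f)
  ∫-pushforward []            φ = refl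
  ∫-pushforward ((q , x) ∷ u) φ = cong (q ℚ.* φ (f x) ℚ.+_) (∫-pushforward u φ)

  pushforward-linear : IsLinear M N pushforward
  pushforward-linear = record
    { transpose           = _∘ f
    ; transpose-invariant = λ inv → inv ∘ f-cong
    ; adjoint             = ∫-pushforward
    }

  pushforward-⊛ : (∀ x y → DecMonoid._≈_ N (f (x ∙ᴹ y)) (f x ∙ᴺ f y)) →
                  ∀ u v → pushforward (u M.⊛ v) N.≋ (pushforward u N.⊛ pushforward v)
  pushforward-⊛ homo u v = ∫N.from-∫ {pushforward (u M.⊛ v)} {pushforward u N.⊛ pushforward v} λ m → begin
    ∫N.∫ (pushforward (u M.⊛ v)) (∫N.δ m)
      ≡⟨ trans (∫-pushforward (u M.⊛ v) _) (∫M.∫-⊛ u v _) ⟩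
    ∫M.∫ u (λ x → ∫M.∫ v (λ y → ∫N.δ m (f (x ∙ᴹ y))))
      ≡⟨ ∫M.∫-cong u (λ x → ∫M.∫-cong v (λ y → ∫N.δ-invariant m (homo x y))) ⟩
    ∫M.∫ u (λ x → ∫M.∫ v (λ y → ∫N.δ m (f x ∙ᴺ f y)))
      ≡⟨ ∫M.∫-cong u (λ x → ∫-pushforward v (λ y → ∫N.δ m (f x ∙ᴺ y))) ⟨
    ∫M.∫ u (λ x → ∫N.∫ (pushforward v) (λ y → ∫N.δ m (f x ∙ᴺ y)))
      ≡⟨ trans (∫N.∫-⊛ (pushforward u) (pushforward v) _) (∫-pushforward u _) ⟨
    ∫N.∫ (pushforward u N.⊛ pushforward v) (∫N.δ m) ∎
    where open ≡-Reasoning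

  pushforward-sumOf : ∀ xs → pushforward (M.sumOf xs) ≡ N.sumOf (map f xs)
  pushforward-sumOf []       = refl
  pushforward-sumOf (x ∷ xs) = cong ((1ℚ , f x) ∷_) (pushforward-sumOf xs)

-- Counting by injective relations, finite enumerations

module _ (S T : Setoid 0ℓ 0ℓ) where
  open Setoid S using () renaming (Carrier to A; _≈_ to _≈ˢ_; sym to symˢ)
  open Setoid T using () renaming (Carrier to B; _≈_ to _≈ᵗ_; trans to transᵗ; sym to symᵗ)
  open Membership S using () renaming (_∈_ to _∈ˢ_)
  open Membership T using () renaming (_∈_ to _∈ᵗ_)

  private
    extract : ∀ {y ys} → y ∈ᵗ ys → ∃ λ zs → length ys ≡ suc (length zs) × (∀ {z} → z ∈ᵗ ys → z ≈ᵗ y ⊎ z ∈ᵗ zs)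
    extract {y} {x ∷ ys} (here y≈x) = ys , refl , λ { (here z≈x) → inj₁ (transᵗ z≈x (symᵗ y≈x)) ; (there z∈) → inj₂ z∈ }
    extract {y} {x ∷ ys} (there y∈) with extract y∈
    ... | zs , eq , rest = x ∷ zs , cong suc eq , λ
      { (here z≈x) → inj₂ (here z≈x)
      ; (there z∈) → Sum.map₂ there (rest z∈) }

  -- Remove the partner of the head from `ys`; partners of later elements survive, since an equal
  -- partner would repeat the head in `xs`. A relation is used because partners arise as existential
  -- witnesses built from membership proofs.
  pigeonhole : (R : A → B → Set) → (∀ {x x′ y y′} → R x y → R x′ y′ → y ≈ᵗ y′ → x ≈ˢ x′) →
    ∀ {xs ys} → Uniqueness.Unique S xs → (∀ {x} → x ∈ˢ xs → ∃ λ y → y ∈ᵗ ys × R x y) → length xs ≤ length ys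
  pigeonhole R inj {[]}     []              total = z≤n
  pigeonhole R inj {x ∷ xs} (x∉xs ∷ unique) total with total (here (Setoid.refl S))
  ... | y , y∈ys , Rxy with extract y∈ys
  ...   | zs , eq , rest = subst (suc (length xs) ≤_) (sym eq) (s≤s (pigeonhole R inj unique total′))
    where
    total′ : ∀ {x′} → x′ ∈ˢ xs → ∃ λ y′ → y′ ∈ᵗ zs × R x′ y′
    total′ {x′} x′∈ with total (there x′∈)
    ... | y′ , y′∈ , Rx′y′ with rest y′∈
    ...   | inj₂ y′∈zs = y′ , y′∈zs , Rx′y′
    ...   | inj₁ y′≈y  = contradiction (∈.∈-resp-≈ S (inj Rx′y′ Rxy y′≈y) x′∈) (All.All¬⇒¬Any x∉xs)

record Enumeration (S : Setoid 0ℓ 0ℓ) : Set where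
  open Setoid S using (Carrier)
  open Membership S using (_∈_)
  open Uniqueness S using (Unique)
  field
    elements : List Carrier
    distinct : Unique elements
    covers   : ∀ x → x ∈ elements

  search : ∀ {P : Pred Carrier 0ℓ} → Decidable P → (∀ {x y} → Setoid._≈_ S x y → P x → P y) → Dec (∃ P)
  search P? P-resp = map′ Any.satisfied (λ (x , p) → Any.map (λ x≈y → P-resp x≈y p) (covers x)) (Any.any? P? elements)

  bounded : (μ : Carrier → ℕ) → (∀ {x y} → Setoid._≈_ S x y → μ x ≡ μ y) → ∃ λ b → ∀ x → μ x < b
  bounded μ μ-cong = proj₁ (bound elements) , λ x → proj₂ (bound elements) (covers x)
    where
    bound : ∀ xs → ∃ λ b → ∀ {x} → x ∈ xs → μ x < b
    bound []       = 0 , λ ()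
    bound (y ∷ xs) with bound xs
    ... | b , lt = suc (μ y) + b , λ
      { (here x≈y) → ≤-trans (s≤s (≤-reflexive (μ-cong x≈y))) (m≤m+n (suc (μ y)) b)
      ; (there x∈) → ≤-trans (lt x∈) (m≤n+m b (suc (μ y))) }

-- Class sums, class functions and triangular families

module ClassSums (M : DecMonoid) where
  open DecMonoid M using (Carrier; _≈?_; _≈_; setoid) renaming (refl to ≈-refl; sym to ≈-sym; trans to ≈-trans)
  open MonoidAlgebra M
  open Pairing M
  open Membership setoid using (_∈_; _∉_)
  open Uniqueness setoid using (Unique)

  coefficient-image : ∀ {A : Set} (f : A → Carrier) xs m →
    coefficient (sumOf (map f xs)) m ≡ fromℕℚ (length (filter (λ x → f x ≈? m) xs))
  coefficient-image f []       m = refl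
  coefficient-image f (x ∷ xs) m with does (f x ≈? m)
  ... | true  = cong (1ℚ ℚ.+_) (coefficient-image f xs m)
  ... | false = trans (ℚ.+-identityˡ _) (coefficient-image f xs m)

  coefficient-∉ : ∀ {xs m} → m ∉ xs → coefficient (sumOf xs) m ≡ 0ℚ
  coefficient-∉ {[]}     {m} m∉ = refl
  coefficient-∉ {x ∷ xs} {m} m∉ with x ≈? m
  ... | yes x≈m = contradiction (here (≈-sym x≈m)) m∉
  ... | no _    = trans (ℚ.+-identityˡ _) (coefficient-∉ (m∉ ∘ there))

  coefficient-∈ : ∀ {xs m} → Unique xs → m ∈ xs → coefficient (sumOf xs) m ≡ 1ℚ
  coefficient-∈ {x ∷ xs} {m} (x∉xs ∷ unique) m∈ with x ≈? m | m∈
  ... | no x≉m  | here m≈x   = contradiction (≈-sym m≈x) x≉m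
  ... | no x≉m  | there m∈xs = trans (ℚ.+-identityˡ _) (coefficient-∈ unique m∈xs)
  ... | yes x≈m | _          = trans (cong (1ℚ ℚ.+_) (coefficient-∉ m∉xs)) (ℚ.+-identityʳ 1ℚ)
    where
    m∉xs : m ∉ xs
    m∉xs m∈xs = All.All¬⇒¬Any x∉xs (∈.∈-resp-≈ setoid (≈-sym x≈m) m∈xs)

  -- Without repetitions every coefficient is 1 or 0 according to membership.
  sumOf-cong : ∀ {xs ys} → Unique xs → Unique ys → (∀ m → m ∈ xs → m ∈ ys) → (∀ m → m ∈ ys → m ∈ xs) →
               sumOf xs ≋ sumOf ys
  sumOf-cong {xs} {ys} xs! ys! xs⊆ys ys⊆xs m with Any.any? (m ≈?_) xs
  ... | yes m∈xs = trans (coefficient-∈ xs! m∈xs) (sym (coefficient-∈ ys! (xs⊆ys m m∈xs)))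
  ... | no m∉xs  = trans (coefficient-∉ m∉xs) (sym (coefficient-∉ (m∉xs ∘ ys⊆xs m)))

  coefficient-image-≢0 : ∀ {A : Set} (f : A → Carrier) {xs m} → Any (λ x → f x ≈ m) xs → coefficient (sumOf (map f xs)) m ≢ 0ℚ
  coefficient-image-≢0 f {xs} {m} hit eq with filter (λ x → f x ≈? m) xs | filter-nonempty hit | coefficient-image f xs m
    where
    filter-nonempty : ∀ {xs} → Any (λ x → f x ≈ m) xs → 0 < length (filter (λ x → f x ≈? m) xs)
    filter-nonempty {xs} hit = ≤-trans (s≤s z≤n) (filter-some (λ x → f x ≈? m) hit)
  ... | y ∷ ys | _ | count = fromℕℚ-nonZero (length ys) (trans (sym count) eq)

  coefficient-image-≡0 : ∀ {A : Set} (f : A → Carrier) {xs m} → ¬ Any (λ x → f x ≈ m) xs → coefficient (sumOf (map f xs)) m ≡ 0ℚ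
  coefficient-image-≡0 f miss = coefficient-∉ (miss ∘ Any.map ≈-sym ∘ Any.map⁻)

  coefficient-combination : ∀ {I : Set} (v : I → ℚ[M]) q i ts m →
    coefficient (linearCombination v ((q , i) ∷ ts)) m ≡ q ℚ.* coefficient (v i) m ℚ.+ coefficient (linearCombination v ts) m
  coefficient-combination v q i ts m =
    trans (coefficient-⊕ (q · v i) (linearCombination v ts) m) (cong (ℚ._+ _) (coefficient-· q (v i) m))

  module _ {V : Set} {μ : Carrier → V} (levels : FiniteLevelSets μ) where
    open FiniteLevelSets levels

    coefficient-classSum-≡ : ∀ x y → μ y ≡ μ x → coefficient (classSum x) y ≡ 1ℚ
    coefficient-classSum-≡ x y eq = coefficient-∈ (unique x) (Equivalence.from (complete x y) eq)

    coefficient-classSum-≢ : ∀ x y → μ y ≢ μ x → coefficient (classSum x) y ≡ 0ℚ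
    coefficient-classSum-≢ x y neq = coefficient-∉ (neq ∘ Equivalence.to (complete x y))

    classSum-independent : LinearlyIndependent (classes μ) classSum
    classSum-independent []             distinct         null = []
    classSum-independent ((q , i) ∷ ts) (i≢ts ∷ distinct) null = q≡0 ∷ classSum-independent ts distinct rest
      where
      other : ∀ ts → All (λ t → μ i ≢ μ (proj₂ t)) ts → coefficient (linearCombination classSum ts) i ≡ 0ℚ
      other []             []            = refl
      other ((r , j) ∷ ts) (i≢j ∷ i≢ts) = trans (coefficient-combination classSum r j ts i)
        (trans (cong₂ (λ a b → r ℚ.* a ℚ.+ b) (coefficient-classSum-≢ j i i≢j) (other ts i≢ts))
        (trans (ℚ.+-identityʳ _) (ℚ.*-zeroʳ r)))
      q≡0 : q ≡ 0ℚ
      q≡0 = begin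
        q
          ≡⟨ trans (ℚ.+-identityʳ _) (ℚ.*-identityʳ q) ⟨
        q ℚ.* 1ℚ ℚ.+ 0ℚ
          ≡⟨ cong₂ (λ a b → q ℚ.* a ℚ.+ b) (coefficient-classSum-≡ i i refl) (other ts i≢ts) ⟨
        q ℚ.* coefficient (classSum i) i ℚ.+ coefficient (linearCombination classSum ts) i
          ≡⟨ coefficient-combination classSum q i ts i ⟨
        coefficient (linearCombination classSum ((q , i) ∷ ts)) i
          ≡⟨ null i ⟩
        0ℚ ∎
        where open ≡-Reasoning
      rest : linearCombination classSum ts ≋ 𝟘
      rest m = begin
        coefficient (linearCombination classSum ts) m
          ≡⟨ trans (cong (ℚ._+ coefficient (linearCombination classSum ts) m) (ℚ.*-zeroˡ (coefficient (classSum i) m)))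
               (ℚ.+-identityˡ (coefficient (linearCombination classSum ts) m)) ⟨
        0ℚ ℚ.* coefficient (classSum i) m ℚ.+ coefficient (linearCombination classSum ts) m
          ≡⟨ cong (λ a → a ℚ.* coefficient (classSum i) m ℚ.+ coefficient (linearCombination classSum ts) m) q≡0 ⟨
        q ℚ.* coefficient (classSum i) m ℚ.+ coefficient (linearCombination classSum ts) m
          ≡⟨ coefficient-combination classSum q i ts m ⟨
        coefficient (linearCombination classSum ((q , i) ∷ ts)) m
          ≡⟨ null m ⟩
        0ℚ ∎
        where open ≡-Reasoning

  module _ {μ : Carrier → ℕ} (μ-cong : ∀ {x y} → x ≈ y → μ x ≡ μ y) (enumeration : Enumeration setoid) where
    open Enumeration enumeration

    enumeratedLevelSets : FiniteLevelSets μ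
    enumeratedLevelSets = record
      { levelSet = λ x → filter (λ y → μ y ≟ μ x) elements
      ; unique   = λ x → Unique.filter⁺ setoid (λ y → μ y ≟ μ x) distinct
      ; complete = λ x y → mk⇔
          (λ y∈ → proj₂ (∈.∈-filter⁻ setoid (λ y → μ y ≟ μ x) (same-level x) {xs = elements} y∈))
          (λ eq → ∈.∈-filter⁺ setoid (λ y → μ y ≟ μ x) (same-level x) (covers y) eq)
      }
      where
      same-level : ∀ x {y z} → y ≈ z → μ y ≡ μ x → μ z ≡ μ x
      same-level x y≈z eq = trans (sym (μ-cong y≈z)) eq

    IsClassFunction : Pred ℚ[M] 0ℓ
    IsClassFunction u = ∀ {x y} → μ x ≡ μ y → coefficient u x ≡ coefficient u y

    classFunctions-isSubspace : IsSubspace IsClassFunction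
    classFunctions-isSubspace = record
      { ≋-closed = λ u≋v cf {x} {y} eq → trans (sym (u≋v x)) (trans (cf eq) (u≋v y))
      ; 𝟘-closed = λ _ → refl
      ; ⊕-closed = λ {u} {v} cf cf′ {x} {y} eq →
          trans (coefficient-⊕ u v x) (trans (cong₂ ℚ._+_ (cf eq) (cf′ eq)) (sym (coefficient-⊕ u v y)))
      ; ·-closed = λ q {u} cf {x} {y} eq →
          trans (coefficient-· q u x) (trans (cong (q ℚ.*_) (cf eq)) (sym (coefficient-· q u y)))
      }

    classSum-isClassFunction : (levels : FiniteLevelSets μ) → ∀ x → IsClassFunction (FiniteLevelSets.classSum levels x)
    classSum-isClassFunction levels x {y} {z} eq with μ y ≟ μ x
    ... | yes y~x = trans (coefficient-classSum-≡ levels x y y~x) (sym (coefficient-classSum-≡ levels x z (trans (sym eq) y~x)))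
    ... | no y≁x  = trans (coefficient-classSum-≢ levels x y y≁x) (sym (coefficient-classSum-≢ levels x z (y≁x ∘ trans eq)))

    -- The diagonal entry at `x` belongs to the generator `leading x`. `J` is arbitrary since the
    -- families of interest are indexed by representatives, for instance by all ruffles, whose
    -- numbers of hands are unbounded.
    record IsTriangular {J : Set} (v : J → ℚ[M]) : Set where
      field
        classFunction : ∀ j → IsClassFunction (v j)
        leading       : Carrier → J
        leading≢0     : ∀ x → coefficient (v (leading x)) x ≢ 0ℚ
        above≡0       : ∀ {x y} → μ x < μ y → coefficient (v (leading x)) y ≡ 0ℚ

    -- The class sums are the diagonal case. Elimination therefore applies to them as well, and any
    -- triangular family has the same span as they have, namely all class functions.
    classSum-isTriangular : (levels : FiniteLevelSets μ) → IsTriangular (FiniteLevelSets.classSum levels)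
    classSum-isTriangular levels = record
      { classFunction = classSum-isClassFunction levels
      ; leading       = λ x → x
      ; leading≢0     = λ x eq → contradiction (trans (sym (coefficient-classSum-≡ levels x x refl)) eq) λ ()
      ; above≡0       = λ {x} {y} lt → coefficient-classSum-≢ levels x y (<⇒≢ lt ∘ sym)
      }

    module _ {J : Set} {v : J → ℚ[M]} (triangular : IsTriangular v) where
      open IsTriangular triangular

      span⇒classFunction : ∀ {u} → Span v u → IsClassFunction u
      span⇒classFunction {u} = span-least v classFunctions-isSubspace classFunction {u}

      -- Clear the coefficients on the highest remaining class with the
      -- generator that leads there.
      classFunction⇒span : ∀ {u} → IsClassFunction u → Span v u
      classFunction⇒span {u} cf = eliminate (proj₁ bound) u cf λ x le → contradiction (proj₂ bound x) (≤⇒≯ le)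
        where
        bound = bounded μ μ-cong
        open IsSubspace (span-isSubspace v)
        eliminate : ∀ k u → IsClassFunction u → (∀ x → k ≤ μ x → coefficient u x ≡ 0ℚ) → Span v u
        eliminate zero    u cf null = ≋-closed {𝟘} {u} (λ m → sym (null m z≤n)) 𝟘-closed
        eliminate (suc k) u cf null with search (λ x → μ x ≟ k) (λ x≈y eq → trans (sym (μ-cong x≈y)) eq)
        ... | no unattained = eliminate k u cf λ x le → null x (≤∧≢⇒< le (λ eq → unattained (x , sym eq)))
        ... | yes (x , μx≡k) = ≋-closed {reduced ⊕ c · w} {u} restored
                (⊕-closed {reduced} {c · w} (eliminate k reduced cf′ null′) (·-closed c {w} (span-generator v (leading x))))
          where
          w = v (leading x)
          instance
            w≢0 : ℚ.NonZero (coefficient w x)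
            w≢0 = ℚ.≢-nonZero (leading≢0 x)
          c = coefficient u x ℚ.÷ coefficient w x
          reduced = u ⊕ (ℚ.- c) · w
          coefficient-reduced : ∀ m → coefficient reduced m ≡ coefficient u m ℚ.+ ℚ.- c ℚ.* coefficient w m
          coefficient-reduced m = trans (coefficient-⊕ u ((ℚ.- c) · w) m) (cong (coefficient u m ℚ.+_) (coefficient-· (ℚ.- c) w m))
          restored : reduced ⊕ c · w ≋ u
          restored m = trans (coefficient-⊕ reduced (c · w) m)
            (trans (cong₂ ℚ._+_ (coefficient-reduced m) (coefficient-· c w m))
                   (sym (Rational.restore c (coefficient u m) (coefficient w m))))
          cf′ : IsClassFunction reduced
          cf′ = IsSubspace.⊕-closed classFunctions-isSubspace {u} {(ℚ.- c) · w} cf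
                  (IsSubspace.·-closed classFunctions-isSubspace (ℚ.- c) {w} (classFunction (leading x)))
          at-x : coefficient reduced x ≡ 0ℚ
          at-x = trans (coefficient-reduced x)
            (trans (cong (coefficient u x ℚ.+_) (trans (Rational.neg-* c (coefficient w x))
                     (cong ℚ.-_ (Rational.quotient (coefficient u x) (coefficient w x)))))
                   (ℚ.+-inverseʳ (coefficient u x)))
          null′ : ∀ y → k ≤ μ y → coefficient reduced y ≡ 0ℚ
          null′ y le with m≤n⇒m<n∨m≡n le
          ... | inj₂ eq = trans (cf′ (sym (trans μx≡k eq))) at-x
          ... | inj₁ lt = trans (coefficient-reduced y)
                  (trans (cong₂ (λ a b → a ℚ.+ ℚ.- c ℚ.* b) (null y lt) (above≡0 (subst (_< μ y) (sym μx≡k) lt)))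
                  (trans (ℚ.+-identityˡ _) (ℚ.*-zeroʳ (ℚ.- c))))

    module _ {J : Set} {v : J → ℚ[M]} (triangular : IsTriangular v) (levels : FiniteLevelSets μ) where

      toClassSums : ∀ {u} → Span v u → Span (FiniteLevelSets.classSum levels) u
      toClassSums {u} = classFunction⇒span (classSum-isTriangular levels) {u} ∘ span⇒classFunction triangular {u}

      fromClassSums : ∀ {u} → Span (FiniteLevelSets.classSum levels) u → Span v u
      fromClassSums {u} = classFunction⇒span triangular {u} ∘ span⇒classFunction (classSum-isTriangular levels) {u}

      -- Products are computed in the family `v`, where they are understood, and the result is
      -- carried back to the class sums through the common span.
      triangular⇒lumping : (∀ i j → Span v (v i ⊛ v j)) → IsLumping μ
      triangular⇒lumping closed = record
        { finiteLevelSets = levels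
        ; independent     = classSum-independent levels
        ; isSubalgebra    = record
          { ≋-closed = λ {u} {w} eq → IsSubspace.≋-closed classSpan {u} {w} eq
          ; 𝟘-closed = IsSubspace.𝟘-closed classSpan
          ; ⊕-closed = λ {u} {w} → IsSubspace.⊕-closed classSpan {u} {w}
          ; ·-closed = λ q {u} → IsSubspace.·-closed classSpan q {u}
          ; ⊛-closed = λ {u} {w} su sw → toClassSums {u ⊛ w}
              (IsSubalgebra.⊛-closed (Multiplication.span-isSubalgebra M v closed) {u} {w} (fromClassSums {u} su) (fromClassSums {w} sw))
          }
        }
        where
        classSpan = span-isSubspace (FiniteLevelSets.classSum levels)

      triangular⇒commutative : (∀ i j → v i ⊛ v j ≋ v j ⊛ v i) →
        IsCommutative (Span (FiniteLevelSets.classSum levels))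
      triangular⇒commutative comm {u} {w} su sw =
        Multiplication.span-isCommutative M v comm {u} {w} (fromClassSums {u} su) (fromClassSums {w} sw)

-- Enumerations of functions and permutations

module _ {A : Set} (enumeration : Enumeration (≡.setoid A)) where
  open Enumeration enumeration

  functionList : ∀ n → List (Fin n → A)
  functionList zero    = (λ ()) ∷ []
  functionList (suc n) = cartesianProductWith Vector._∷_ elements (functionList n)

  functions : ∀ n → Enumeration (Fin n →-setoid A)
  functions n = record { elements = functionList n ; distinct = unique n ; covers = every n }
    where
    unique : ∀ n → Uniqueness.Unique (Fin n →-setoid A) (functionList n)
    unique zero    = [] ∷ []
    unique (suc n) = Unique.cartesianProductWith⁺ (≡.setoid A) (Fin n →-setoid A) (Fin (suc n) →-setoid A)
      Vector._∷_ (λ eq → eq zero , eq ∘ suc) distinct (unique n)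
    every : ∀ n (f : Fin n → A) → Membership._∈_ (Fin n →-setoid A) f (functionList n)
    every zero    f = here λ ()
    every (suc n) f = ∈.∈-resp-≈ (Fin (suc n) →-setoid A) (λ { zero → refl ; (suc i) → refl })
      (∈.∈-cartesianProductWith⁺ (≡.setoid A) (Fin n →-setoid A) (Fin (suc n) →-setoid A)
        (λ { eq eq′ zero → eq ; eq eq′ (suc i) → eq′ i }) (covers (f zero)) (every n (f ∘ suc)))

fins : ∀ a → Enumeration (≡.setoid (Fin a))
fins a = record { elements = allFin a ; distinct = allFin⁺ a ; covers = ∈-allFin }

signs : Enumeration (≡.setoid Sign)
signs = record
  { elements = Sign.+ ∷ Sign.- ∷ []
  ; distinct = ((λ ()) ∷ []) ∷ [] ∷ []
  ; covers   = λ { Sign.+ → here refl ; Sign.- → there (here refl) }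
  }

-- A permutation amounts to the image of `zero` together with the permutation induced on what
-- remains; `Perm.insert` and `Perm.remove` pass between the two.
permutations : ∀ n → Enumeration (DecMonoid.setoid (𝕊 n))
permutations n = record { elements = list n ; distinct = unique n ; covers = every n }
  where
  list : ∀ n → List (Permutation′ n)
  list zero    = Perm.id ∷ []
  list (suc n) = cartesianProductWith (Perm.insert zero) (allFin (suc n)) (list n)
  unique : ∀ n → Uniqueness.Unique (DecMonoid.setoid (𝕊 n)) (list n)
  unique zero    = [] ∷ []
  unique (suc n) = Unique.cartesianProductWith⁺ (≡.setoid (Fin (suc n))) (DecMonoid.setoid (𝕊 n)) (DecMonoid.setoid (𝕊 (suc n)))
    (Perm.insert zero) injective (allFin⁺ (suc n)) (unique n)
    where
    injective : ∀ {j k : Fin (suc n)} {σ τ : Permutation′ n} →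
                Perm.insert zero j σ Perm.≈ Perm.insert zero k τ → j ≡ k × σ Perm.≈ τ
    injective {j} {k} {σ} {τ} eq with refl ← eq zero = refl , λ i → Fin.punchIn-injective j _ _
      (trans (sym (Perm.insert-punchIn zero j σ i)) (trans (eq (suc i)) (Perm.insert-punchIn zero j τ i)))
  every : ∀ n σ → Membership._∈_ (DecMonoid.setoid (𝕊 n)) σ (list n)
  every zero    σ = here λ ()
  every (suc n) σ = ∈.∈-resp-≈ (DecMonoid.setoid (𝕊 (suc n)))
    {x = Perm.insert zero (σ ⟨$⟩ʳ zero) (Perm.remove zero σ)} {σ} (Perm.insert-remove zero σ)
    (∈.∈-cartesianProductWith⁺ (≡.setoid (Fin (suc n))) (DecMonoid.setoid (𝕊 n)) (DecMonoid.setoid (𝕊 (suc n)))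
      {f = Perm.insert zero} (λ {j} {k} {τ} {υ} → congruent {j} {k} {τ} {υ})
      {b = Perm.remove zero σ} (∈-allFin (σ ⟨$⟩ʳ zero)) (every n (Perm.remove zero σ)))
    where
    congruent : ∀ {j k : Fin (suc n)} {σ τ : Permutation′ n} → j ≡ k → σ Perm.≈ τ →
                Perm.insert zero j σ Perm.≈ Perm.insert zero k τ
    congruent                 refl eq zero    = refl
    congruent {j} {_} {σ} {τ} refl eq (suc i) = trans (Perm.insert-punchIn zero j σ i)
      (trans (cong (punchIn j) (eq i)) (sym (Perm.insert-punchIn zero j τ i)))

-- The orientations are indexed by cards, that is by positions before the move, to match the steps
-- of the graph of σ.
orient : ∀ {n} → Permutation′ n → (Fin n → Sign) → OrientedPerm n
orient {n} σ o = record
  { bijection = mk↔ₛ′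
      (λ (s , i) → s Sign.* o i , σ ⟨$⟩ʳ i)
      (λ (s , j) → s Sign.* o (σ ⟨$⟩ˡ j) , σ ⟨$⟩ˡ j)
      (λ (s , j) → cong₂ _,_ (cancel s (o (σ ⟨$⟩ˡ j))) (Perm.inverseʳ σ))
      (λ (s , i) → cong₂ _,_ (trans (cong (λ k → s Sign.* o i Sign.* o k) (Perm.inverseˡ σ)) (cancel s (o i))) (Perm.inverseˡ σ))
  ; odd = λ (s , i) → cong (_, σ ⟨$⟩ʳ i) (opposite-* s (o i))
  }
  where
  cancel : ∀ s t → s Sign.* t Sign.* t ≡ s
  cancel s t = trans (Sign.*-assoc s t t) (trans (cong (s Sign.*_) (Sign.s*s≡+ t)) (Sign.*-identityʳ s))
  opposite-* : ∀ s t → Sign.opposite s Sign.* t ≡ Sign.opposite (s Sign.* t)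
  opposite-* Sign.- t = sym (Sign.opposite-involutive t)
  opposite-* Sign.+ t = refl

orientation : ∀ {n} → OrientedPerm n → Fin n → Sign
orientation w i = proj₁ (OrientedPerm.to w (Sign.+ , i))

orient-cong : ∀ {n} {σ τ : Permutation′ n} {o p : Fin n → Sign} → σ Perm.≈ τ → (∀ i → o i ≡ p i) → orient σ o ≈± orient τ p
orient-cong σ≈τ o≡p (s , i) = cong₂ _,_ (cong (s Sign.*_) (o≡p i)) (σ≈τ i)

orient-injective : ∀ {n} {σ τ : Permutation′ n} {o p : Fin n → Sign} → orient σ o ≈± orient τ p → σ Perm.≈ τ × (∀ i → o i ≡ p i)
orient-injective eq = (λ i → cong proj₂ (eq (Sign.+ , i))) , (λ i → cong proj₁ (eq (Sign.+ , i)))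

orient-orientation : ∀ {n} (w : OrientedPerm n) → orient (π w) (orientation w) ≈± w
orient-orientation w (s , i) = sym (odd-* (OrientedPerm.to w) (odd w) s i)

orientedPermutations : ∀ n → Enumeration (DecMonoid.setoid (𝕊± n))
orientedPermutations n = record
  { elements = cartesianProductWith orient (elements (permutations n)) (elements (functions signs n))
  ; distinct = Unique.cartesianProductWith⁺ 𝕊-setoid (Fin n →-setoid Sign) 𝕊±-setoid orient
      (λ {σ} {τ} → orient-injective {n} {σ} {τ}) (distinct (permutations n)) (distinct (functions signs n))
  ; covers   = λ w → ∈.∈-resp-≈ 𝕊±-setoid {x = orient (π w) (orientation w)} {w} (orient-orientation w)
      (∈.∈-cartesianProductWith⁺ 𝕊-setoid (Fin n →-setoid Sign) 𝕊±-setoid {f = orient} (λ {σ} {τ} → orient-cong {n} {σ} {τ}) {a = π w}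
        (covers (permutations n) (π w)) (covers (functions signs n) (orientation w)))
  }
  where
  open Enumeration
  𝕊-setoid = DecMonoid.setoid (𝕊 n)
  𝕊±-setoid = DecMonoid.setoid (𝕊± n)

-- Ruffles with a given number of hands

module _ {n a : ℕ} (a≥1 : 1 ≤ a) where

  fromDigits : (Fin n → Fin a) → Ruffle n
  fromDigits f = record { hand = a ; hand≥1 = a≥1 ; source = toℕ ∘ f ; source<hand = Fin.toℕ<n ∘ f }

digits : ∀ {n} (r : Ruffle n) → Fin n → Fin (hand r)
digits r i = fromℕ< (source<hand r i)

handLevelSets : ∀ n → MonoidAlgebra.FiniteLevelSets (RuffleMonoid n) hand
handLevelSets n = record
  { levelSet = λ r → map (fromDigits (hand≥1 r)) (functionList (fins (hand r)) n)
  ; unique   = λ r → Unique.map⁺ (Fin n →-setoid Fin (hand r)) ruffles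
      (λ (_ , eq) i → Fin.toℕ-injective (eq i)) (distinct (functions (fins (hand r)) n))
  ; complete = λ r s → mk⇔ (sound r s) (full r s)
  }
  where
  open Enumeration
  ruffles = DecMonoid.setoid (RuffleMonoid n)
  open Membership ruffles using (_∈_)
  sound : ∀ r s → s ∈ map (fromDigits (hand≥1 r)) (functionList (fins (hand r)) n) → hand s ≡ hand r
  sound r s s∈ = let (f , f∈ , eq , _) = ∈.∈-map⁻ (Fin n →-setoid Fin (hand r)) ruffles {v = s} s∈ in eq
  full : ∀ r s → hand s ≡ hand r → s ∈ map (fromDigits (hand≥1 r)) (functionList (fins (hand r)) n)
  full r s refl = ∈.∈-resp-≈ ruffles {x = fromDigits (hand≥1 r) (digits s)} {s} (refl , λ i → Fin.toℕ-fromℕ< (source<hand s i))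
    (∈.∈-map⁺ (Fin n →-setoid Fin (hand r)) ruffles {f = fromDigits (hand≥1 r)} (λ eq → refl , λ i → cong toℕ (eq i))
      (covers (functions (fins (hand r)) n) (digits s)))

reflect-involutive : ∀ p {b y} → y < b → reflectIfOdd p b (reflectIfOdd p b y) ≡ y
reflect-involutive 0ℙ         y<b       = refl
reflect-involutive 1ℙ {suc b} (s≤s y≤b) = m∸[m∸n]≡n y≤b

-- Uniqueness of quotient and remainder gives the quotients and the reflected remainders at each
-- position. Undoing the reflection, whose parity is now known, recovers `s`, and then the
-- permutation by `s` can be undone on the quotients.
*ᴿ-injective : ∀ {n} {r r′ s s′ : Ruffle n} → hand r ≡ hand r′ → hand s ≡ hand s′ →
               (r *ᴿ s) ≈ᴿ (r′ *ᴿ s′) → r ≈ᴿ r′ × s ≈ᴿ s′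
*ᴿ-injective {n} {r} {r′} {s} {s′} a≡a′ b≡b′ (_ , eq) = (a≡a′ , sources) , (b≡b′ , lower)
  where
  b = hand s
  x  = λ i → source r (cardAt (source s) i)
  x′ = λ i → source r′ (cardAt (source s′) i)
  <b : ∀ i → source s′ i < b
  <b i = subst (source s′ i <_) (sym b≡b′) (source<hand s′ i)
  split : ∀ i → x i ≡ x′ i × reflectIfOdd (parity (x i)) b (source s i) ≡ reflectIfOdd (parity (x′ i)) b (source s′ i)
  split i = digit-≡⁻¹ b (reflect< (parity (x i)) (source<hand s i)) (reflect< (parity (x′ i)) (<b i))
    (trans (eq i) (cong (λ c → c * x′ i + reflectIfOdd (parity (x′ i)) c (source s′ i)) (sym b≡b′)))
  lower : ∀ i → source s i ≡ source s′ i
  lower i = reflect-injective (parity (x′ i)) (source<hand s i) (<b i)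
    (trans (cong (λ m → reflectIfOdd (parity m) b (source s i)) (sym (proj₁ (split i)))) (proj₂ (split i)))
  sources : ∀ c → source r c ≡ source r′ c
  sources c = begin
    source r c
      ≡⟨ cong (source r) (cardAt-positionOf (source s) c) ⟨
    x (positionOf (source s) c)
      ≡⟨ proj₁ (split (positionOf (source s) c)) ⟩
    source r′ (cardAt (source s′) (positionOf (source s) c))
      ≡⟨ cong (source r′) (cardAt-cong lower (positionOf (source s) c)) ⟨
    source r′ (cardAt (source s) (positionOf (source s) c))
      ≡⟨ cong (source r′) (cardAt-positionOf (source s) c) ⟩
    source r′ c ∎
    where open ≡-Reasoning

-- The second factor comes from the remainders modulo `b`, reflected at odd quotients, and can be
-- formed first. The quotients are indexed by final positions, whereas the first factor needs them
-- by the positions before `s` acts; hence `positionOf (source s)`.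
*ᴿ-factorisation : ∀ {n} a b → 1 ≤ a → 1 ≤ b → (t : Ruffle n) → hand t ≡ a * b →
                   ∃ λ r → ∃ λ s → hand r ≡ a × hand s ≡ b × (r *ᴿ s) ≈ᴿ t
*ᴿ-factorisation {n} a b@(suc _) a≥1 b≥1 t eq = r , s , refl , refl , sym eq , recombine
  where
  z = source t
  x : Fin n → ℕ
  x i = z i / b
  x<a : ∀ i → x i < a
  x<a i = m<n*o⇒m/o<n (subst (z i <_) eq (source<hand t i))
  s : Ruffle n
  s = record { hand = b ; hand≥1 = b≥1 ; source = λ i → reflectIfOdd (parity (x i)) b (z i % b)
             ; source<hand = λ i → reflect< (parity (x i)) (m%n<n (z i) b) }
  r : Ruffle n
  r = record { hand = a ; hand≥1 = a≥1 ; source = λ c → x (positionOf (source s) c) ; source<hand = λ c → x<a _ }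
  recombine : ∀ i → source (r *ᴿ s) i ≡ z i
  recombine i = begin
    b * x (positionOf (source s) (cardAt (source s) i)) +
      reflectIfOdd (parity (x (positionOf (source s) (cardAt (source s) i)))) b (source s i)
      ≡⟨ cong (λ j → b * x j + reflectIfOdd (parity (x j)) b (source s i)) (positionOf-cardAt (source s) i) ⟩
    b * x i + reflectIfOdd (parity (x i)) b (source s i)
      ≡⟨ cong₂ _+_ (*-comm b (x i)) (reflect-involutive (parity (x i)) (m%n<n (z i) b)) ⟩
    x i * b + z i % b
      ≡⟨ +-comm (x i * b) (z i % b) ⟩
    z i % b + x i * b
      ≡⟨ m≡m%n+[m/n]*n (z i) b ⟨
    z i ∎
    where open ≡-Reasoning

-- Products of hand classes and of their images

sumOf-⊛ : ∀ (M : DecMonoid) {A B : Set} (f : A → DecMonoid.Carrier M) (g : B → DecMonoid.Carrier M) xs ys →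
  let open DecMonoid M using (_∙_) ; open MonoidAlgebra M in
  sumOf (map f xs) ⊛ sumOf (map g ys) ≡ sumOf (cartesianProductWith (λ x y → f x ∙ g y) xs ys)
sumOf-⊛ M f g []       ys = refl
sumOf-⊛ M f g (x ∷ xs) ys = row ys
  where
  open DecMonoid M using (_∙_)
  open MonoidAlgebra M
  row : ∀ zs → map (λ (r , y) → (1ℚ ℚ.* r , f x ∙ y)) (sumOf (map g zs)) ⊕ (sumOf (map f xs) ⊛ sumOf (map g ys)) ≡
               sumOf (map (λ y → f x ∙ g y) zs ++ cartesianProductWith (λ x y → f x ∙ g y) xs ys)
  row []       = sumOf-⊛ M f g xs ys
  row (z ∷ zs) = cong ((1ℚ , f x ∙ g z) ∷_) (row zs)

classSum-cong : ∀ (M : DecMonoid) {V : Set} {μ : DecMonoid.Carrier M → V} (levels : MonoidAlgebra.FiniteLevelSets M μ) →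
  let open MonoidAlgebra M; open FiniteLevelSets levels in ∀ {x y} → μ x ≡ μ y → classSum x ≋ classSum y
classSum-cong M levels {x} {y} eq = ClassSums.sumOf-cong M (unique x) (unique y)
  (λ m m∈ → from (complete y m) (trans (to (complete x m) m∈) eq))
  (λ m m∈ → from (complete x m) (trans (to (complete y m) m∈) (sym eq)))
  where
  open MonoidAlgebra.FiniteLevelSets levels
  open Equivalence

module HandClasses (n : ℕ) where
  open MonoidAlgebra (RuffleMonoid n)
  open FiniteLevelSets (handLevelSets n) public
  private
    ruffles = DecMonoid.setoid (RuffleMonoid n)

  -- Existence and uniqueness of factorisations with prescribed numbers of hands: the list of
  -- products runs through the class of `r *ᴿ s` exactly once.
  classSum-*ᴿ : ∀ r s → classSum r ⊛ classSum s ≋ classSum (r *ᴿ s)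
  classSum-*ᴿ r s m = trans
    (cong (λ u → coefficient u m) (sumOf-⊛ (RuffleMonoid n) (fromDigits (hand≥1 r)) (fromDigits (hand≥1 s)) fs gs))
    (ClassSums.sumOf-cong (RuffleMonoid n) unique-products (unique (r *ᴿ s))
      (λ t t∈ → Equivalence.from (complete (r *ᴿ s) t) (sound t t∈))
      (λ t t∈ → full t (Equivalence.to (complete (r *ᴿ s) t) t∈)) m)
    where
    open Membership ruffles using (_∈_)
    rs = Fin n →-setoid Fin (hand r)
    ss = Fin n →-setoid Fin (hand s)
    fs = functionList (fins (hand r)) n
    gs = functionList (fins (hand s)) n
    product : (Fin n → Fin (hand r)) → (Fin n → Fin (hand s)) → Ruffle n
    product f g = fromDigits (hand≥1 r) f *ᴿ fromDigits (hand≥1 s) g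
    products = cartesianProductWith product fs gs
    unique-products : Uniqueness.Unique ruffles products
    unique-products = Unique.cartesianProductWith⁺ rs ss ruffles product
      (λ {f} {f′} {g} {g′} eq →
        let ((_ , x) , (_ , y)) = *ᴿ-injective {r = fromDigits (hand≥1 r) f} {fromDigits (hand≥1 r) f′}
                                               {fromDigits (hand≥1 s) g} {fromDigits (hand≥1 s) g′} refl refl eq
        in Fin.toℕ-injective ∘ x , Fin.toℕ-injective ∘ y)
      (Enumeration.distinct (functions (fins (hand r)) n)) (Enumeration.distinct (functions (fins (hand s)) n))
    sound : ∀ t → t ∈ products → hand t ≡ hand r * hand s
    sound t t∈ = let (f , g , _ , _ , eq , _) = ∈.∈-cartesianProductWith⁻ rs ss ruffles product fs gs {t} t∈ in eq
    full : ∀ t → hand t ≡ hand r * hand s → t ∈ products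
    full t eq with *ᴿ-factorisation (hand r) (hand s) (hand≥1 r) (hand≥1 s) t eq
    ... | r′ , s′ , refl , refl , eq′ = ∈.∈-resp-≈ ruffles {x = product (digits r′) (digits s′)} {t}
      (DecMonoid.trans (RuffleMonoid n) {product (digits r′) (digits s′)} {r′ *ᴿ s′} {t}
        (*ᴿ-cong {r = fromDigits (hand≥1 r) (digits r′)} {r′} {fromDigits (hand≥1 s) (digits s′)} {s′}
          (refl , λ i → Fin.toℕ-fromℕ< (source<hand r′ i)) (refl , λ i → Fin.toℕ-fromℕ< (source<hand s′ i)))
        eq′)
      (∈.∈-cartesianProductWith⁺ rs ss ruffles {f = product}
        (λ {f} {f′} {g} {g′} eqf eqg → *ᴿ-cong {r = fromDigits (hand≥1 r) f} {fromDigits (hand≥1 r) f′}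
          {fromDigits (hand≥1 s) g} {fromDigits (hand≥1 s) g′} (refl , λ i → cong toℕ (eqf i)) (refl , λ i → cong toℕ (eqg i)))
        (Enumeration.covers (functions (fins (hand r)) n) (digits r′)) (Enumeration.covers (functions (fins (hand s)) n) (digits s′)))

  hand-isLumping : IsLumping hand
  hand-isLumping = record
    { finiteLevelSets = handLevelSets n
    ; independent     = ClassSums.classSum-independent (RuffleMonoid n) (handLevelSets n)
    ; isSubalgebra    = Multiplication.span-isSubalgebra (RuffleMonoid n) classSum λ r s →
        Pairing.IsSubspace.≋-closed (Pairing.span-isSubspace (RuffleMonoid n) classSum) {classSum (r *ᴿ s)} {classSum r ⊛ classSum s}
          (λ m → sym (classSum-*ᴿ r s m)) (Pairing.span-generator (RuffleMonoid n) classSum (r *ᴿ s))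
    }

  module Image (N : DecMonoid) (f : Ruffle n → DecMonoid.Carrier N)
               (f-cong : ∀ {r s} → r ≈ᴿ s → DecMonoid._≈_ N (f r) (f s))
               (f-homo : ∀ r s → DecMonoid._≈_ N (f (r *ᴿ s)) (DecMonoid._∙_ N (f r) (f s))) where
    private module N = MonoidAlgebra N

    imageSum : Ruffle n → N.ℚ[M]
    imageSum r = N.sumOf (map f (levelSet r))

    imageSum-⊛ : ∀ r s → (imageSum r N.⊛ imageSum s) N.≋ imageSum (r *ᴿ s)
    imageSum-⊛ r s m = begin
      N.coefficient (imageSum r N.⊛ imageSum s) m
        ≡⟨ cong₂ (λ u v → N.coefficient (u N.⊛ v) m) (push-sum (levelSet r)) (push-sum (levelSet s)) ⟨
      N.coefficient (push (classSum r) N.⊛ push (classSum s)) m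
        ≡⟨ pushforward-⊛ (RuffleMonoid n) N f f-cong f-homo (classSum r) (classSum s) m ⟨
      N.coefficient (push (classSum r ⊛ classSum s)) m
        ≡⟨ linear-cong {classSum r ⊛ classSum s} {classSum (r *ᴿ s)} (classSum-*ᴿ r s) m ⟩
      N.coefficient (push (classSum (r *ᴿ s))) m
        ≡⟨ cong (λ u → N.coefficient u m) (push-sum (levelSet (r *ᴿ s))) ⟩
      N.coefficient (imageSum (r *ᴿ s)) m ∎
      where
      open ≡-Reasoning
      open IsLinear (pushforward-linear (RuffleMonoid n) N f f-cong)
      push = pushforward (RuffleMonoid n) N f f-cong
      push-sum = pushforward-sumOf (RuffleMonoid n) N f f-cong

    imageSum-cong : ∀ {r s} → hand r ≡ hand s → imageSum r N.≋ imageSum s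
    imageSum-cong {r} {s} eq m = trans (cong (λ u → N.coefficient u m) (sym (push-sum (levelSet r))))
      (trans (linear-cong {classSum r} {classSum s} (classSum-cong (RuffleMonoid n) (handLevelSets n) {r} {s} eq) m)
             (cong (λ u → N.coefficient u m) (push-sum (levelSet s))))
      where
      open IsLinear (pushforward-linear (RuffleMonoid n) N f f-cong)
      push-sum = pushforward-sumOf (RuffleMonoid n) N f f-cong

    imageSums-closed : ∀ r s → N.Span imageSum (imageSum r N.⊛ imageSum s)
    imageSums-closed r s = Pairing.IsSubspace.≋-closed (Pairing.span-isSubspace N imageSum) {imageSum (r *ᴿ s)} {imageSum r N.⊛ imageSum s}
      (λ m → sym (imageSum-⊛ r s m)) (Pairing.span-generator N imageSum (r *ᴿ s))

    -- `r *ᴿ s` and `s *ᴿ r` may differ, but they have equally many hands and so lie in the same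
    -- class.
    imageSums-commute : ∀ r s → (imageSum r N.⊛ imageSum s) N.≋ (imageSum s N.⊛ imageSum r)
    imageSums-commute r s m = trans (imageSum-⊛ r s m)
      (trans (imageSum-cong {r *ᴿ s} {s *ᴿ r} (*-comm (hand r) (hand s)) m) (sym (imageSum-⊛ s r m)))

-- Partial sums, to recover hands from their increments

partialSum : ∀ {n} → (Fin n → ℕ) → Fin n → ℕ
partialSum f zero    = f zero
partialSum f (suc i) = f zero + partialSum (f ∘ suc) i

partialSum-suc : ∀ {n} (f : Fin (suc n) → ℕ) i → partialSum f (suc i) ≡ f (suc i) + partialSum f (inject₁ i)
partialSum-suc f zero    = +-comm (f zero) (f (suc zero))
partialSum-suc f (suc i) = begin
  f zero + partialSum (f ∘ suc) (suc i)                       ≡⟨ cong (f zero +_) (partialSum-suc (f ∘ suc) i) ⟩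
  f zero + (f (suc (suc i)) + partialSum (f ∘ suc) (inject₁ i)) ≡⟨ +-assoc (f zero) (f (suc (suc i))) _ ⟨
  (f zero + f (suc (suc i))) + partialSum (f ∘ suc) (inject₁ i) 
    ≡⟨ cong (_+ partialSum (f ∘ suc) (inject₁ i)) (+-comm (f zero) (f (suc (suc i)))) ⟩
  (f (suc (suc i)) + f zero) + partialSum (f ∘ suc) (inject₁ i) ≡⟨ +-assoc (f (suc (suc i))) (f zero) _ ⟩
  f (suc (suc i)) + (f zero + partialSum (f ∘ suc) (inject₁ i)) ∎
  where open ≡-Reasoning

partialSum≤sum : ∀ {n} (f : Fin n → ℕ) i → partialSum f i ≤ sum f
partialSum≤sum f zero    = m≤m+n (f zero) _
partialSum≤sum f (suc i) = +-monoʳ-≤ (f zero) (partialSum≤sum (f ∘ suc) i)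

partialSum-last : ∀ {n} (f : Fin (suc n) → ℕ) → partialSum f (fromℕ n) ≡ sum f
partialSum-last {zero}  f = sym (+-identityʳ (f zero))
partialSum-last {suc n} f = cong (f zero +_) (partialSum-last (f ∘ suc))

partialSum-injective : ∀ {n} (f g : Fin n → ℕ) → (∀ i → partialSum f i ≡ partialSum g i) → ∀ i → f i ≡ g i
partialSum-injective f g eq zero    = eq zero
partialSum-injective f g eq (suc i) = partialSum-injective (f ∘ suc) (g ∘ suc) tails i
  where
  tails : ∀ i → partialSum (f ∘ suc) i ≡ partialSum (g ∘ suc) i
  tails i = +-cancelˡ-≡ (f zero) _ _ (trans (eq (suc i)) (cong (_+ partialSum (g ∘ suc) i) (sym (eq zero))))

-- Climbing from hand to hand

-- The hand of the next card in the deck, b, after hand a, when the two cards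
-- are moved to positions in the order s.
Climb : Sign → ℕ → ℕ → Set
Climb s a b = a < b ⊎ (a ≡ b × flipSign b ≡ s)

disagree : Sign → Sign → ℕ
disagree Sign.+ Sign.+ = 0
disagree Sign.- Sign.- = 0
disagree Sign.+ Sign.- = 1
disagree Sign.- Sign.+ = 1

disagree-refl : ∀ s → disagree s s ≡ 0
disagree-refl Sign.+ = refl
disagree-refl Sign.- = refl

flipSign-+ : ∀ a b → flipSign (a + b) ≡ flipSign a Sign.* flipSign b
flipSign-+ a b = trans (cong toSign (ℙ.+-homo-+ a b)) (ℙ.+-homo-* (parity a) (parity b))

flipSign-double : ∀ e a → flipSign (e * 2 + a) ≡ flipSign a
flipSign-double zero    a = refl
flipSign-double (suc e) a = flipSign-double e a

-- The forced part has the parity of the rise, as both record whether the two flips differ. It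
-- reaches 2 only when the flips are equal and opposite to `s`; the rise, being positive and even,
-- is then at least 2. The pattern has period two in `k`.
gap : ∀ s t k → ∃ λ e → suc k ≡ e * 2 + (disagree t s + disagree (flipSign (suc k) Sign.* t) s)
gap Sign.+ Sign.+ 0 = 0 , refl
gap Sign.+ Sign.- 0 = 0 , refl
gap Sign.- Sign.+ 0 = 0 , refl
gap Sign.- Sign.- 0 = 0 , refl
gap Sign.+ Sign.+ 1 = 1 , refl
gap Sign.+ Sign.- 1 = 0 , refl
gap Sign.- Sign.+ 1 = 0 , refl
gap Sign.- Sign.- 1 = 1 , refl
gap s t (suc (suc k)) = let (e , eq) = gap s t k in suc e , cong (λ l → suc (suc l)) eq

-- A positive rise is covered by `gap`. The rise is zero only if the common flip is `s`, and then
-- nothing is forced.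
climb⇒ : ∀ s a b → Climb s a b → ∃ λ e → b ≡ e * 2 + (disagree (flipSign a) s + disagree (flipSign b) s) + a
climb⇒ s a b (inj₂ (refl , refl)) = 0 , cong (λ d → d + d + a) (sym (disagree-refl s))
climb⇒ s a b (inj₁ a<b) with m≤n⇒∃[o]m+o≡n a<b
... | k , refl with gap s (flipSign a) k
...   | e , eq = e , (begin
    suc a + k ≡⟨ cong suc (+-comm a k) ⟩
    suc k + a ≡⟨ cong (_+ a) eq ⟩
    e * 2 + (disagree (flipSign a) s + disagree (flipSign (suc k) Sign.* flipSign a) s) + a
      ≡⟨ cong (λ t → e * 2 + (disagree (flipSign a) s + disagree t s) + a)
           (trans (sym (flipSign-+ (suc k) a)) (cong (flipSign ∘ suc) (+-comm k a))) ⟩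
    e * 2 + (disagree (flipSign a) s + disagree (flipSign (suc a + k)) s) + a ∎)
  where open ≡-Reasoning

-- The flip of the new hand is returned along with the climb because it is the hypothesis for the
-- next climb.
climb⇐ : ∀ s o o′ e a → flipSign a ≡ o →
  let b = e * 2 + (disagree o s + disagree o′ s) + a in flipSign b ≡ o′ × Climb s a b
climb⇐ s o o′ e a refl = trans (cong flipSign (+-assoc (e * 2) d a)) (trans (flipSign-double e (d + a)) (sign s o′)) ,
  climb s o o′ e refl
  where
  d = disagree o s + disagree o′ s
  sign : ∀ s o′ → flipSign (disagree (flipSign a) s + disagree o′ s + a) ≡ o′
  sign s o′ = trans (flipSign-+ (disagree (flipSign a) s + disagree o′ s) a) (table s (flipSign a) o′)
    where
    table : ∀ s o o′ → flipSign (disagree o s + disagree o′ s) Sign.* o ≡ o′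
    table Sign.+ Sign.+ Sign.+ = refl
    table Sign.+ Sign.+ Sign.- = refl
    table Sign.+ Sign.- Sign.+ = refl
    table Sign.+ Sign.- Sign.- = refl
    table Sign.- Sign.+ Sign.+ = refl
    table Sign.- Sign.+ Sign.- = refl
    table Sign.- Sign.- Sign.+ = refl
    table Sign.- Sign.- Sign.- = refl
  climb : ∀ s o o′ e → flipSign a ≡ o → Climb s a (e * 2 + (disagree o s + disagree o′ s) + a)
  climb s      o      o′     (suc e) eq = inj₁ (s≤s (m≤n+m a (suc (e * 2 + (disagree o s + disagree o′ s)))))
  climb Sign.+ Sign.+ Sign.+ zero    eq = inj₂ (refl , eq)
  climb Sign.- Sign.- Sign.- zero    eq = inj₂ (refl , eq)
  climb Sign.+ Sign.+ Sign.- zero    eq = inj₁ ≤-refl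
  climb Sign.+ Sign.- Sign.+ zero    eq = inj₁ ≤-refl
  climb Sign.- Sign.+ Sign.- zero    eq = inj₁ ≤-refl
  climb Sign.- Sign.- Sign.+ zero    eq = inj₁ ≤-refl
  climb Sign.+ Sign.- Sign.- zero    eq = inj₁ (m≤n⇒m≤1+n ≤-refl)
  climb Sign.- Sign.+ Sign.+ zero    eq = inj₁ (m≤n⇒m≤1+n ≤-refl)

-- Equal arguments fall under `Sign.-`; in the steps of a permutation the arguments are images of
-- distinct cards.
direction : ∀ {n} → Fin n → Fin n → Sign
direction i j with i Fin.<? j
... | yes _ = Sign.+
... | no  _ = Sign.-

towards⇒direction : ∀ {n} p {i j : Fin n} → Towards p i j → toSign p ≡ direction i j
towards⇒direction p {i} {j} t with i Fin.<? j
towards⇒direction 0ℙ t | yes _   = refl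
towards⇒direction 1ℙ t | no _    = refl
towards⇒direction 0ℙ t | no i≮j  = contradiction t i≮j
towards⇒direction 1ℙ t | yes i<j = contradiction t (<⇒≯ i<j)

direction⇒towards : ∀ {n} p {i j : Fin n} → i ≢ j → toSign p ≡ direction i j → Towards p i j
direction⇒towards p {i} {j} i≢j eq with i Fin.<? j
direction⇒towards 0ℙ i≢j eq | yes i<j = i<j
direction⇒towards 1ℙ i≢j eq | no i≮j  = ≤∧≢⇒< (≮⇒≥ i≮j) (i≢j ∘ sym ∘ Fin.toℕ-injective)
direction⇒towards 0ℙ i≢j () | no _
direction⇒towards 1ℙ i≢j () | yes _

inject₁<suc : ∀ {n} (k : Fin n) → inject₁ k Fin.< suc k
inject₁<suc k = s≤s (≤-reflexive (Fin.toℕ-inject₁ k))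

permutation-injective : ∀ {n} (σ : Permutation′ n) {i j} → σ ⟨$⟩ʳ i ≡ σ ⟨$⟩ʳ j → i ≡ j
permutation-injective σ eq = trans (sym (Perm.inverseˡ σ)) (trans (cong (σ ⟨$⟩ˡ_) eq) (Perm.inverseˡ σ))

consecutive⇒< : ∀ {m} (_∼_ : Fin (suc m) → Fin (suc m) → Set) → (∀ {i j k} → i ∼ j → j ∼ k → i ∼ k) →
                (∀ k → inject₁ k ∼ suc k) → ∀ {i j} → i Fin.< j → i ∼ j
consecutive⇒< _∼_ ∼-trans next {i} {j} = <-weakInduction (λ j → ∀ i → i Fin.< j → i ∼ j) (λ i ()) extend j i
  where
  extend : ∀ k → (∀ i → i Fin.< inject₁ k → i ∼ inject₁ k) → ∀ i → i Fin.< suc k → i ∼ suc k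
  extend k ih i i<k+1 with m≤n⇒m<n∨m≡n (≤-pred i<k+1)
  ... | inj₁ i<k = ∼-trans (ih i (subst (toℕ i <_) (sym (Fin.toℕ-inject₁ k)) i<k)) (next k)
  ... | inj₂ i≡k = subst (_∼ suc k) (Fin.toℕ-injective (trans (Fin.toℕ-inject₁ k) (sym i≡k))) (next k)

-- The hands from which an oriented permutation can be dealt

module _ {m : ℕ} where

  -- Prepends a virtual card 0, taken to be unflipped and in hand 0, so that the first card obeys
  -- the same rule as the others.
  before : {A : Set} → A → (Fin (suc m) → A) → Fin (suc m) → A
  before a f zero    = a
  before a f (suc k) = f (inject₁ k)

  -- The first step is up because the graph starts at height 0, below every position.
  step : Permutation′ (suc m) → Fin (suc m) → Sign
  step σ zero    = Sign.+
  step σ (suc k) = direction (σ ⟨$⟩ʳ inject₁ k) (σ ⟨$⟩ʳ suc k)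

  increment : Permutation′ (suc m) → (Fin (suc m) → Sign) → Fin (suc m) → ℕ
  increment σ o i = disagree (before Sign.+ o i) (step σ i) + disagree (o i) (step σ i)

  climbed : Permutation′ (suc m) → (Fin (suc m) → Sign) → (Fin (suc m) → ℕ) → Fin (suc m) → ℕ
  climbed σ o e = partialSum (λ i → e i * 2 + increment σ o i)

  climbed-before : ∀ σ o e i → climbed σ o e i ≡ e i * 2 + increment σ o i + before 0 (climbed σ o e) i
  climbed-before σ o e zero    = sym (+-identityʳ _)
  climbed-before σ o e (suc k) = partialSum-suc _ k

  module _ {σ : Permutation′ (suc m)} {o : Fin (suc m) → Sign} where

    -- The card received is monotone for `Precedes`, so the positions of consecutive cards are in
    -- that order, which says exactly that their hands climb. The excesses `e` are then read off
    -- step by step.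
    orientedRuffle⇒climbed : ∀ r → orientedRuffle r ≈± orient σ o → ∃ λ e → ∀ c → source r (σ ⟨$⟩ʳ c) ≡ climbed σ o e c
    orientedRuffle⇒climbed r eq = e , λ c → <-weakInduction (λ c → h c ≡ climbed σ o e c) base extend c
      where
      x = source r
      h : Fin (suc m) → ℕ
      h c = x (σ ⟨$⟩ʳ c)
      position : ∀ c → positionOf x c ≡ σ ⟨$⟩ʳ c
      position c = cong proj₂ (eq (Sign.+ , c))
      sign : ∀ c → flipSign (h c) ≡ o c
      sign c = trans (cong (flipSign ∘ x) (sym (position c))) (cong proj₁ (eq (Sign.+ , c)))
      cardAt-σ : ∀ c → cardAt x (σ ⟨$⟩ʳ c) ≡ c
      cardAt-σ c = trans (cong (cardAt x) (sym (position c))) (cardAt-positionOf x c)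
      climb : ∀ i → Climb (step σ i) (before 0 h i) (h i)
      climb zero with h zero in h₀
      ... | zero  = inj₂ (refl , refl)
      ... | suc _ = inj₁ (s≤s z≤n)
      climb (suc k) with precedes-total x (σ ⟨$⟩ʳ inject₁ k) (σ ⟨$⟩ʳ suc k)
      ... | inj₁ (inj₁ lt)       = inj₁ lt
      ... | inj₁ (inj₂ (eq , t)) = inj₂ (eq , towards⇒direction (parity (h (suc k))) t)
      ... | inj₂ (inj₁ eq)       = contradiction (cong toℕ (permutation-injective σ eq)) (<⇒≢ (inject₁<suc k))
      ... | inj₂ (inj₂ p)        = contradiction (subst₂ Fin._<_ (cardAt-σ (suc k)) (cardAt-σ (inject₁ k)) (cardAt-mono x p))
                                                 (<⇒≯ (inject₁<suc k))
      e : Fin (suc m) → ℕ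
      e i = proj₁ (climb⇒ (step σ i) (before 0 h i) (h i) (climb i))
      sign-before : ∀ i → flipSign (before 0 h i) ≡ before Sign.+ o i
      sign-before zero    = refl
      sign-before (suc k) = sign (inject₁ k)
      rise : ∀ i → h i ≡ e i * 2 + increment σ o i + before 0 h i
      rise i = trans (proj₂ (climb⇒ (step σ i) (before 0 h i) (h i) (climb i)))
        (cong₂ (λ s t → e i * 2 + (disagree s (step σ i) + disagree t (step σ i)) + before 0 h i) (sign-before i) (sign i))
      base : h zero ≡ climbed σ o e zero
      base = trans (rise zero) (+-identityʳ _)
      extend : ∀ k → h (inject₁ k) ≡ climbed σ o e (inject₁ k) → h (suc k) ≡ climbed σ o e (suc k)
      extend k ih = trans (rise (suc k)) (trans (cong (e (suc k) * 2 + increment σ o (suc k) +_) ih)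
                                              (sym (climbed-before σ o e (suc k))))

    -- The flips come out right by induction on the card, so consecutive cards occupy positions
    -- ordered by `Precedes`. Transitivity extends this to all cards, and `cardAt` is the only map
    -- monotone for that order.
    climbed⇒orientedRuffle : ∀ e r → (∀ c → source r (σ ⟨$⟩ʳ c) ≡ climbed σ o e c) → orientedRuffle r ≈± orient σ o
    climbed⇒orientedRuffle e r eq = ≈±-from (orientedRuffle r) (orient σ o) λ (t , i) →
      cong₂ _,_ (cong (t Sign.*_) (sign-at i)) (cardAt-unique x (σ ⟨$⟩ˡ_) order i)
      where
      x = source r
      h : Fin (suc m) → ℕ
      h c = x (σ ⟨$⟩ʳ c)
      rise : ∀ i → h i ≡ e i * 2 + increment σ o i + before 0 h i
      rise zero    = trans (eq zero) (climbed-before σ o e zero)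
      rise (suc k) = trans (eq (suc k)) (trans (climbed-before σ o e (suc k))
                       (cong (e (suc k) * 2 + increment σ o (suc k) +_) (sym (eq (inject₁ k)))))
      climb : ∀ i → flipSign (before 0 h i) ≡ before Sign.+ o i → flipSign (h i) ≡ o i × Climb (step σ i) (before 0 h i) (h i)
      climb i before-sign = subst (λ b → flipSign b ≡ o i × Climb (step σ i) (before 0 h i) b) (sym (rise i))
        (climb⇐ (step σ i) (before Sign.+ o i) (o i) (e i) (before 0 h i) before-sign)
      sign : ∀ c → flipSign (h c) ≡ o c
      sign = <-weakInduction (λ c → flipSign (h c) ≡ o c) (proj₁ (climb zero refl)) (λ k ih → proj₁ (climb (suc k) ih))
      sign-at : ∀ i → flipSign (x i) ≡ o (σ ⟨$⟩ˡ i)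
      sign-at i = trans (cong (flipSign ∘ x) (sym (Perm.inverseʳ σ))) (sign (σ ⟨$⟩ˡ i))
      consecutive : ∀ k → Precedes x (σ ⟨$⟩ʳ inject₁ k) (σ ⟨$⟩ʳ suc k)
      consecutive k with proj₂ (climb (suc k) (sign (inject₁ k)))
      ... | inj₁ lt       = inj₁ lt
      ... | inj₂ (eq , s) = inj₂ (eq , direction⇒towards (parity (h (suc k)))
              (λ e → <⇒≢ (inject₁<suc k) (cong toℕ (permutation-injective σ e))) s)
      precedes : ∀ {c d} → c Fin.< d → Precedes x (σ ⟨$⟩ʳ c) (σ ⟨$⟩ʳ d)
      precedes = consecutive⇒< (λ c d → Precedes x (σ ⟨$⟩ʳ c) (σ ⟨$⟩ʳ d))
        (λ {c} {d} {f} → precedes-trans x {σ ⟨$⟩ʳ c} {σ ⟨$⟩ʳ d} {σ ⟨$⟩ʳ f}) consecutive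
      order : ∀ {i j} → Precedes x i j → (σ ⟨$⟩ˡ i) Fin.< (σ ⟨$⟩ˡ j)
      order {i} {j} p with Fin.<-cmp (σ ⟨$⟩ˡ i) (σ ⟨$⟩ˡ j)
      ... | tri< lt _ _ = lt
      ... | tri≈ _ e _  = contradiction
                            (subst (Precedes x i) (trans (sym (Perm.inverseʳ σ)) (trans (cong (σ ⟨$⟩ʳ_) (sym e)) (Perm.inverseʳ σ))) p)
                            (precedes-irrefl x)
      ... | tri> _ _ gt = contradiction
                            (precedes-trans x {i} {j} {i} p (subst₂ (Precedes x) (Perm.inverseʳ σ) (Perm.inverseʳ σ) (precedes gt)))
                            (precedes-irrefl x)

-- The oriented rising number

least-unique : ∀ {P : Pred ℕ 0ℓ} {a b} → IsLeast P a → IsLeast P b → a ≡ b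
least-unique (pa , min-a) (pb , min-b) = ≤-antisym (min-a _ pb) (min-b _ pa)

isRuffle-resp : ∀ {n} {w v : OrientedPerm n} → w ≈± v → ∀ {a} → IsRuffle w a → IsRuffle v a
isRuffle-resp w≈v (r , eq , eq′) = r , eq , λ x → trans (eq′ x) (w≈v x)

isLeast-orientedRisingNumber : ∀ {n} (w : OrientedPerm n) → IsLeast (IsRuffle w) (orientedRisingNumber w)
isLeast-orientedRisingNumber w = proj₂ (orientedRisingNumber-exists w)

orientedRisingNumber-cong : ∀ {n} {w v : OrientedPerm n} → w ≈± v → orientedRisingNumber w ≡ orientedRisingNumber v
orientedRisingNumber-cong {w = w} {v} w≈v = ≤-antisym
  (proj₂ (isLeast-orientedRisingNumber w) _ (isRuffle-resp {w = v} {w} (sym ∘ w≈v) (proj₁ (isLeast-orientedRisingNumber v))))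
  (proj₂ (isLeast-orientedRisingNumber v) _ (isRuffle-resp {w = w} {v} w≈v (proj₁ (isLeast-orientedRisingNumber w))))

orientedRisingNumber≤hand : ∀ {n} (r : Ruffle n) {w} → orientedRuffle r ≈± w → orientedRisingNumber w ≤ hand r
orientedRisingNumber≤hand r {w} eq = proj₂ (isLeast-orientedRisingNumber w) (hand r) (r , refl , eq)

-- A ruffle attaining the minimum; its hand class is the leading one in the triangular families of
-- ruffles.
dealing : ∀ {n} → OrientedPerm n → Ruffle n
dealing w = proj₁ (proj₁ (isLeast-orientedRisingNumber w))

hand-dealing : ∀ {n} (w : OrientedPerm n) → hand (dealing w) ≡ orientedRisingNumber w
hand-dealing w = proj₁ (proj₂ (proj₁ (isLeast-orientedRisingNumber w)))

orientedRuffle-dealing : ∀ {n} (w : OrientedPerm n) → orientedRuffle (dealing w) ≈± w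
orientedRuffle-dealing w = proj₂ (proj₂ (proj₁ (isLeast-orientedRisingNumber w)))

module _ {m : ℕ} (σ : Permutation′ (suc m)) (o : Fin (suc m) → Sign) (e : Fin (suc m) → ℕ) where

  sum-climbed : sum (λ i → e i * 2 + increment σ o i) ≡ sum (λ i → e i * 2) + sum (increment σ o)
  sum-climbed = ∑-distrib-+ {suc m} (λ i → e i * 2) (increment σ o)

  climbed≤ : ∀ i → climbed σ o e i ≤ sum (λ i → e i * 2) + sum (increment σ o)
  climbed≤ i = subst (climbed σ o e i ≤_) sum-climbed (partialSum≤sum (λ i → e i * 2 + increment σ o i) i)

  -- The last card lies in the highest hand.
  last-hand : ∀ r → (∀ c → source r (σ ⟨$⟩ʳ c) ≡ climbed σ o e c) →
              sum (λ i → e i * 2) + sum (increment σ o) < hand r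
  last-hand r eq = subst (_< hand r)
    (trans (eq (fromℕ m)) (trans (partialSum-last (λ i → e i * 2 + increment σ o i)) sum-climbed))
    (source<hand r (σ ⟨$⟩ʳ fromℕ m))

  deal : ∀ a → sum (λ i → e i * 2) + sum (increment σ o) < a → Ruffle (suc m)
  deal a lt = record
    { hand        = a
    ; hand≥1      = ≤-trans (s≤s z≤n) lt
    ; source      = λ i → climbed σ o e (σ ⟨$⟩ˡ i)
    ; source<hand = λ i → ≤-<-trans (climbed≤ (σ ⟨$⟩ˡ i)) lt
    }

  source-deal : ∀ a lt c → source (deal a lt) (σ ⟨$⟩ʳ c) ≡ climbed σ o e c
  source-deal a lt c = cong (climbed σ o e) (Perm.inverseˡ σ)

module _ {m : ℕ} where

  -- Taking all excesses zero puts the last card in hand `sum (increment σ o)`, and no dealing can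
  -- put it lower. The successor accounts for hand 0.
  orientedRisingNumber-increment : ∀ (σ : Permutation′ (suc m)) o {w} → orient σ o ≈± w →
                                   orientedRisingNumber w ≡ suc (sum (increment σ o))
  orientedRisingNumber-increment σ o {w} oriented = least-unique (isLeast-orientedRisingNumber w) (attained , minimal)
    where
    none : ∀ n → sum {n} (λ _ → 0) ≡ 0
    none zero    = refl
    none (suc n) = none n
    lt : sum {suc m} (λ _ → 0) + sum (increment σ o) < suc (sum (increment σ o))
    lt = s≤s (≤-reflexive (cong (_+ sum (increment σ o)) (none (suc m))))
    attained : IsRuffle w (suc (sum (increment σ o)))
    attained = deal σ o (λ _ → 0) _ lt , refl , λ x → trans
      (climbed⇒orientedRuffle {σ = σ} {o} (λ _ → 0) (deal σ o (λ _ → 0) _ lt) (source-deal σ o (λ _ → 0) _ lt) x) (oriented x)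
    minimal : ∀ b → IsRuffle w b → suc (sum (increment σ o)) ≤ b
    minimal b (r , hand≡ , eq) = subst (suc (sum (increment σ o)) ≤_) hand≡
      (≤-<-trans (m≤n+m (sum (increment σ o)) (sum (λ i → proj₁ rise i * 2))) (last-hand σ o (proj₁ rise) r (proj₂ rise)))
      where rise = orientedRuffle⇒climbed {σ = σ} {o} r (λ x → trans (eq x) (sym (oriented x)))

  -- The number of ruffles dealing a given oriented permutation

  DealtTo : OrientedPerm (suc m) → Ruffle (suc m) → Set
  DealtTo w r = orientedRuffle r ≈± w

  dealtTo? : ∀ w → Decidable (DealtTo w)
  dealtTo? w r = DecMonoid._≈?_ (𝕊± (suc m)) (orientedRuffle r) w

  dealtTo-resp : ∀ w {r s} → r ≈ᴿ s → DealtTo w r → DealtTo w s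
  dealtTo-resp w {r} {s} (_ , r≡s) eq x = trans (sym (orientedRuffle-cong r s r≡s x)) (eq x)

  module _ (a : Ruffle (suc m)) where
    private
      ruffles = DecMonoid.setoid (RuffleMonoid (suc m))
    open Membership ruffles using (_∈_)
    open HandClasses (suc m)

    fibre : OrientedPerm (suc m) → List (Ruffle (suc m))
    fibre w = filter (dealtTo? w) (levelSet a)

    -- The ruffles giving an oriented permutation are described by where and by
    -- how much they exceed the least one, so the same excess can be dealt to any
    -- other oriented permutation of the same oriented rising number.
    length-fibre-≤ : ∀ (σ τ : Permutation′ (suc m)) (o p : Fin (suc m) → Sign) {w v} → orient σ o ≈± w → orient τ p ≈± v →
                     sum (increment σ o) ≡ sum (increment τ p) → length (fibre w) ≤ length (fibre v)
    length-fibre-≤ σ τ o p {w} {v} oriented-w oriented-v total≡ = pigeonhole ruffles ruffles SameExcess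
      (λ {r} {r′} {s} {s′} → injective {r} {r′} {s} {s′})
      (Unique.filter⁺ ruffles (dealtTo? w) (unique a)) (λ {r} → transfer {r})
      where
      SameExcess : Ruffle (suc m) → Ruffle (suc m) → Set
      SameExcess r s = hand r ≡ hand s × ∃ λ e →
        (∀ c → source r (σ ⟨$⟩ʳ c) ≡ climbed σ o e c) × (∀ c → source s (τ ⟨$⟩ʳ c) ≡ climbed τ p e c)
      injective : ∀ {r r′ s s′} → SameExcess r s → SameExcess r′ s′ → s ≈ᴿ s′ → r ≈ᴿ r′
      injective {r} {r′} {s} {s′} (a , e , eq , eq₁) (a′ , e′ , eq′ , eq₁′) (b , s≡s′) = trans a (trans b (sym a′)) , λ i →
        trans (cong (source r) (sym (Perm.inverseʳ σ))) (trans (same (σ ⟨$⟩ˡ i)) (cong (source r′) (Perm.inverseʳ σ)))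
        where
        doubles : ∀ i → e i * 2 ≡ e′ i * 2
        doubles i = +-cancelʳ-≡ (increment τ p i) _ _ (partialSum-injective _ _
          (λ c → trans (sym (eq₁ c)) (trans (s≡s′ _) (eq₁′ c))) i)
        same : ∀ c → source r (σ ⟨$⟩ʳ c) ≡ source r′ (σ ⟨$⟩ʳ c)
        same c = trans (eq c) (trans (partialSum-cong (λ i → cong (_+ increment σ o i) (doubles i)) c) (sym (eq′ c)))
          where
          partialSum-cong : ∀ {n} {f g : Fin n → ℕ} → (∀ i → f i ≡ g i) → ∀ i → partialSum f i ≡ partialSum g i
          partialSum-cong eq zero    = eq zero
          partialSum-cong eq (suc i) = cong₂ _+_ (eq zero) (partialSum-cong (eq ∘ suc) i)
      transfer-excess : ∀ {r} → r ∈ levelSet a → (∃ λ e → ∀ c → source r (σ ⟨$⟩ʳ c) ≡ climbed σ o e c) →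
                        ∃ λ s → s ∈ fibre v × SameExcess r s
      transfer-excess {r} r∈a (e , eq) = s ,
        ∈.∈-filter⁺ ruffles {DealtTo v} (dealtTo? v) (λ {r} {s} → dealtTo-resp v {r} {s}) {s} {levelSet a}
          (Equivalence.from (complete a s) (Equivalence.to (complete a r) r∈a))
          (λ x → trans (climbed⇒orientedRuffle {σ = τ} {p} e s (source-deal τ p e (hand r) lt) x) (oriented-v x)) ,
        (refl , e , eq , source-deal τ p e (hand r) lt)
        where
        -- The last card needs the same number of hands under τ as under σ, since both the excesses
        -- and the total increments agree.
        lt = subst (λ t → sum (λ i → e i * 2) + t < hand r) total≡ (last-hand σ o e r eq)
        s = deal τ p e (hand r) lt
      transfer : ∀ {r} → r ∈ fibre w → ∃ λ s → s ∈ fibre v × SameExcess r s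
      transfer {r} r∈ = transfer-excess {r} (proj₁ split)
        (orientedRuffle⇒climbed {σ = σ} {o} r (λ x → trans (proj₂ split x) (sym (oriented-w x))))
        where split = ∈.∈-filter⁻ ruffles {DealtTo w} (dealtTo? w) (λ {r} {s} → dealtTo-resp w {r} {s}) {r} {levelSet a} r∈

    length-fibre-cong : ∀ {w v} → orientedRisingNumber w ≡ orientedRisingNumber v → length (fibre w) ≡ length (fibre v)
    length-fibre-cong {w} {v} eq = ≤-antisym
      (length-fibre-≤ (π w) (π v) (orientation w) (orientation v) {w} {v} (orient-orientation w) (orient-orientation v) total≡)
      (length-fibre-≤ (π v) (π w) (orientation v) (orientation w) {v} {w} (orient-orientation v) (orient-orientation w) (sym total≡))
      where
      total≡ : sum (increment (π w) (orientation w)) ≡ sum (increment (π v) (orientation v))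
      total≡ = suc-injective (trans (sym (orientedRisingNumber-increment (π w) (orientation w) {w} (orient-orientation w)))
        (trans eq (orientedRisingNumber-increment (π v) (orientation v) {v} (orient-orientation v))))

-- Turns

-- A function on ℕ stands for a generating function in z; this multiplies it by the power of z with
-- exponent given by the first argument.
shift : ℕ → (ℕ → ℕ) → ℕ → ℕ
shift zero    c k       = c k
shift (suc d) c zero    = 0
shift (suc d) c (suc k) = shift d c k

-- The coefficient at `k` of the sum over `xs` of z to the power `f x`.
count : {A : Set} → (A → ℕ) → List A → ℕ → ℕ
count f xs k = length (filter (λ x → f x ≟ k) xs)

count-map-++ : ∀ {A B : Set} (f : B → ℕ) (g : A → B) xs ys k → count f (map g xs ++ ys) k ≡ count (f ∘ g) xs k + count f ys k
count-map-++ f g []       ys k = refl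
count-map-++ f g (x ∷ xs) ys k with does (f (g x) ≟ k)
... | true  = cong suc (count-map-++ f g xs ys k)
... | false = count-map-++ f g xs ys k

count-shift : ∀ {A : Set} d (f : A → ℕ) xs k → count (λ x → d + f x) xs k ≡ shift d (count f xs) k
count-shift zero    f xs k       = refl
count-shift (suc d) f xs zero    = none xs
  where
  none : ∀ xs → count (λ x → suc (d + f x)) xs 0 ≡ 0
  none []       = refl
  none (x ∷ xs) = none xs
count-shift (suc d) f xs (suc k) = trans
  (cong length (filter-≐ (λ x → suc (d + f x) ≟ suc k) (λ x → d + f x ≟ k) (suc-injective , cong suc) xs))
  (count-shift d f xs k)

shift-cong : ∀ d {c c′} → (∀ k → c k ≡ c′ k) → ∀ k → shift d c k ≡ shift d c′ k
shift-cong zero    eq k       = eq k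
shift-cong (suc d) eq zero    = refl
shift-cong (suc d) eq (suc k) = shift-cong d eq k

-- Multiplication of a generating function by 1 + z² and by 2z.
flat turn : (ℕ → ℕ) → ℕ → ℕ
flat c k = c k + shift 2 c k
turn c k = shift 1 c k + shift 1 c k

flat-turn : ∀ c k → flat (turn c) k ≡ turn (flat c) k
flat-turn c zero                = refl
flat-turn c (suc zero)          = trans (+-identityʳ _) (sym (cong₂ _+_ (+-identityʳ (c 0)) (+-identityʳ (c 0))))
flat-turn c (suc (suc zero))    = trans (+-identityʳ _) (sym (cong₂ _+_ (+-identityʳ (c 1)) (+-identityʳ (c 1))))
flat-turn c (suc (suc (suc k))) = interchange (c (suc (suc k))) (c (suc (suc k))) (c k) (c k)
  where open import Algebra.Properties.CommutativeSemigroup +-commutativeSemigroup using (interchange)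

-- The total increment regrouped by card: each card is compared with the step leading to it and the
-- step leaving it, the last card with the former alone.
excess : ∀ {m} → (Fin (suc m) → Sign) → (Fin (suc m) → Sign) → ℕ
excess {zero}  s o = disagree (o zero) (s zero)
excess {suc m} s o = disagree (o zero) (s zero) + disagree (o zero) (s (suc zero)) + excess (s ∘ suc) (o ∘ suc)

turns : ∀ {m} → (Fin (suc m) → Sign) → ℕ
turns {zero}  s = 0
turns {suc m} s = disagree (s zero) (s (suc zero)) + turns (s ∘ suc)

turns-cong : ∀ {m} {s t : Fin (suc m) → Sign} → (∀ i → s i ≡ t i) → turns s ≡ turns t
turns-cong {zero}  eq = refl
turns-cong {suc m} eq = cong₂ _+_ (cong₂ disagree (eq zero) (eq (suc zero))) (turns-cong (eq ∘ suc))

disagree≤1 : ∀ s t → disagree s t ≤ 1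
disagree≤1 Sign.+ Sign.+ = z≤n
disagree≤1 Sign.- Sign.- = z≤n
disagree≤1 Sign.+ Sign.- = ≤-refl
disagree≤1 Sign.- Sign.+ = ≤-refl

disagree-triangle : ∀ o s t → disagree s t ≤ disagree o s + disagree o t
disagree-triangle Sign.+ Sign.+ t      = ≤-refl
disagree-triangle Sign.- Sign.- t      = ≤-refl
disagree-triangle Sign.+ Sign.- Sign.+ = s≤s z≤n
disagree-triangle Sign.+ Sign.- Sign.- = z≤n
disagree-triangle Sign.- Sign.+ Sign.+ = z≤n
disagree-triangle Sign.- Sign.+ Sign.- = s≤s z≤n

turns≤ : ∀ {m} (s : Fin (suc m) → Sign) → turns s ≤ m
turns≤ {zero}  s = z≤n
turns≤ {suc m} s = +-mono-≤ (disagree≤1 (s zero) (s (suc zero))) (turns≤ (s ∘ suc))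

-- No orientation agrees with both neighbouring steps at a turn, so each turn costs at least 1.
turns≤excess : ∀ {m} (s o : Fin (suc m) → Sign) → turns s ≤ excess s o
turns≤excess {zero}  s o = z≤n
turns≤excess {suc m} s o = +-mono-≤ (disagree-triangle (o zero) (s zero) (s (suc zero))) (turns≤excess (s ∘ suc) (o ∘ suc))

-- When each card is oriented along the step leading to it, disagreement can come only from the step
-- leaving it, and this happens precisely at the turns.
excess-refl : ∀ {m} (s : Fin (suc m) → Sign) → excess s s ≡ turns s
excess-refl {zero}  s = disagree-refl (s zero)
excess-refl {suc m} s = cong₂ _+_ (cong (_+ disagree (s zero) (s (suc zero))) (disagree-refl (s zero))) (excess-refl (s ∘ suc))

excess-cong : ∀ {m} (s : Fin (suc m) → Sign) {o p} → (∀ i → o i ≡ p i) → excess s o ≡ excess s p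
excess-cong {zero}  s eq = cong (λ t → disagree t (s zero)) (eq zero)
excess-cong {suc m} s eq = cong₂ _+_
  (cong (λ t → disagree t (s zero) + disagree t (s (suc zero))) (eq zero))
  (excess-cong (s ∘ suc) (eq ∘ suc))

-- The coefficients of (1 + z) (2z)ᵗ (1 + z²)ᵐ⁻ᵗ.
distribution : ℕ → ℕ → ℕ → ℕ
distribution zero    t       zero          = 1
distribution zero    t       (suc zero)    = 1
distribution zero    t       (suc (suc k)) = 0
distribution (suc m) zero    = flat (distribution m zero)
distribution (suc m) (suc t) = turn (distribution m t)

-- The recursion for `distribution` strips the turn factors before the flat ones, while turns and
-- non-turns occur among the cards in any order; `flat-turn` moves the new flat factor inwards. The
-- bound `t ≤ m` keeps all turn factors present.
flat-distribution : ∀ {m t} → t ≤ m → ∀ k → flat (distribution m t) k ≡ distribution (suc m) t k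
flat-distribution {m}     {zero}  le       k = refl
flat-distribution {suc m} {suc t} (s≤s le) k = trans (flat-turn (distribution m t) k)
  (cong₂ _+_ (shift-cong 1 (flat-distribution le) k) (shift-cong 1 (flat-distribution le) k))

count-excess : ∀ {m} (s : Fin (suc m) → Sign) k → count (excess s) (functionList signs (suc m)) k ≡ distribution m (turns s) k
count-excess {zero} s k with s zero
count-excess {zero} s zero          | Sign.+ = refl
count-excess {zero} s (suc zero)    | Sign.+ = refl
count-excess {zero} s (suc (suc k)) | Sign.+ = refl
count-excess {zero} s zero          | Sign.- = refl
count-excess {zero} s (suc zero)    | Sign.- = refl
count-excess {zero} s (suc (suc k)) | Sign.- = refl
count-excess {suc m} s k = begin
  count (excess s) (map (Sign.+ Vector.∷_) fl ++ (map (Sign.- Vector.∷_) fl ++ [])) k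
    ≡⟨ trans (count-map-++ (excess s) (Sign.+ Vector.∷_) fl _ k)
         (cong (count (λ o → weight Sign.+ + excess s′ o) fl k +_)
           (trans (count-map-++ (excess s) (Sign.- Vector.∷_) fl [] k) (+-identityʳ _))) ⟩
  count (λ o → weight Sign.+ + excess s′ o) fl k + count (λ o → weight Sign.- + excess s′ o) fl k
    ≡⟨ cong₂ _+_ (shifted Sign.+) (shifted Sign.-) ⟩
  shift (weight Sign.+) (distribution m (turns s′)) k + shift (weight Sign.-) (distribution m (turns s′)) k
    ≡⟨ combine (s zero) (s (suc zero)) ⟩
  distribution (suc m) (turns s) k ∎
  where
  open ≡-Reasoning
  fl = functionList signs (suc m)
  s′ = s ∘ suc
  weight : Sign → ℕ
  weight t = disagree t (s zero) + disagree t (s (suc zero))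
  shifted : ∀ t → count (λ o → weight t + excess s′ o) fl k ≡ shift (weight t) (distribution m (turns s′)) k
  shifted t = trans (count-shift (weight t) (excess s′) fl k) (shift-cong (weight t) (count-excess s′) k)
  combine : ∀ a b → shift (disagree Sign.+ a + disagree Sign.+ b) (distribution m (turns s′)) k
                  + shift (disagree Sign.- a + disagree Sign.- b) (distribution m (turns s′)) k
                  ≡ distribution (suc m) (disagree a b + turns s′) k
  combine Sign.+ Sign.+ = flat-distribution (turns≤ s′) k
  combine Sign.- Sign.- = trans (+-comm (shift 2 (distribution m (turns s′)) k) _) (flat-distribution (turns≤ s′) k)
  combine Sign.+ Sign.- = refl
  combine Sign.- Sign.+ = refl

-- The virtual card 0 drops out because its orientation and the first step are both `Sign.+`.
sum-increment : ∀ {m} (σ : Permutation′ (suc m)) o → sum (increment σ o) ≡ excess (step σ) o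
sum-increment σ o = sum-disagree Sign.+ (step σ) o
  where
  -- The orientation `p` before the first card is left general: in the tail it is that of the card
  -- just passed.
  sum-disagree : ∀ {m} p (s o : Fin (suc m) → Sign) →
    sum (λ i → disagree (before p o i) (s i) + disagree (o i) (s i)) ≡ disagree p (s zero) + excess s o
  sum-disagree {zero}  p s o = +-identityʳ _
  sum-disagree {suc m} p s o = begin
    disagree p (s zero) + disagree (o zero) (s zero) +
      sum (λ i → disagree (o (inject₁ i)) (s (suc i)) + disagree (o (suc i)) (s (suc i)))
      ≡⟨ cong (disagree p (s zero) + disagree (o zero) (s zero) +_)
           (trans (sum-cong-≗ earlier) (sum-disagree (o zero) (s ∘ suc) (o ∘ suc))) ⟩
    disagree p (s zero) + disagree (o zero) (s zero) + (disagree (o zero) (s (suc zero)) + excess (s ∘ suc) (o ∘ suc))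
      ≡⟨ +-assoc (disagree p (s zero)) _ _ ⟩
    disagree p (s zero) + (disagree (o zero) (s zero) + (disagree (o zero) (s (suc zero)) + excess (s ∘ suc) (o ∘ suc)))
      ≡⟨ cong (disagree p (s zero) +_) (+-assoc (disagree (o zero) (s zero)) _ _) ⟨
    disagree p (s zero) + (disagree (o zero) (s zero) + disagree (o zero) (s (suc zero)) + excess (s ∘ suc) (o ∘ suc)) ∎
    where
    open ≡-Reasoning
    earlier : ∀ i → disagree (o (inject₁ i)) (s (suc i)) + disagree (o (suc i)) (s (suc i)) ≡
                    disagree (before (o zero) (o ∘ suc) i) (s (suc i)) + disagree (o (suc i)) (s (suc i))
    earlier zero    = refl
    earlier (suc i) = refl

-- The map `f` lets the induction move to the tail of the list of points while the predicate stays
-- on the original index set.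
length-filter-turns : ∀ {l m} {P : Pred (Fin m) 0ℓ} (P? : Decidable P) (f : Fin l → Fin m) (s : Fin (suc l) → Sign) →
  (∀ k → P (f k) → disagree (s (inject₁ k)) (s (suc k)) ≡ 1) →
  (∀ k → ¬ P (f k) → disagree (s (inject₁ k)) (s (suc k)) ≡ 0) →
  length (filter P? (tabulate f)) ≡ turns s
length-filter-turns {zero}  P? f s on off = refl
length-filter-turns {suc l} P? f s on off with P? (f zero)
... | yes t = trans (cong suc (length-filter-turns P? (f ∘ suc) (s ∘ suc) (on ∘ suc) (off ∘ suc)))
                    (cong (_+ turns (s ∘ suc)) (sym (on zero t)))
... | no ¬t = trans (length-filter-turns P? (f ∘ suc) (s ∘ suc) (on ∘ suc) (off ∘ suc))
                    (cong (_+ turns (s ∘ suc)) (sym (off zero ¬t)))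

-- Turning points as changes of direction

module _ {m : ℕ} (σ : Permutation′ (suc m)) where

  Rise Fall : Fin (suc m) → Set
  Rise i = height σ (inject₁ i) < height σ (suc i) × step σ i ≡ Sign.+
  Fall i = height σ (suc i) < height σ (inject₁ i) × step σ i ≡ Sign.-

  rise-or-fall : ∀ i → Rise i ⊎ Fall i
  rise-or-fall zero    = inj₁ (s≤s z≤n , refl)
  rise-or-fall (suc k) with (σ ⟨$⟩ʳ inject₁ k) Fin.<? (σ ⟨$⟩ʳ suc k)
  ... | yes lt = inj₁ (s≤s lt , refl)
  ... | no ≮   = inj₂ (s≤s (≤∧≢⇒< (≮⇒≥ ≮) (λ eq → <⇒≢ (inject₁<suc k)
                   (sym (cong toℕ (permutation-injective σ (Fin.toℕ-injective eq)))))) , refl)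

  turning⇒disagree : ∀ k → IsTurningPoint σ k → disagree (step σ (inject₁ k)) (step σ (suc k)) ≡ 1
  turning⇒disagree k t with rise-or-fall (inject₁ k) | rise-or-fall (suc k) | t
  ... | inj₁ (_ , eq) | inj₂ (_ , eq′) | _              = cong₂ disagree eq eq′
  ... | inj₂ (_ , eq) | inj₁ (_ , eq′) | _              = cong₂ disagree eq eq′
  ... | inj₁ (lt , _) | inj₁ (lt′ , _) | inj₁ (_ , gt)  = contradiction gt (<⇒≯ lt′)
  ... | inj₁ (lt , _) | inj₁ (lt′ , _) | inj₂ (gt , _)  = contradiction gt (<⇒≯ lt)
  ... | inj₂ (gt , _) | inj₂ (gt′ , _) | inj₁ (lt , _)  = contradiction gt (<⇒≯ lt)
  ... | inj₂ (gt , _) | inj₂ (gt′ , _) | inj₂ (_ , lt)  = contradiction gt′ (<⇒≯ lt)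

  nonturning⇒agree : ∀ k → ¬ IsTurningPoint σ k → disagree (step σ (inject₁ k)) (step σ (suc k)) ≡ 0
  nonturning⇒agree k ¬t with rise-or-fall (inject₁ k) | rise-or-fall (suc k)
  ... | inj₁ (_ , eq)  | inj₁ (_ , eq′)  = cong₂ disagree eq eq′
  ... | inj₂ (_ , eq)  | inj₂ (_ , eq′)  = cong₂ disagree eq eq′
  ... | inj₁ (lt , _)  | inj₂ (gt , _)   = contradiction (inj₁ (lt , gt)) ¬t
  ... | inj₂ (gt , _)  | inj₁ (lt , _)   = contradiction (inj₂ (gt , lt)) ¬t

  turningNumber-turns : turningNumber σ ≡ turns (step σ)
  turningNumber-turns = length-filter-turns (isTurningPoint? σ) (λ k → k) (step σ) turning⇒disagree nonturning⇒agree

module _ {m : ℕ} where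

  direction-cong : ∀ {n} {i i′ j j′ : Fin n} → i ≡ i′ → j ≡ j′ → direction i j ≡ direction i′ j′
  direction-cong refl refl = refl

  turningNumber-cong : ∀ {σ τ : Permutation′ (suc m)} → σ Perm.≈ τ → turningNumber σ ≡ turningNumber τ
  turningNumber-cong {σ} {τ} σ≈τ = trans (turningNumber-turns σ) (trans (turns-cong steps) (sym (turningNumber-turns τ)))
    where
    steps : ∀ i → step σ i ≡ step τ i
    steps zero    = refl
    steps (suc k) = direction-cong (σ≈τ (inject₁ k)) (σ≈τ (suc k))

  orientedRisingNumber-excess : ∀ (σ : Permutation′ (suc m)) o {w} → orient σ o ≈± w →
                                orientedRisingNumber w ≡ suc (excess (step σ) o)
  orientedRisingNumber-excess σ o {w} oriented =
    trans (orientedRisingNumber-increment σ o {w} oriented) (cong suc (sum-increment σ o))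

  turningNumber<orientedRisingNumber : ∀ (w : OrientedPerm (suc m)) → turningNumber (π w) < orientedRisingNumber w
  turningNumber<orientedRisingNumber w = subst₂ _<_ (sym (turningNumber-turns (π w)))
    (sym (orientedRisingNumber-excess (π w) (orientation w) {w} (orient-orientation w)))
    (s≤s (turns≤excess (step (π w)) (orientation w)))

  orientedRisingNumber-step : ∀ (σ : Permutation′ (suc m)) {w} → orient σ (step σ) ≈± w →
                              orientedRisingNumber w ≡ suc (turningNumber σ)
  orientedRisingNumber-step σ {w} oriented = trans (orientedRisingNumber-excess σ (step σ) {w} oriented)
    (cong suc (trans (excess-refl (step σ)) (sym (turningNumber-turns σ))))

-- The classes of the turning number

ruffle-cong : ∀ {n} {r s : Ruffle n} → r ≈ᴿ s → ruffle r Perm.≈ ruffle s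
ruffle-cong {r = r} {s} (_ , eq) i = cong proj₂ (orientedRuffle-cong r s eq (Sign.+ , i))

ruffle-*ᴿ : ∀ {n} (r s : Ruffle n) → ruffle (r *ᴿ s) Perm.≈ DecMonoid._∙_ (𝕊 n) (ruffle r) (ruffle s)
ruffle-*ᴿ r s i = cong proj₂ (orientedRuffle-*ᴿ r s (Sign.+ , i))

ruffle-1ᴿ : ∀ {n} → ruffle {n} 1ᴿ Perm.≈ Perm.id
ruffle-1ᴿ i = trans (cong (positionOf (source 1ᴿ)) (sym (cardAt-1ᴿ i))) (positionOf-cardAt (source 1ᴿ) i)

π-cong : ∀ {n} {w v : OrientedPerm n} → w ≈± v → π w Perm.≈ π v
π-cong eq i = cong proj₂ (eq (Sign.+ , i))

-- The flip made by `w` can be forgotten before applying `v`, because an odd map acts on absolute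
-- values.
π-∙ : ∀ {n} (w v : OrientedPerm n) → π (DecMonoid._∙_ (𝕊± n) w v) Perm.≈ DecMonoid._∙_ (𝕊 n) (π w) (π v)
π-∙ w v i = cong proj₂ (odd-* (OrientedPerm.to v) (odd v) _ _)

ruffle-isMonoidHomomorphism : ∀ n →
  MonoidMorphisms.IsMonoidHomomorphism (DecMonoid.rawMonoid (RuffleMonoid n)) (DecMonoid.rawMonoid (𝕊 n)) ruffle
ruffle-isMonoidHomomorphism n = record
  { isMagmaHomomorphism = record
    { isRelHomomorphism = record { cong = λ {r} {s} → ruffle-cong {n} {r} {s} }
    ; homo              = ruffle-*ᴿ
    }
  ; ε-homo = ruffle-1ᴿ
  }

π-isMonoidHomomorphism : ∀ n →
  MonoidMorphisms.IsMonoidHomomorphism (DecMonoid.rawMonoid (𝕊± n)) (DecMonoid.rawMonoid (𝕊 n)) π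
π-isMonoidHomomorphism n = record
  { isMagmaHomomorphism = record
    { isRelHomomorphism = record { cong = λ {w} {v} → π-cong {n} {w} {v} }
    ; homo              = π-∙
    }
  ; ε-homo = λ _ → refl
  }

-- The three triangular families and the theorem

module Turning (m : ℕ) where
  private
    n = suc m
    ruffles = DecMonoid.setoid (RuffleMonoid n)
    module ℚ[𝕊] = MonoidAlgebra (𝕊 n)
    module ℚ[𝕊±] = MonoidAlgebra (𝕊± n)
    module ∫𝕊 = Pairing (𝕊 n)
    module 𝕊-Sums = ClassSums (𝕊 n)
    module 𝕊±-Sums = ClassSums (𝕊± n)
    𝕊±-setoid = DecMonoid.setoid (𝕊± n)
    𝕊-setoid = DecMonoid.setoid (𝕊 n)
    rising-cong : ∀ {w v} → w ≈± v → orientedRisingNumber w ≡ orientedRisingNumber v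
    rising-cong {w} {v} = orientedRisingNumber-cong {n} {w} {v}
    turning-cong : ∀ {σ τ : Permutation′ n} → σ Perm.≈ τ → turningNumber σ ≡ turningNumber τ
    turning-cong {σ} {τ} = turningNumber-cong {m} {σ} {τ}

  open HandClasses n
  module Oriented = Image (𝕊± n) orientedRuffle (λ {r} {s} (_ , eq) → orientedRuffle-cong r s eq) orientedRuffle-*ᴿ
  module Unoriented = Image (𝕊 n) ruffle (λ {r} {s} → ruffle-cong {n} {r} {s}) ruffle-*ᴿ

  risingLevelSets : ℚ[𝕊±].FiniteLevelSets orientedRisingNumber
  risingLevelSets = 𝕊±-Sums.enumeratedLevelSets (λ {w} {v} → rising-cong {w} {v}) (orientedPermutations n)

  turningLevelSets : ℚ[𝕊].FiniteLevelSets turningNumber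
  turningLevelSets = 𝕊-Sums.enumeratedLevelSets (λ {σ} {τ} → turning-cong {σ} {τ}) (permutations n)

  module Rising = ℚ[𝕊±].FiniteLevelSets risingLevelSets

  π-imageSum : OrientedPerm n → ℚ[𝕊].ℚ[M]
  π-imageSum w = ℚ[𝕊].sumOf (map π (Rising.levelSet w))

  private
    Rising-IsTriangular : {J : Set} → (J → ℚ[𝕊±].ℚ[M]) → Set
    Rising-IsTriangular = 𝕊±-Sums.IsTriangular (λ {w} {v} → rising-cong {w} {v}) (orientedPermutations n)
    Turning-IsTriangular : {J : Set} → (J → ℚ[𝕊].ℚ[M]) → Set
    Turning-IsTriangular = 𝕊-Sums.IsTriangular (λ {σ} {τ} → turning-cong {σ} {τ}) (permutations n)

  someHand : ∀ {P : Pred (Ruffle n) 0ℓ} {C : Set} r → Any P (levelSet r) → (∀ s → hand s ≡ hand r → P s → C) → C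
  someHand r any k = let (s , s∈ , p) = Membership.find ruffles any in k s (Equivalence.to (complete r s) s∈) p

  turningNumber<risingOver : ∀ w {σ} → π w Perm.≈ σ → turningNumber σ < orientedRisingNumber w
  turningNumber<risingOver w {σ} eq =
    subst (_< orientedRisingNumber w) (turning-cong {π w} {σ} eq) (turningNumber<orientedRisingNumber w)

  dealing∈ : ∀ r → Membership._∈_ ruffles r (levelSet r)
  dealing∈ r = Equivalence.from (complete r r) refl

  -- The coefficient at `w` counts the ruffles of the class that deal `w`. With just enough hands
  -- for `w`, nothing of larger oriented rising number can be dealt.
  orientedRuffle-triangular : Rising-IsTriangular Oriented.imageSum
  orientedRuffle-triangular = record
    { classFunction = λ r {w} {v} eq → trans (𝕊±-Sums.coefficient-image orientedRuffle (levelSet r) w)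
        (trans (cong fromℕℚ (length-fibre-cong r {w} {v} eq)) (sym (𝕊±-Sums.coefficient-image orientedRuffle (levelSet r) v)))
    ; leading   = dealing
    ; leading≢0 = λ w → 𝕊±-Sums.coefficient-image-≢0 orientedRuffle {levelSet (dealing w)} {w}
        (Any.map (λ {s} (_ , eq) x → trans (sym (orientedRuffle-cong (dealing w) s eq x)) (orientedRuffle-dealing w x))
                 (dealing∈ (dealing w)))
    ; above≡0   = λ {w} {v} lt → 𝕊±-Sums.coefficient-image-≡0 orientedRuffle {levelSet (dealing w)} {v} (above w v lt)
    }
    where
    above : ∀ w v → orientedRisingNumber w < orientedRisingNumber v → ¬ Any (λ s → orientedRuffle s ≈± v) (levelSet (dealing w))
    above w v lt any = someHand {λ s → orientedRuffle s ≈± v} (dealing w) any λ s hand≡ eq →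
      <⇒≱ lt (subst (orientedRisingNumber v ≤_) (trans hand≡ (hand-dealing w)) (orientedRisingNumber≤hand s {v} eq))

  π-fibre : OrientedPerm n → Permutation′ n → List (OrientedPerm n)
  π-fibre w σ = filter (λ v → DecMonoid._≈?_ (𝕊 n) (π v) σ) (Rising.levelSet w)

  -- Over σ, an oriented permutation is the same as an orientation of each card. The two lists are
  -- enumerated up to different equalities, so the count is compared by injective relations both
  -- ways.
  length-π-fibre : ∀ w σ k → orientedRisingNumber w ≡ suc k → length (π-fibre w σ) ≡ distribution m (turningNumber σ) k
  length-π-fibre w σ k rising≡ = begin
    length (π-fibre w σ)
      ≡⟨ ≤-antisym
           (pigeonhole 𝕊±-setoid signings (λ v o → orient σ o ≈± v)
             (λ eq eq′ o≡ x → trans (sym (eq x)) (trans (orient-cong {n} {σ} {σ} (λ _ → refl) o≡ x) (eq′ x)))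
             (Unique.filter⁺ 𝕊±-setoid over? (Rising.unique w)) (λ {v} → orientationOf {v}))
           (pigeonhole signings 𝕊±-setoid (λ o v → orient σ o ≈± v)
             (λ eq eq′ v≈ → proj₂ (orient-injective {n} {σ} {σ} (λ x → trans (eq x) (trans (v≈ x) (sym (eq′ x))))))
             (Unique.filter⁺ signings right? (Enumeration.distinct (functions signs n))) oriented) ⟩
    count (excess (step σ)) (functionList signs n) k
      ≡⟨ count-excess (step σ) k ⟩
    distribution m (turns (step σ)) k
      ≡⟨ cong (λ t → distribution m t k) (turningNumber-turns σ) ⟨
    distribution m (turningNumber σ) k ∎
    where
    open ≡-Reasoning
    signings = Fin n →-setoid Sign
    Over : OrientedPerm n → Set
    Over v = π v Perm.≈ σ
    over? : Decidable Over
    over? v = DecMonoid._≈?_ (𝕊 n) (π v) σ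
    over-resp : ∀ {v u} → v ≈± u → Over v → Over u
    over-resp {v} {u} v≈u eq i = trans (sym (π-cong {n} {v} {u} v≈u i)) (eq i)
    Right : (Fin n → Sign) → Set
    Right o = excess (step σ) o ≡ k
    right? : Decidable Right
    right? o = excess (step σ) o ≟ k
    right-resp : ∀ {o p} → (∀ i → o i ≡ p i) → Right o → Right p
    right-resp o≡p eq = trans (sym (excess-cong (step σ) o≡p)) eq
    orientationOf : ∀ {v} → Membership._∈_ 𝕊±-setoid v (π-fibre w σ) →
      ∃ λ o → Membership._∈_ signings o (filter right? (functionList signs n)) × orient σ o ≈± v
    orientationOf {v} v∈ = orientation v ,
      ∈.∈-filter⁺ signings {Right} right? right-resp (Enumeration.covers (functions signs n) (orientation v))
        (suc-injective (trans (sym (orientedRisingNumber-excess σ (orientation v) {v} eq))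
                              (trans (Equivalence.to (Rising.complete w v) (proj₁ split)) rising≡))) ,
      eq
      where
      split = ∈.∈-filter⁻ 𝕊±-setoid {Over} over? (λ {v} {u} → over-resp {v} {u}) {v} {Rising.levelSet w} v∈
      eq : orient σ (orientation v) ≈± v
      eq x = trans (orient-cong {n} {σ} {π v} {orientation v} {orientation v} (λ i → sym (proj₂ split i)) (λ _ → refl) x)
                   (orient-orientation v x)
    contains : ∀ o v → orient σ o ≈± v → Right o → Membership._∈_ 𝕊±-setoid v (π-fibre w σ)
    contains o v eq right = ∈.∈-filter⁺ 𝕊±-setoid {Over} over? (λ {v} {u} → over-resp {v} {u}) {v} {Rising.levelSet w}
      (Equivalence.from (Rising.complete w v) (trans (orientedRisingNumber-excess σ o {v} eq) (trans (cong suc right) (sym rising≡))))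
      (λ i → sym (cong proj₂ (eq (Sign.+ , i))))
    oriented : ∀ {o} → Membership._∈_ signings o (filter right? (functionList signs n)) →
      ∃ λ v → Membership._∈_ 𝕊±-setoid v (π-fibre w σ) × orient σ o ≈± v
    oriented {o} o∈ = orient σ o , contains o (orient σ o) (λ _ → refl) excess≡ , λ _ → refl
      where
      excess≡ : excess (step σ) o ≡ k
      excess≡ = proj₂ (∈.∈-filter⁻ signings {Right} right? right-resp {o} {functionList signs n} o∈)

  -- Among the oriented permutations over σ this one has the least oriented rising number.
  upright : Permutation′ n → OrientedPerm n
  upright σ = orient σ (step σ)

  rising-upright : ∀ σ → orientedRisingNumber (upright σ) ≡ suc (turningNumber σ)
  rising-upright σ = orientedRisingNumber-step σ {upright σ} (λ _ → refl)

  -- The fibre counts depend on σ through its turning number. Everything over τ has oriented rising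
  -- number above `turningNumber τ`, so the class of `upright σ`, at `suc (turningNumber σ)`, misses
  -- every τ with more turning points.
  π-triangular : Turning-IsTriangular π-imageSum
  π-triangular = record
    { classFunction = λ w {σ} {τ} eq → begin
        ℚ[𝕊].coefficient (π-imageSum w) σ
          ≡⟨ 𝕊-Sums.coefficient-image π (Rising.levelSet w) σ ⟩
        fromℕℚ (length (π-fibre w σ))
          ≡⟨ cong fromℕℚ (trans (length-π-fibre w σ _ (rising≡ w)) (trans
               (cong (λ t → distribution m t (excess (step (π w)) (orientation w))) eq)
               (sym (length-π-fibre w τ _ (rising≡ w))))) ⟩
        fromℕℚ (length (π-fibre w τ))
          ≡⟨ 𝕊-Sums.coefficient-image π (Rising.levelSet w) τ ⟨
        ℚ[𝕊].coefficient (π-imageSum w) τ ∎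
    ; leading   = upright
    ; leading≢0 = λ σ → 𝕊-Sums.coefficient-image-≢0 π {Rising.levelSet (upright σ)} {σ}
        (Any.map (λ {v} eq i → sym (π-cong {n} {upright σ} {v} eq i))
                 (Equivalence.from (Rising.complete (upright σ) (upright σ)) refl))
    ; above≡0   = λ {σ} {τ} lt → 𝕊-Sums.coefficient-image-≡0 π {Rising.levelSet (upright σ)} {τ} (above σ τ lt)
    }
    where
    open ≡-Reasoning
    rising≡ : ∀ w → orientedRisingNumber w ≡ suc (excess (step (π w)) (orientation w))
    rising≡ w = orientedRisingNumber-excess (π w) (orientation w) {w} (orient-orientation w)
    above : ∀ σ τ → turningNumber σ < turningNumber τ → ¬ Any (λ v → π v Perm.≈ τ) (Rising.levelSet (upright σ))
    above σ τ lt any = let (v , v∈ , eq) = Membership.find 𝕊±-setoid {P = λ v → π v Perm.≈ τ} any in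
      <⇒≱ lt (≤-pred (subst (turningNumber τ <_) (trans (Equivalence.to (Rising.complete (upright σ) v) v∈) (rising-upright σ))
        (turningNumber<risingOver v {τ} eq)))

  -- The oriented image of a hand class is a combination of class sums of the oriented rising
  -- number, and π takes each of those to a class function. For the vanishing, a ruffle giving τ has
  -- more than `turningNumber τ` hands, while the leading class has `suc (turningNumber σ)`.
  ruffle-triangular : Turning-IsTriangular Unoriented.imageSum
  ruffle-triangular = record
    { classFunction = λ r {σ} {τ} eq → trans (cong (λ u → ℚ[𝕊].coefficient u σ) (sym (push-image r)))
        (trans (image-isClassFunction r {σ} {τ} eq) (cong (λ u → ℚ[𝕊].coefficient u τ) (push-image r)))
    ; leading   = dealing ∘ upright
    ; leading≢0 = λ σ → 𝕊-Sums.coefficient-image-≢0 ruffle {levelSet (dealing (upright σ))} {σ}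
        (Any.map (λ {s} eq i → trans (sym (ruffle-cong {n} {dealing (upright σ)} {s} eq i))
                                     (π-cong {n} {orientedRuffle (dealing (upright σ))} {upright σ}
                                       (orientedRuffle-dealing (upright σ)) i))
                 (dealing∈ (dealing (upright σ))))
    ; above≡0   = λ {σ} {τ} lt → 𝕊-Sums.coefficient-image-≡0 ruffle {levelSet (dealing (upright σ))} {τ} (above σ τ lt)
    }
    where
    push : ℚ[𝕊±].ℚ[M] → ℚ[𝕊].ℚ[M]
    push = pushforward (𝕊± n) (𝕊 n) π (λ {w} {v} → π-cong {n} {w} {v})
    push-linear : IsLinear (𝕊± n) (𝕊 n) push
    push-linear = pushforward-linear (𝕊± n) (𝕊 n) π (λ {w} {v} → π-cong {n} {w} {v})
    push-sum : ∀ ws → push (ℚ[𝕊±].sumOf ws) ≡ ℚ[𝕊].sumOf (map π ws)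
    push-sum = pushforward-sumOf (𝕊± n) (𝕊 n) π (λ {w} {v} → π-cong {n} {w} {v})
    push-image : ∀ r → push (Oriented.imageSum r) ≡ Unoriented.imageSum r
    push-image r = trans (push-sum (map orientedRuffle (levelSet r))) (cong ℚ[𝕊].sumOf (sym (map-∘ (levelSet r))))
    IsTurningFunction : Pred ℚ[𝕊].ℚ[M] 0ℓ
    IsTurningFunction = 𝕊-Sums.IsClassFunction (λ {σ} {τ} → turning-cong {σ} {τ}) (permutations n)
    image-isClassFunction : ∀ r → IsTurningFunction (push (Oriented.imageSum r))
    image-isClassFunction r = Pairing.span-least (𝕊± n) Rising.classSum {IsTurningFunction ∘ push}
      (preimage-isSubspace push-linear (𝕊-Sums.classFunctions-isSubspace (λ {σ} {τ} → turning-cong {σ} {τ}) (permutations n)))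
      (λ w {σ} {τ} eq → trans (cong (λ u → ℚ[𝕊].coefficient u σ) (push-sum (Rising.levelSet w)))
        (trans (𝕊-Sums.IsTriangular.classFunction π-triangular w {σ} {τ} eq)
               (cong (λ u → ℚ[𝕊].coefficient u τ) (sym (push-sum (Rising.levelSet w))))))
      {Oriented.imageSum r}
      (𝕊±-Sums.toClassSums (λ {w} {v} → rising-cong {w} {v}) (orientedPermutations n) orientedRuffle-triangular risingLevelSets
        {Oriented.imageSum r} (Pairing.span-generator (𝕊± n) Oriented.imageSum r))
    above : ∀ σ τ → turningNumber σ < turningNumber τ → ¬ Any (λ s → ruffle s Perm.≈ τ) (levelSet (dealing (upright σ)))
    above σ τ lt any = someHand {λ s → ruffle s Perm.≈ τ} (dealing (upright σ)) any λ s hand≡ eq →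
      <⇒≱ lt (≤-pred (subst (turningNumber τ <_) (trans hand≡ (trans (hand-dealing (upright σ)) (rising-upright σ)))
        (≤-trans (turningNumber<risingOver (orientedRuffle s) {τ} eq) (orientedRisingNumber≤hand s {orientedRuffle s} (λ _ → refl)))))

  ruffle-doesTheRightThing : DoesTheRightThing (RuffleMonoid n) (𝕊 n) hand turningNumber ruffle
  ruffle-doesTheRightThing = record
    { isMonoidHomomorphism = ruffle-isMonoidHomomorphism n
    ; isLumping            = hand-isLumping
    ; finiteLevelSets      = turningLevelSets
    ; belong               = λ r → 𝕊-Sums.toClassSums (λ {σ} {τ} → turning-cong {σ} {τ}) (permutations n)
        ruffle-triangular turningLevelSets
        {Unoriented.imageSum r} (Pairing.span-generator (𝕊 n) Unoriented.imageSum r)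
    ; span                 = λ {u} → 𝕊-Sums.fromClassSums (λ {σ} {τ} → turning-cong {σ} {τ}) (permutations n)
        ruffle-triangular turningLevelSets {u}
    }

  risingNumber-isLumping : ℚ[𝕊±].IsLumping orientedRisingNumber
  risingNumber-isLumping = 𝕊±-Sums.triangular⇒lumping (λ {w} {v} → rising-cong {w} {v}) (orientedPermutations n)
    orientedRuffle-triangular risingLevelSets Oriented.imageSums-closed

  π-doesTheRightThing : DoesTheRightThing (𝕊± n) (𝕊 n) orientedRisingNumber turningNumber π
  π-doesTheRightThing = record
    { isMonoidHomomorphism = π-isMonoidHomomorphism n
    ; isLumping            = risingNumber-isLumping
    ; finiteLevelSets      = turningLevelSets
    ; belong               = λ w → 𝕊-Sums.toClassSums (λ {σ} {τ} → turning-cong {σ} {τ}) (permutations n)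
        π-triangular turningLevelSets
        {π-imageSum w} (Pairing.span-generator (𝕊 n) π-imageSum w)
    ; span                 = λ {u} → 𝕊-Sums.fromClassSums (λ {σ} {τ} → turning-cong {σ} {τ}) (permutations n)
        π-triangular turningLevelSets {u}
    }

  turningNumber-isLumping : ℚ[𝕊].IsLumping turningNumber
  turningNumber-isLumping = 𝕊-Sums.triangular⇒lumping (λ {σ} {τ} → turning-cong {σ} {τ}) (permutations n)
    ruffle-triangular turningLevelSets Unoriented.imageSums-closed

  turningAlgebra-isCommutative : ℚ[𝕊].IsCommutative (ℚ[𝕊].IsLumping.algebra turningNumber-isLumping)
  turningAlgebra-isCommutative {u} {v} = 𝕊-Sums.triangular⇒commutative (λ {σ} {τ} → turning-cong {σ} {τ}) (permutations n)
    ruffle-triangular turningLevelSets Unoriented.imageSums-commute {u} {v}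

mainTheorem3 : (n : ℕ) → 1 ≤ n →
    DoesTheRightThing (RuffleMonoid n) (𝕊 n) hand turningNumber ruffle
    × DoesTheRightThing (𝕊± n) (𝕊 n) orientedRisingNumber turningNumber π
    × (Σ[ turning ∈ MonoidAlgebra.IsLumping (𝕊 n) turningNumber ]
    MonoidAlgebra.IsCommutative (𝕊 n) (MonoidAlgebra.IsLumping.algebra turning))
mainTheorem3 (suc m) _ =
  ruffle-doesTheRightThing , π-doesTheRightThing , turningNumber-isLumping , λ {u} {v} → turningAlgebra-isCommutative {u} {v}
  where open Turning m
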